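{- There is a function $f$ such that every instance of $P||C_{\max}$ with $n$ jobs, $m$ machines and integer processing times bounded by $p_{\max}$ can be solved optimally in time $f(p_{\max})\cdot(n+\log m)^{O(1)}$.
   Context: $P||C_{\max}$: given $m$ identical machines and a set $J$ of $n$ jobs, each job $j$ with positive integer processing time $p_j$ and released at time $0$, assign each job non-preemptively to a machine so as to minimize the makespan (maximum total processing time on a machine). $p_{\max}:=\max_j p_j$. -}

module Defs where

open import Data.Bool using (Bool; true; false; if_then_else_)
open import Data.Fin using (Fin; toℕ)
import Data.Fin.Properties as Fin
open import Data.List using (List; []; _∷_; tabulate)
open import Data.List.Extrema.Nat using (max)
open import Data.Nat using (ℕ; suc; _+_; _≤_; _<_; _≡ᵇ_)
open import Data.Nat.Binary using (ℕᵇ; 2[1+_]; 1+[2_]; fromℕ)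
import Data.Nat.Binary as ℕᵇ
open import Data.Nat.ListAction using (sum)
open import Data.Product using (Σ-syntax; ∃-syntax; _×_)
open import Relation.Binary.PropositionalEquality using (_≡_)
open import Relation.Nullary using (does)

record Instance : Set where
  field
    m   : ℕ
    n   : ℕ
    p   : Fin n → ℕ
    0<m : 0 < m
    0<p : ∀ j → 0 < p j

  -- The maximum over an empty job set is taken to be 0.
  pmax : ℕ
  pmax = max 0 (tabulate p)

  Schedule : Set
  Schedule = Fin n → Fin m

  load : Schedule → Fin m → ℕ
  load s i = sum (tabulate λ j → if does (s j Fin.≟ i) then p j else 0)

  makespan : Schedule → ℕ
  makespan s = max 0 (tabulate (load s))

  Optimal : Schedule → Set
  Optimal s = ∀ s′ → makespan s ≤ makespan s′

-- Model of computation: the WHILE language over binary trees (N. D. Jones,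
-- "Computability and Complexity from a Programming Perspective", 1997).
-- Every operation is a constant number of pointer manipulations and is
-- charged accordingly.  There is no built-in arithmetic and no built-in
-- equality test on trees; the only test is "is this tree nil?".  Running
-- times are polynomially related to those of multi-tape Turing machines and
-- of logarithmic-cost random access machines.

data Tree : Set where
  nil  : Tree
  cons : Tree → Tree → Tree

hd tl : Tree → Tree
hd nil        = nil
hd (cons a b) = a
tl nil        = nil
tl (cons a b) = b

-- nil is false, every other tree is true.
truth : Tree → Bool
truth nil        = false
truth (cons _ _) = true

Var : Set
Var = ℕ

data Expr : Set where
  `var    : Var → Expr
  `nil    : Expr
  `cons   : Expr → Expr → Expr
  `hd `tl : Expr → Expr

infix  6 _:=_
infixr 5 _⨾_

data Cmd : Set where
  skip  : Cmd
  _:=_  : Var → Expr → Cmd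
  _⨾_   : Cmd → Cmd → Cmd
  if    : Expr → Cmd → Cmd → Cmd
  while : Expr → Cmd → Cmd

Store : Set
Store = Var → Tree

_[_↦_] : Store → Var → Tree → Store
(σ [ x ↦ v ]) y = if x ≡ᵇ y then v else σ y

eval : Expr → Store → Tree
eval (`var x)    σ = σ x
eval `nil        σ = nil
eval (`cons e f) σ = cons (eval e σ) (eval f σ)
eval (`hd e)     σ = hd (eval e σ)
eval (`tl e)     σ = tl (eval e σ)

evalTime : Expr → ℕ
evalTime (`var x)    = 1
evalTime `nil        = 1
evalTime (`cons e f) = suc (evalTime e + evalTime f)
evalTime (`hd e)     = suc (evalTime e)
evalTime (`tl e)     = suc (evalTime e)

-- c ⊢ σ ⇓ τ ∶ t : started in σ, the command c halts in τ after time t.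
infix 4 _⊢_⇓_∶_

data _⊢_⇓_∶_ : Cmd → Store → Store → ℕ → Set where
  ⇓-skip   : ∀ {σ} →
             skip ⊢ σ ⇓ σ ∶ 1
  ⇓-assign : ∀ {x e σ} →
             x := e ⊢ σ ⇓ σ [ x ↦ eval e σ ] ∶ suc (evalTime e)
  ⇓-seq    : ∀ {c d ρ σ τ s t} →
             c ⊢ ρ ⇓ σ ∶ s → d ⊢ σ ⇓ τ ∶ t →
             c ⨾ d ⊢ ρ ⇓ τ ∶ s + t
  ⇓-then   : ∀ {e c d σ τ t} → truth (eval e σ) ≡ true →
             c ⊢ σ ⇓ τ ∶ t →
             if e c d ⊢ σ ⇓ τ ∶ suc (evalTime e) + t
  ⇓-else   : ∀ {e c d σ τ t} → truth (eval e σ) ≡ false →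
             d ⊢ σ ⇓ τ ∶ t →
             if e c d ⊢ σ ⇓ τ ∶ suc (evalTime e) + t
  ⇓-stop   : ∀ {e c σ} → truth (eval e σ) ≡ false →
             while e c ⊢ σ ⇓ σ ∶ suc (evalTime e)
  ⇓-loop   : ∀ {e c ρ σ τ s t} → truth (eval e ρ) ≡ true →
             c ⊢ ρ ⇓ σ ∶ s → while e c ⊢ σ ⇓ τ ∶ t →
             while e c ⊢ ρ ⇓ τ ∶ suc (evalTime e) + (s + t)

-- The input is placed in variable 0, all other variables being nil; the
-- output is the final value of variable 0.
initial : Tree → Store
initial input = (λ _ → nil) [ 0 ↦ input ]

_on_outputs_inTime_ : Cmd → Tree → Tree → ℕ → Set
c on input outputs output inTime t =
  ∃[ τ ] c ⊢ initial input ⇓ τ ∶ t × τ 0 ≡ output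

-- Numbers are written in binary (the library's bijective base 2), least
-- significant digit first, so a number k occupies Θ(log k) nodes.
encodeℕᵇ : ℕᵇ → Tree
encodeℕᵇ ℕᵇ.zero   = nil
encodeℕᵇ 2[1+ b ]  = cons (cons nil nil) (encodeℕᵇ b)
encodeℕᵇ 1+[2 b ]  = cons nil (encodeℕᵇ b)

encodeℕ : ℕ → Tree
encodeℕ k = encodeℕᵇ (fromℕ k)

encodeList : List Tree → Tree
encodeList []       = nil
encodeList (t ∷ ts) = cons t (encodeList ts)

encodeInstance : Instance → Tree
encodeInstance I = cons (encodeℕ m) (encodeList (tabulate λ j → encodeℕ (p j)))
  where open Instance I

encodeSchedule : (I : Instance) → Instance.Schedule I → Tree
encodeSchedule I s = encodeList (tabulate λ j → encodeℕ (toℕ (s j)))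

_solvesOptimallyWithin_ : Cmd → (Instance → ℕ) → Set
c solvesOptimallyWithin T = (I : Instance) → let open Instance I in
  Σ[ s ∈ Schedule ] Optimal s ×
  ∃[ t ] t ≤ T I × c on encodeInstance I outputs encodeSchedule I s inTime t

{-# OPTIONS --safe #-}
-- Let q be the largest processing time and L = q!, so that every size divides
-- L.  With at least as many machines as jobs the optimum is q; hence at most n
-- machines matter and all numbers may be kept in unary.  A makespan T is written
-- as T₀ + t L with T₀ < (q + 1) L, and with T₀ ≥ q L unless t = 0.  Jobs of total
-- size more than q L contain, by pigeonhole, equal jobs of total size exactly L,
-- so a machine of load ≤ T is a configuration of load ≤ T₀ together with t blocks
-- of load ≤ L, and blocks may be exchanged between machines.  Configurations and
-- blocks are the columns of a linear system over the naturals whose matrix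
-- depends on q and T₀ only.  Writing its solution in binary, least significant
-- digit first, the carries stay in a box whose size depends on q only, so a
-- dynamic program over pairs (digit position, carry) solves it.
--
-- Programs are written in a total functional language compiled to WHILE.  Their
-- running time is polynomial in the largest number of iterations of a loop, and
-- this number is a function of q whenever the input size is.

module Submission where

open import Data.Bool using (Bool; true; false; if_then_else_; T)
open import Data.Empty using (⊥; ⊥-elim)
open import Data.Fin using (Fin; toℕ; fromℕ<)
import Data.Fin as Fin
import Data.Fin.Properties as Finₚ
open import Data.List using (List; []; _∷_; _++_; foldr; length; map; replicate; zip; tabulate; upTo; cartesianProductWith)
open import Data.List.Extrema.Nat using (max≤v⁺; xs≤max)
open import Data.List.Membership.Propositional using (_∈_)
open import Data.List.Membership.Propositional.Properties using (∈-upTo⁺; ∈-cartesianProductWith⁺; ∈-++⁺ˡ; ∈-++⁺ʳ; ∈-++⁻; ∈-tabulate⁺)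
open import Data.List.Properties using (length-++; length-map; length-tabulate; map-tabulate; tabulate-cong)
open import Data.List.Relation.Unary.All as All using (All; []; _∷_)
open import Data.List.Relation.Unary.All.Properties using (++⁺; replicate⁺; map⁺; map⁻; tabulate⁺; tabulate⁻)
open import Data.List.Relation.Unary.Any using (here; there)
open import Data.Nat
open import Data.Nat.Binary using (ℕᵇ; 2[1+_]; 1+[2_]; fromℕ; fromℕ')
import Data.Nat.Binary as ℕᵇ
open import Data.Nat.Binary.Properties using (toℕ-fromℕ; fromℕ≡fromℕ')
open import Data.Nat.Divisibility using (_∣_; divides; ∣m⇒∣m*n; ∣n⇒∣m*n; ∣-refl)
open import Data.Nat.ListAction using (sum)
open import Data.Nat.Logarithm using (⌊log₂_⌋; ⌊log₂⌋-mono-≤; ⌊log₂[2^n]⌋≡n)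
open import Data.Nat.Properties
open import Data.Nat.Tactic.RingSolver using (solve-∀)
open import Data.Product using (Σ-syntax; ∃-syntax; _×_; _,_; proj₁; proj₂)
open import Data.Sum using (_⊎_; inj₁; inj₂)
open import Data.Unit using (⊤; tt)
open import Function using (_∘_; id)
open import Relation.Binary.PropositionalEquality
open import Relation.Nullary using (yes; no; ¬_; does)
open import Defs

-- A total functional language

-- The exponent of n must not depend on q, which rules out a table of all vectors of job counts: it
-- has about n ^ q entries. Digits remove this obstacle. Halving all multiplicities of a solution
-- leaves a remainder r with at most one copy of each column, so if W is the total length of all
-- columns, a carry c of length at most W leads to a carry (c + r) / 2 of length at most (W + W) / 2
-- = W. For W to depend on q alone, T may enter the matrix only through T₀, and t only through the
-- right-hand side. The condition T₀ ≥ q L is what lets blocks be peeled off one at a time: a load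
-- above T₀ + (t - 1) L is above q L, which is where pigeonhole yields a block. Two extra rows, 0
-- and q + 1, count configurations and blocks, so that all equations have the same form. The
-- programs that build and test columns, carries and moves see only inputs bounded in terms of q;
-- their cost is a maximum over finitely many inputs and is never computed explicitly.

infixr 6 _⊗_
infix  4 _∋_
infixr 5 _▸_

data Ty : Set where
  nat bool : Ty
  list     : Ty → Ty
  _⊗_      : Ty → Ty → Ty

Ctx : Set
Ctx = List Ty

Val : Ty → Set
Val nat      = ℕ
Val bool     = Bool
Val (list A) = List (Val A)
Val (A ⊗ B)  = Val A × Val B

Env : Ctx → Set
Env []      = ⊤
Env (A ∷ Γ) = Val A × Env Γ

data _∋_ : Ctx → Ty → Set where
  first : ∀ {A Γ} → A ∷ Γ ∋ A
  later : ∀ {A B Γ} → Γ ∋ A → B ∷ Γ ∋ A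

-- `call` evaluates its body in a fresh environment made of the arguments alone. A subprogram is
-- therefore analysed once, as a term over its own context, and the result applies at every call
-- site.
data Tm (Γ : Ctx) : Ty → Set
data Args (Γ : Ctx) : Ctx → Set

data Tm Γ where
  var     : ∀ {A} → Γ ∋ A → Tm Γ A
  `0      : Tm Γ nat
  `suc    : Tm Γ nat → Tm Γ nat
  `case   : ∀ {A} → Tm Γ nat → Tm Γ A → Tm (nat ∷ Γ) A → Tm Γ A
  `loop   : ∀ {A} → Tm (nat ∷ A ∷ Γ) A → Tm Γ A → Tm Γ nat → Tm Γ A
  `t `f   : Tm Γ bool
  `if     : ∀ {A} → Tm Γ bool → Tm Γ A → Tm Γ A → Tm Γ A
  `[]     : ∀ {A} → Tm Γ (list A)
  _`∷_    : ∀ {A} → Tm Γ A → Tm Γ (list A) → Tm Γ (list A)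
  `foldr  : ∀ {A B} → Tm (A ∷ B ∷ Γ) B → Tm Γ B → Tm Γ (list A) → Tm Γ B
  _`,_    : ∀ {A B} → Tm Γ A → Tm Γ B → Tm Γ (A ⊗ B)
  `fst    : ∀ {A B} → Tm Γ (A ⊗ B) → Tm Γ A
  `snd    : ∀ {A B} → Tm Γ (A ⊗ B) → Tm Γ B
  `let    : ∀ {A B} → Tm Γ A → Tm (A ∷ Γ) B → Tm Γ B
  call    : ∀ {Δ A} → Tm Δ A → Args Γ Δ → Tm Γ A

data Args Γ where
  ∅   : Args Γ []
  _▸_ : ∀ {A Δ} → Tm Γ A → Args Γ Δ → Args Γ (A ∷ Δ)

infixr 5 _`∷_
infixr 4 _`,_

-- The index runs through n - 1, …, 1, 0.
countdown : {X : Set} → (ℕ → X → X) → ℕ → X → X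
countdown f zero    a = a
countdown f (suc k) a = countdown f k (f k a)

natCase : {X : Set} → X → (ℕ → X) → ℕ → X
natCase z s zero    = z
natCase z s (suc k) = s k

look : ∀ {Γ A} → Γ ∋ A → Env Γ → Val A
look first      (v , ρ) = v
look (later x) (v , ρ) = look x ρ

⟦_⟧  : ∀ {Γ A} → Tm Γ A → Env Γ → Val A
⟦_⟧* : ∀ {Γ Δ} → Args Γ Δ → Env Γ → Env Δ

⟦ var x ⟧ ρ        = look x ρ
⟦ `0 ⟧ ρ           = 0
⟦ `suc t ⟧ ρ       = suc (⟦ t ⟧ ρ)
⟦ `case t u v ⟧ ρ  = natCase (⟦ u ⟧ ρ) (λ k → ⟦ v ⟧ (k , ρ)) (⟦ t ⟧ ρ)
⟦ `loop b z t ⟧ ρ  = countdown (λ k a → ⟦ b ⟧ (k , a , ρ)) (⟦ t ⟧ ρ) (⟦ z ⟧ ρ)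
⟦ `t ⟧ ρ           = true
⟦ `f ⟧ ρ           = false
⟦ `if t u v ⟧ ρ    = if ⟦ t ⟧ ρ then ⟦ u ⟧ ρ else ⟦ v ⟧ ρ
⟦ `[] ⟧ ρ          = []
⟦ t `∷ u ⟧ ρ       = ⟦ t ⟧ ρ ∷ ⟦ u ⟧ ρ
⟦ `foldr b z t ⟧ ρ = foldr (λ x a → ⟦ b ⟧ (x , a , ρ)) (⟦ z ⟧ ρ) (⟦ t ⟧ ρ)
⟦ t `, u ⟧ ρ       = ⟦ t ⟧ ρ , ⟦ u ⟧ ρ
⟦ `fst t ⟧ ρ       = proj₁ (⟦ t ⟧ ρ)
⟦ `snd t ⟧ ρ       = proj₂ (⟦ t ⟧ ρ)
⟦ `let t u ⟧ ρ     = ⟦ u ⟧ (⟦ t ⟧ ρ , ρ)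
⟦ call t ts ⟧ ρ    = ⟦ t ⟧ (⟦ ts ⟧* ρ)

⟦ ∅ ⟧* ρ      = tt
⟦ t ▸ ts ⟧* ρ = ⟦ t ⟧ ρ , ⟦ ts ⟧* ρ

loopPeak : {X : Set} → (ℕ → X → X) → (ℕ → X → ℕ) → ℕ → X → ℕ
loopPeak f c zero    a = 0
loopPeak f c (suc k) a = c k a ⊔ loopPeak f c k (f k a)

foldPeak : {A X : Set} → (A → X → X) → (A → X → ℕ) → X → List A → ℕ
foldPeak f c z []       = 0
foldPeak f c z (x ∷ xs) = c x (foldr f z xs) ⊔ foldPeak f c z xs

-- The largest number of iterations of a single loop during the evaluation.
peak  : ∀ {Γ A} → Tm Γ A → Env Γ → ℕ
peak* : ∀ {Γ Δ} → Args Γ Δ → Env Γ → ℕ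

peak (var x) ρ        = 0
peak `0 ρ             = 0
peak (`suc t) ρ       = peak t ρ
peak (`case t u v) ρ  = peak t ρ ⊔ natCase (peak u ρ) (λ k → peak v (k , ρ)) (⟦ t ⟧ ρ)
peak (`loop b z t) ρ  = peak t ρ ⊔ (peak z ρ ⊔ (⟦ t ⟧ ρ ⊔
                          loopPeak (λ k a → ⟦ b ⟧ (k , a , ρ)) (λ k a → peak b (k , a , ρ)) (⟦ t ⟧ ρ)
                            (⟦ z ⟧ ρ)))
peak `t ρ             = 0
peak `f ρ             = 0
-- Both branches count, whichever is taken, which spares a case distinction on the test in later
-- bounds. For a case on numbers this is impossible, since the second branch needs the predecessor.
peak (`if t u v) ρ    = peak t ρ ⊔ (peak u ρ ⊔ peak v ρ)
peak `[] ρ            = 0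
peak (t `∷ u) ρ       = peak t ρ ⊔ peak u ρ
peak (`foldr b z t) ρ = peak t ρ ⊔ (peak z ρ ⊔ (length (⟦ t ⟧ ρ) ⊔
                          foldPeak (λ x a → ⟦ b ⟧ (x , a , ρ)) (λ x a → peak b (x , a , ρ)) (⟦ z ⟧ ρ)
                            (⟦ t ⟧ ρ)))
peak (t `, u) ρ       = peak t ρ ⊔ peak u ρ
peak (`fst t) ρ       = peak t ρ
peak (`snd t) ρ       = peak t ρ
peak (`let t u) ρ     = peak t ρ ⊔ peak u (⟦ t ⟧ ρ , ρ)
peak (call t ts) ρ    = peak* ts ρ ⊔ peak t (⟦ ts ⟧* ρ)

peak* ∅ ρ        = 0
peak* (t ▸ ts) ρ = peak* ts ρ ⊔ peak t ρ

-- Compilation to WHILE programs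

-- Variable 0 receives the result, variable 1 holds the environment and
-- variable 2 a stack; both are restored on exit.

enc : ∀ A → Val A → Tree
enc nat zero          = nil
enc nat (suc k)       = cons nil (enc nat k)
enc bool false        = nil
enc bool true         = cons nil nil
enc (list A) []       = nil
enc (list A) (x ∷ xs) = cons (enc A x) (enc (list A) xs)
enc (A ⊗ B) (a , b)   = cons (enc A a) (enc B b)

encEnv : ∀ Γ → Env Γ → Tree
encEnv []      tt      = nil
encEnv (A ∷ Γ) (v , ρ) = cons (enc A v) (encEnv Γ ρ)

#0 #1 #2 : Expr
#0 = `var 0
#1 = `var 1
#2 = `var 2

path : ∀ {Γ A} → Γ ∋ A → Expr → Expr
path first      e = `hd e
path (later x) e = path x (`tl e)

-- The top of the stack holds the state of the current loop, a counter or the list still to be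
-- consumed. A list gives up its elements from the head while `foldr` combines from the last element
-- on, hence the preliminary reversal.
push bind₂ unbind₂ drop reverseStep : Cmd
push        = 2 := `cons #0 #2
bind₂       = 1 := `cons (`hd #2) (`cons #0 #1)
unbind₂     = 1 := `tl (`tl #1)
drop        = 2 := `tl #2
reverseStep = 2 := `cons (`cons (`hd #0) (`hd #2)) (`tl #2) ⨾ 0 := `tl #0

loopBody foldBody : Cmd → Cmd
loopBody c = 2 := `cons (`tl (`hd #2)) (`tl #2) ⨾ bind₂ ⨾ c ⨾ unbind₂
foldBody c = 1 := `cons (`hd (`hd #2)) (`cons #0 #1) ⨾ 2 := `cons (`tl (`hd #2)) (`tl #2) ⨾ c ⨾ unbind₂

compile  : ∀ {Γ A} → Tm Γ A → Cmd
compile* : ∀ {Γ Δ} → Args Γ Δ → Cmd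

compile (var x)        = 0 := path x #1
compile `0             = 0 := `nil
compile (`suc t)       = compile t ⨾ 0 := `cons `nil #0
compile (`case t u v)  = compile t ⨾ if #0 (1 := `cons (`tl #0) #1 ⨾ compile v ⨾ 1 := `tl #1) (compile u)
compile (`loop b z t)  = compile t ⨾ push ⨾ compile z ⨾ while (`hd #2) (loopBody (compile b)) ⨾ drop
compile `t             = 0 := `cons `nil `nil
compile `f             = 0 := `nil
compile (`if t u v)    = compile t ⨾ if #0 (compile u) (compile v)
compile `[]            = 0 := `nil
compile (t `∷ u)       = compile t ⨾ push ⨾ compile u ⨾ 0 := `cons (`hd #2) #0 ⨾ drop
compile (`foldr b z t) = compile t ⨾ 2 := `cons `nil #2 ⨾ while #0 reverseStep ⨾ compile z ⨾
                         while (`hd #2) (foldBody (compile b)) ⨾ drop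
compile (t `, u)       = compile t ⨾ push ⨾ compile u ⨾ 0 := `cons (`hd #2) #0 ⨾ drop
compile (`fst t)       = compile t ⨾ 0 := `hd #0
compile (`snd t)       = compile t ⨾ 0 := `tl #0
compile (`let t u)     = compile t ⨾ 1 := `cons #0 #1 ⨾ compile u ⨾ 1 := `tl #1
-- The argument environment, built on top of the stack, changes places with the environment of the
-- caller, which waits on the stack until the body has run.
compile (call t ts)    = compile* ts ⨾ 0 := `hd #2 ⨾ 2 := `cons #1 (`tl #2) ⨾ 1 := #0 ⨾
                         compile t ⨾ 1 := `hd #2 ⨾ drop

compile* ∅        = 2 := `cons `nil #2
compile* (t ▸ ts) = compile* ts ⨾ compile t ⨾ 2 := `cons (`cons #0 (`hd #2)) (`tl #2)

-- Running time when no single loop makes more than M iterations.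
time  : ∀ {Γ A} → Tm Γ A → ℕ → ℕ
time* : ∀ {Γ Δ} → Args Γ Δ → ℕ → ℕ

time (var x) M        = suc (evalTime (path x #1))
time `0 M             = 2
time (`suc t) M       = time t M + 4
time (`case t u v) M  = time t M + (2 + (time u M + (5 + (time v M + 3))))
time (`loop b z t) M  = time t M + (4 + (time z M + ((3 + M * (21 + time b M)) + 3)))
time `t M             = 4
time `f M             = 2
time (`if t u v) M    = time t M + (2 + (time u M + time v M))
time `[] M            = 2
time (t `∷ u) M       = time t M + (4 + (time u M + (5 + 3)))
time (`foldr b z t) M = time t M + (4 + ((2 + M * 14) + (time z M + ((M * (22 + time b M) + 3) + 3))))
time (t `, u) M       = time t M + (4 + (time u M + (5 + 3)))
time (`fst t) M       = time t M + 3
time (`snd t) M       = time t M + 3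
time (`let t u) M     = time t M + (4 + (time u M + 3))
time (call t ts) M    = time* ts M + (3 + (5 + (2 + (time t M + (3 + 3)))))

time* ∅ M        = 4
time* (t ▸ ts) M = time* ts M + (time t M + 8)

-- Final stores are described by their values at the variables 0, 1 and 2 only. Stores are
-- functions, and an equation between them would call for extensionality.
record Run (c : Cmd) (σ : Store) (v₀ v₁ v₂ : Tree) (B : ℕ) : Set where
  constructor mkRun
  field
    {τ}  : Store
    {t}  : ℕ
    run  : c ⊢ σ ⇓ τ ∶ t
    t≤B  : t ≤ B
    res₀ : τ 0 ≡ v₀
    res₁ : τ 1 ≡ v₁
    res₂ : τ 2 ≡ v₂

-- Correctness and running time of compiled programs

path-eval : ∀ {Γ A} (x : Γ ∋ A) ρ e σ → eval e σ ≡ encEnv Γ ρ →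
            eval (path x e) σ ≡ enc A (look x ρ)
path-eval first      (v , ρ) e σ eq rewrite eq = refl
path-eval (later x) (v , ρ) e σ eq = path-eval x ρ (`tl e) σ (cong tl eq)

module _ {Γ : Ctx} {A : Ty} (b : Tm (nat ∷ A ∷ Γ) A) (ρ : Env Γ) (M : ℕ)
  (IH : ∀ k a σ → peak b (k , a , ρ) ≤ M → σ 1 ≡ encEnv (nat ∷ A ∷ Γ) (k , a , ρ) →
        Run (compile b) σ (enc A (⟦ b ⟧ (k , a , ρ))) (σ 1) (σ 2) (time b M)) where

  -- The claim for the loop body comes in as a module parameter, so the induction here is on the
  -- counter alone. In the cost 21 + `time b M` of an iteration, 3 is for the guard, 7 for the
  -- decrement, 7 for binding and 4 for unbinding; the last guard costs another 3.
  loop-correct : ∀ n a σ r →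
    loopPeak (λ k a → ⟦ b ⟧ (k , a , ρ)) (λ k a → peak b (k , a , ρ)) n a ≤ M →
    σ 0 ≡ enc A a → σ 1 ≡ encEnv Γ ρ → σ 2 ≡ cons (enc nat n) r →
    Run (while (`hd #2) (loopBody (compile b))) σ
        (enc A (countdown (λ k a → ⟦ b ⟧ (k , a , ρ)) n a)) (encEnv Γ ρ) (cons nil r)
        (3 + n * (21 + time b M))
  loop-correct zero a σ r pk e₀ e₁ e₂ =
    mkRun (⇓-stop (cong (λ v → truth (hd v)) e₂)) ≤-refl e₀ e₁ e₂
  loop-correct (suc n) a σ r pk e₀ e₁ e₂
    with IH n a ((σ [ 2 ↦ cons (tl (hd (σ 2))) (tl (σ 2)) ])
                   [ 1 ↦ cons (tl (hd (σ 2))) (cons (σ 0) (σ 1)) ])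
               (m⊔n≤o⇒m≤o _ _ pk)
               (cong₂ cons (cong (λ v → tl (hd v)) e₂) (cong₂ cons e₀ e₁))
  ... | mkRun {τ} {t} run t≤B r₀ r₁ r₂
    with loop-correct n _ (τ [ 1 ↦ tl (tl (τ 1)) ]) r (m⊔n≤o⇒n≤o (peak b (n , a , ρ)) _ pk) r₀
           (trans (cong (λ v → tl (tl v)) r₁) e₁)
           (trans r₂ (cong (λ v → cons (tl (hd v)) (tl v)) e₂))
  ... | mkRun {τ′} {t′} run′ t′≤B r₀′ r₁′ r₂′ =
    mkRun (⇓-loop (cong (λ v → truth (hd v)) e₂)
            (⇓-seq ⇓-assign (⇓-seq ⇓-assign (⇓-seq run ⇓-assign))) run′)
          bound r₀′ r₁′ r₂′
    where
    open ≤-Reasoning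
    rearrange : ∀ x y → 14 + (x + 4) + (3 + y) ≡ 21 + x + y
    rearrange = solve-∀
    bound : 3 + (7 + (7 + (t + 4)) + t′) ≤ 3 + (21 + time b M + n * (21 + time b M))
    bound = +-monoʳ-≤ 3 (begin
      7 + (7 + (t + 4)) + t′                            ≤⟨ +-mono-≤ (+-monoʳ-≤ 14 (+-monoˡ-≤ 4 t≤B)) t′≤B ⟩
      14 + (time b M + 4) + (3 + n * (21 + time b M))   ≡⟨ rearrange (time b M) (n * (21 + time b M)) ⟩
      21 + time b M + n * (21 + time b M)               ∎)

revOnto : {X : Set} → List X → List X → List X
revOnto []       ys = ys
revOnto (x ∷ xs) ys = revOnto xs (x ∷ ys)

reverse-correct : ∀ {A} xs ys σ r → σ 0 ≡ enc (list A) xs → σ 2 ≡ cons (enc (list A) ys) r →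
  Run (while #0 reverseStep) σ nil (σ 1) (cons (enc (list A) (revOnto xs ys)) r) (2 + length xs * 14)
reverse-correct [] ys σ r e₀ e₂ = mkRun (⇓-stop (cong truth e₀)) ≤-refl e₀ refl e₂
reverse-correct {A} (x ∷ xs) ys σ r e₀ e₂
  with reverse-correct {A} xs (x ∷ ys)
         ((σ [ 2 ↦ cons (cons (hd (σ 0)) (hd (σ 2))) (tl (σ 2)) ]) [ 0 ↦ tl (σ 0) ]) r
         (cong tl e₀)
         (cong₂ (λ u v → cons (cons (hd u) (hd v)) (tl v)) e₀ e₂)
... | mkRun {τ} {t} run t≤B r₀ r₁ r₂ =
  mkRun (⇓-loop (cong truth e₀) (⇓-seq ⇓-assign ⇓-assign) run)
        (+-monoʳ-≤ 14 t≤B) r₀ r₁ r₂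

module _ {Γ : Ctx} {A B : Ty} (b : Tm (A ∷ B ∷ Γ) B) (ρ : Env Γ) (M : ℕ)
  (IH : ∀ x a σ → peak b (x , a , ρ) ≤ M → σ 1 ≡ encEnv (A ∷ B ∷ Γ) (x , a , ρ) →
        Run (compile b) σ (enc B (⟦ b ⟧ (x , a , ρ))) (σ 1) (σ 2) (time b M)) where

  private
    f : Val A → Val B → Val B
    f x a = ⟦ b ⟧ (x , a , ρ)

  -- The loop consumes the reversed list, so its first iterations deal with xs.
  fold-correct : ∀ z xs ys σ r →
    foldPeak f (λ x a → peak b (x , a , ρ)) z xs ≤ M →
    σ 0 ≡ enc B z → σ 1 ≡ encEnv Γ ρ → σ 2 ≡ cons (enc (list A) (revOnto xs ys)) r →
    Σ[ τ ∈ Store ] Σ[ t ∈ ℕ ] t ≤ length xs * (22 + time b M) ×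
      τ 0 ≡ enc B (foldr f z xs) × τ 1 ≡ encEnv Γ ρ × τ 2 ≡ cons (enc (list A) ys) r ×
      (∀ {τ′ t′} → while (`hd #2) (foldBody (compile b)) ⊢ τ ⇓ τ′ ∶ t′ →
                   while (`hd #2) (foldBody (compile b)) ⊢ σ ⇓ τ′ ∶ t + t′)
  fold-correct z []       ys σ r pk e₀ e₁ e₂ = σ , 0 , z≤n , e₀ , e₁ , e₂ , λ run → run
  fold-correct z (x ∷ xs) ys σ r pk e₀ e₁ e₂
    -- The elements of `xs` leave the stack before `x`, so the iteration for `x` has to be appended
    -- at the end of the earlier ones. A derivation of `while` grows at the front, hence the
    -- continuation in place of a finished run.
    with fold-correct z xs (x ∷ ys) σ r (m⊔n≤o⇒n≤o (peak b (x , foldr f z xs , ρ)) _ pk) e₀ e₁ e₂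
  ... | τ , t , t≤B , r₀ , r₁ , r₂ , cont
    with IH x (foldr f z xs)
            ((τ [ 1 ↦ cons (hd (hd (τ 2))) (cons (τ 0) (τ 1)) ]) [ 2 ↦ cons (tl (hd (τ 2))) (tl (τ 2)) ])
            (m⊔n≤o⇒m≤o _ _ pk)
            (cong₂ cons (cong (λ v → hd (hd v)) r₂) (cong₂ cons r₀ r₁))
  ... | mkRun {τ′} {t′} run′ t′≤B r₀′ r₁′ r₂′ =
    τ′ [ 1 ↦ tl (tl (τ′ 1)) ] , t + (3 + (8 + (7 + (t′ + 4)))) , bound , r₀′ ,
    trans (cong (λ v → tl (tl v)) r₁′) r₁ ,
    trans r₂′ (cong (λ v → cons (tl (hd v)) (tl v)) r₂) ,
    λ {τ″} {t″} run″ → subst (while (`hd #2) (foldBody (compile b)) ⊢ σ ⇓ τ″ ∶_)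
      (sym (+-assoc t (3 + (8 + (7 + (t′ + 4)))) t″))
      (cont (⇓-loop (cong (λ v → truth (hd v)) r₂)
        (⇓-seq ⇓-assign (⇓-seq ⇓-assign (⇓-seq run′ ⇓-assign))) run″))
    where
    open ≤-Reasoning
    bound : t + (18 + (t′ + 4)) ≤ 22 + time b M + length xs * (22 + time b M)
    bound = begin
      t + (18 + (t′ + 4))                                 ≡⟨ +-comm t _ ⟩
      18 + (t′ + 4) + t                                   ≤⟨ +-mono-≤ (+-monoʳ-≤ 18 (+-monoˡ-≤ 4 t′≤B)) t≤B ⟩
      18 + (time b M + 4) + length xs * (22 + time b M)   ≡⟨ cong (_+ length xs * (22 + time b M))
        (cong (18 +_) (+-comm (time b M) 4)) ⟩
      22 + time b M + length xs * (22 + time b M)         ∎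

compile-correct : ∀ {Γ A} (t : Tm Γ A) ρ M σ → peak t ρ ≤ M → σ 1 ≡ encEnv Γ ρ →
  Run (compile t) σ (enc A (⟦ t ⟧ ρ)) (σ 1) (σ 2) (time t M)
compile*-correct : ∀ {Γ Δ} (ts : Args Γ Δ) ρ M σ → peak* ts ρ ≤ M → σ 1 ≡ encEnv Γ ρ →
  Σ[ v ∈ Tree ] Run (compile* ts) σ v (σ 1) (cons (encEnv Δ (⟦ ts ⟧* ρ)) (σ 2)) (time* ts M)

compile-correct (var x) ρ M σ pk e = mkRun ⇓-assign ≤-refl (path-eval x ρ #1 σ e) refl refl
compile-correct `0 ρ M σ pk e = mkRun ⇓-assign ≤-refl refl refl refl
compile-correct (`suc t) ρ M σ pk e with compile-correct t ρ M σ pk e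
... | mkRun run b r₀ r₁ r₂ = mkRun (⇓-seq run ⇓-assign) (+-monoˡ-≤ 4 b) (cong (cons nil) r₀) r₁ r₂
compile-correct {Γ} (`case t u v) ρ M σ pk e
  with compile-correct t ρ M σ (m⊔n≤o⇒m≤o _ _ pk) e
... | mkRun {τ} run b r₀ r₁ r₂ with ⟦ t ⟧ ρ | m⊔n≤o⇒n≤o (peak t ρ) _ pk
... | zero | pk′ with compile-correct u ρ M τ pk′ (trans r₁ e)
... | mkRun run′ b′ r₀′ r₁′ r₂′ =
  mkRun (⇓-seq run (⇓-else (cong truth r₀) run′))
        (+-mono-≤ b (+-monoʳ-≤ 2 (≤-trans b′ (m≤m+n _ _)))) r₀′ (trans r₁′ r₁) (trans r₂′ r₂)
compile-correct {Γ} (`case t u v) ρ M σ pk e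
    | mkRun {τ} run b r₀ r₁ r₂ | suc k | pk′
  with compile-correct v (k , ρ) M (τ [ 1 ↦ cons (tl (τ 0)) (τ 1) ]) pk′
         (cong₂ cons (cong tl r₀) (trans r₁ e))
... | mkRun run′ b′ r₀′ r₁′ r₂′ =
  mkRun (⇓-seq run (⇓-then (cong truth r₀) (⇓-seq ⇓-assign (⇓-seq run′ ⇓-assign))))
        (+-mono-≤ b (+-monoʳ-≤ 2 (≤-trans (+-monoʳ-≤ 5 (+-monoˡ-≤ 3 b′)) (m≤n+m _ (time u M)))))
        r₀′ (trans (cong tl r₁′) r₁) (trans r₂′ r₂)
compile-correct {Γ} {A} (`loop s z t) ρ M σ pk e
  with compile-correct t ρ M σ (m⊔n≤o⇒m≤o _ _ pk) e | m⊔n≤o⇒n≤o (peak t ρ) _ pk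
... | mkRun {τ} run b r₀ r₁ r₂ | pk′
  with compile-correct z ρ M (τ [ 2 ↦ cons (τ 0) (τ 2) ]) (m⊔n≤o⇒m≤o _ _ pk′) (trans r₁ e)
     | m⊔n≤o⇒n≤o (peak z ρ) _ pk′
... | mkRun {τ′} run′ b′ r₀′ r₁′ r₂′ | pk″
  with loop-correct s ρ M (λ k a σ → compile-correct s (k , a , ρ) M σ) (⟦ t ⟧ ρ) (⟦ z ⟧ ρ) τ′ (σ 2)
         (m⊔n≤o⇒n≤o (⟦ t ⟧ ρ) _ pk″) r₀′ (trans r₁′ (trans r₁ e)) (trans r₂′ (cong₂ cons r₀ r₂))
... | mkRun run″ b″ r₀″ r₁″ r₂″ =
  mkRun (⇓-seq run (⇓-seq ⇓-assign (⇓-seq run′ (⇓-seq run″ ⇓-assign))))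
        (+-mono-≤ b (+-monoʳ-≤ 4 (+-mono-≤ b′ (+-monoˡ-≤ 3 (≤-trans b″
          (+-monoʳ-≤ 3 (*-monoˡ-≤ (21 + time s M) (m⊔n≤o⇒m≤o (⟦ t ⟧ ρ) _ pk″))))))))
        r₀″ (trans r₁″ (sym e)) (cong tl r₂″)
compile-correct `t ρ M σ pk e = mkRun ⇓-assign ≤-refl refl refl refl
compile-correct `f ρ M σ pk e = mkRun ⇓-assign ≤-refl refl refl refl
compile-correct (`if t u v) ρ M σ pk e
  with compile-correct t ρ M σ (m⊔n≤o⇒m≤o _ _ pk) e | m⊔n≤o⇒n≤o (peak t ρ) _ pk
... | mkRun {τ} run b r₀ r₁ r₂ | pk′ with ⟦ t ⟧ ρ
... | true  with compile-correct u ρ M τ (m⊔n≤o⇒m≤o _ _ pk′) (trans r₁ e)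
... | mkRun run′ b′ r₀′ r₁′ r₂′ =
  mkRun (⇓-seq run (⇓-then (cong truth r₀) run′))
        (+-mono-≤ b (+-monoʳ-≤ 2 (≤-trans b′ (m≤m+n _ _)))) r₀′ (trans r₁′ r₁) (trans r₂′ r₂)
compile-correct (`if t u v) ρ M σ pk e
    | mkRun {τ} run b r₀ r₁ r₂ | pk′ | false
  with compile-correct v ρ M τ (m⊔n≤o⇒n≤o (peak u ρ) _ pk′) (trans r₁ e)
... | mkRun run′ b′ r₀′ r₁′ r₂′ =
  mkRun (⇓-seq run (⇓-else (cong truth r₀) run′))
        (+-mono-≤ b (+-monoʳ-≤ 2 (≤-trans b′ (m≤n+m _ _)))) r₀′ (trans r₁′ r₁) (trans r₂′ r₂)
compile-correct `[] ρ M σ pk e = mkRun ⇓-assign ≤-refl refl refl refl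
compile-correct (t `∷ u) ρ M σ pk e
  with compile-correct t ρ M σ (m⊔n≤o⇒m≤o _ _ pk) e
... | mkRun {τ} run b r₀ r₁ r₂
  with compile-correct u ρ M (τ [ 2 ↦ cons (τ 0) (τ 2) ]) (m⊔n≤o⇒n≤o (peak t ρ) _ pk) (trans r₁ e)
... | mkRun {τ′} run′ b′ r₀′ r₁′ r₂′ =
  mkRun (⇓-seq run (⇓-seq ⇓-assign (⇓-seq run′ (⇓-seq ⇓-assign ⇓-assign))))
        (+-mono-≤ b (+-monoʳ-≤ 4 (+-monoˡ-≤ 8 b′)))
        (cong₂ cons (trans (cong hd r₂′) r₀) r₀′) (trans r₁′ r₁) (trans (cong tl r₂′) r₂)
compile-correct {Γ} {B} (`foldr {A} s z t) ρ M σ pk e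
  with compile-correct t ρ M σ (m⊔n≤o⇒m≤o _ _ pk) e | m⊔n≤o⇒n≤o (peak t ρ) _ pk
... | mkRun {τ} run b r₀ r₁ r₂ | pk′
  with reverse-correct {A} (⟦ t ⟧ ρ) [] (τ [ 2 ↦ cons nil (τ 2) ]) (σ 2) r₀ (cong (cons nil) r₂)
... | mkRun {τᵣ} runᵣ bᵣ r₀ᵣ r₁ᵣ r₂ᵣ
  with compile-correct z ρ M τᵣ (m⊔n≤o⇒m≤o _ _ pk′) (trans r₁ᵣ (trans r₁ e))
     | m⊔n≤o⇒n≤o (peak z ρ) _ pk′
... | mkRun {τ′} run′ b′ r₀′ r₁′ r₂′ | pk″
  with fold-correct s ρ M (λ x a σ → compile-correct s (x , a , ρ) M σ) (⟦ z ⟧ ρ) (⟦ t ⟧ ρ) [] τ′ (σ 2)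
         (m⊔n≤o⇒n≤o (length (⟦ t ⟧ ρ)) _ pk″) r₀′ (trans r₁′ (trans r₁ᵣ (trans r₁ e))) (trans r₂′ r₂ᵣ)
... | τ″ , u , u≤ , r₀″ , r₁″ , r₂″ , cont =
  mkRun (⇓-seq run (⇓-seq ⇓-assign (⇓-seq runᵣ (⇓-seq run′ (⇓-seq
          (cont (⇓-stop (cong (λ v → truth (hd v)) r₂″))) ⇓-assign)))))
        (+-mono-≤ b (+-monoʳ-≤ 4 (+-mono-≤
          (≤-trans bᵣ (+-monoʳ-≤ 2 (*-monoˡ-≤ 14 len≤)))
          (+-mono-≤ b′ (+-monoˡ-≤ 3 (+-monoˡ-≤ 3 (≤-trans u≤ (*-monoˡ-≤ (22 + time s M) len≤))))))))
        r₀″ (trans r₁″ (sym e)) (cong tl r₂″)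
  where
  len≤ : length (⟦ t ⟧ ρ) ≤ M
  len≤ = m⊔n≤o⇒m≤o _ _ pk″
compile-correct (t `, u) ρ M σ pk e
  with compile-correct t ρ M σ (m⊔n≤o⇒m≤o _ _ pk) e
... | mkRun {τ} run b r₀ r₁ r₂
  with compile-correct u ρ M (τ [ 2 ↦ cons (τ 0) (τ 2) ]) (m⊔n≤o⇒n≤o (peak t ρ) _ pk) (trans r₁ e)
... | mkRun {τ′} run′ b′ r₀′ r₁′ r₂′ =
  mkRun (⇓-seq run (⇓-seq ⇓-assign (⇓-seq run′ (⇓-seq ⇓-assign ⇓-assign))))
        (+-mono-≤ b (+-monoʳ-≤ 4 (+-monoˡ-≤ 8 b′)))
        (cong₂ cons (trans (cong hd r₂′) r₀) r₀′) (trans r₁′ r₁) (trans (cong tl r₂′) r₂)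
compile-correct (`fst t) ρ M σ pk e with compile-correct t ρ M σ pk e
... | mkRun run b r₀ r₁ r₂ = mkRun (⇓-seq run ⇓-assign) (+-monoˡ-≤ 3 b) (cong hd r₀) r₁ r₂
compile-correct (`snd t) ρ M σ pk e with compile-correct t ρ M σ pk e
... | mkRun run b r₀ r₁ r₂ = mkRun (⇓-seq run ⇓-assign) (+-monoˡ-≤ 3 b) (cong tl r₀) r₁ r₂
compile-correct (`let t u) ρ M σ pk e
  with compile-correct t ρ M σ (m⊔n≤o⇒m≤o _ _ pk) e
... | mkRun {τ} run b r₀ r₁ r₂
  with compile-correct u (⟦ t ⟧ ρ , ρ) M (τ [ 1 ↦ cons (τ 0) (τ 1) ]) (m⊔n≤o⇒n≤o (peak t ρ) _ pk)
         (cong₂ cons r₀ (trans r₁ e))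
... | mkRun run′ b′ r₀′ r₁′ r₂′ =
  mkRun (⇓-seq run (⇓-seq ⇓-assign (⇓-seq run′ ⇓-assign)))
        (+-mono-≤ b (+-monoʳ-≤ 4 (+-monoˡ-≤ 3 b′)))
        r₀′ (trans (cong tl r₁′) r₁) (trans r₂′ r₂)
compile-correct (call t ts) ρ M σ pk e
  with compile*-correct ts ρ M σ (m⊔n≤o⇒m≤o _ _ pk) e
... | _ , mkRun {τ} run b r₀ r₁ r₂
  with compile-correct t (⟦ ts ⟧* ρ) M
         (((τ [ 0 ↦ hd (τ 2) ]) [ 2 ↦ cons (τ 1) (tl (τ 2)) ]) [ 1 ↦ hd (τ 2) ])
         (m⊔n≤o⇒n≤o (peak* ts ρ) _ pk) (cong hd r₂)
... | mkRun {τ′} run′ b′ r₀′ r₁′ r₂′ =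
  mkRun (⇓-seq run (⇓-seq ⇓-assign (⇓-seq ⇓-assign (⇓-seq ⇓-assign (⇓-seq run′ (⇓-seq ⇓-assign ⇓-assign))))))
        (+-mono-≤ b (+-monoʳ-≤ 10 (+-monoˡ-≤ 6 b′)))
        r₀′ (trans (cong hd r₂′) r₁) (trans (cong tl r₂′) (cong tl r₂))

compile*-correct ∅ ρ M σ pk e = _ , mkRun ⇓-assign ≤-refl refl refl refl
compile*-correct (t ▸ ts) ρ M σ pk e
  with compile*-correct ts ρ M σ (m⊔n≤o⇒m≤o _ _ pk) e
... | _ , mkRun {τ} run b r₀ r₁ r₂
  with compile-correct t ρ M τ (m⊔n≤o⇒n≤o (peak* ts ρ) _ pk) (trans r₁ e)
... | mkRun run′ b′ r₀′ r₁′ r₂′ =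
  _ , mkRun (⇓-seq run (⇓-seq run′ ⇓-assign))
            (+-mono-≤ b (+-monoˡ-≤ 8 b′)) refl (trans r₁′ r₁)
            (cong₂ cons (cong₂ cons r₀′ (cong hd (trans r₂′ r₂))) (cong tl (trans r₂′ r₂)))

standalone : ∀ {A B} → Tm (A ∷ []) B → Cmd
standalone t = 1 := `cons #0 `nil ⨾ compile t

standalone-correct : ∀ {A B} (t : Tm (A ∷ []) B) a M → peak t (a , tt) ≤ M →
  ∃[ s ] s ≤ 4 + time t M × standalone t on enc A a outputs enc B (⟦ t ⟧ (a , tt)) inTime s
standalone-correct {A} t a M pk
  with compile-correct t (a , tt) M (initial (enc A a) [ 1 ↦ cons (enc A a) nil ]) pk refl
... | mkRun run t≤B r₀ _ _ = _ , +-monoʳ-≤ 4 t≤B , _ , ⇓-seq ⇓-assign run , r₀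

-- Fixed-parameter bounds

-- The successor at every list cell makes the size dominate the length as well as the entries, so
-- that each type has only finitely many values of a given size.
size : ∀ A → Val A → ℕ
size nat k             = k
size bool b            = 0
size (list A) []       = 0
size (list A) (x ∷ xs) = suc (size A x ⊔ size (list A) xs)
size (A ⊗ B) (a , b)   = size A a ⊔ size B b

sizeEnv : ∀ Γ → Env Γ → ℕ
sizeEnv []      tt      = 0
sizeEnv (A ∷ Γ) (v , ρ) = size A v ⊔ sizeEnv Γ ρ

length≤size : ∀ {A} xs → length xs ≤ size (list A) xs
length≤size []       = z≤n
length≤size (x ∷ xs) = s≤s (≤-trans (length≤size xs) (m≤n⊔m _ _))

∈⇒size≤ : ∀ {A x xs} → x ∈ xs → size A x ≤ size (list A) xs
∈⇒size≤ {xs = y ∷ ys} (here refl) = m≤n⇒m≤1+n (m≤m⊔n _ _)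
∈⇒size≤ {A} {xs = y ∷ ys} (there p) = m≤n⇒m≤1+n (≤-trans (∈⇒size≤ p) (m≤n⊔m (size A y) _))

-- Follows the recursion of `size`: in a list of size at most s + 1, head and tail both have size at
-- most s.
listsUpTo : {X : Set} → (ℕ → List X) → ℕ → List (List X)
listsUpTo E zero    = [] ∷ []
listsUpTo E (suc s) = [] ∷ cartesianProductWith _∷_ (E s) (listsUpTo E s)

enum : ∀ A → ℕ → List (Val A)
enum nat s      = upTo (suc s)
enum bool s     = true ∷ false ∷ []
enum (list A) s = listsUpTo (enum A) s
enum (A ⊗ B) s  = cartesianProductWith _,_ (enum A s) (enum B s)

enumEnv : ∀ Γ → ℕ → List (Env Γ)
enumEnv []      s = tt ∷ []
enumEnv (A ∷ Γ) s = cartesianProductWith _,_ (enum A s) (enumEnv Γ s)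

∈-enum : ∀ A {s} v → size A v ≤ s → v ∈ enum A s
∈-enum nat v le          = ∈-upTo⁺ (s≤s le)
∈-enum bool true le      = here refl
∈-enum bool false le     = there (here refl)
∈-enum (list A) {zero} [] le    = here refl
∈-enum (list A) {suc s} [] le    = here refl
∈-enum (list A) (x ∷ xs) (s≤s le) =
  there (∈-cartesianProductWith⁺ _∷_ (∈-enum A x (m⊔n≤o⇒m≤o _ _ le))
                                     (∈-enum (list A) xs (m⊔n≤o⇒n≤o (size A x) _ le)))
∈-enum (A ⊗ B) (a , b) le =
  ∈-cartesianProductWith⁺ _,_ (∈-enum A a (m⊔n≤o⇒m≤o _ _ le)) (∈-enum B b (m⊔n≤o⇒n≤o (size A a) _ le))

∈-enumEnv : ∀ Γ {s} ρ → sizeEnv Γ ρ ≤ s → ρ ∈ enumEnv Γ s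
∈-enumEnv [] tt le = here refl
∈-enumEnv (A ∷ Γ) (v , ρ) le =
  ∈-cartesianProductWith⁺ _,_ (∈-enum A v (m⊔n≤o⇒m≤o _ _ le)) (∈-enumEnv Γ ρ (m⊔n≤o⇒n≤o (size A v) _ le))

maxOver : {X : Set} → (X → ℕ) → List X → ℕ
maxOver f = foldr (λ x a → f x ⊔ a) 0

≤maxOver : {X : Set} (f : X → ℕ) {x : X} {xs : List X} → x ∈ xs → f x ≤ maxOver f xs
≤maxOver f (here refl)       = m≤m⊔n _ _
≤maxOver f {xs = y ∷ _} (there p) = ≤-trans (≤maxOver f p) (m≤n⊔m (f y) _)

-- There are only finitely many inputs of a given size, so a program whose
-- inputs have size bounded in terms of the parameter needs no analysis.
opaque

  peakBound sizeBound : ∀ {Γ A} → Tm Γ A → ℕ → ℕ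
  peakBound {Γ} t s     = maxOver (peak t) (enumEnv Γ s)
  sizeBound {Γ} {A} t s = maxOver (λ ρ → size A (⟦ t ⟧ ρ)) (enumEnv Γ s)

  peak≤ : ∀ {Γ A} (t : Tm Γ A) {s} ρ → sizeEnv Γ ρ ≤ s → peak t ρ ≤ peakBound t s
  peak≤ {Γ} t ρ le = ≤maxOver (peak t) (∈-enumEnv Γ ρ le)

  size≤ : ∀ {Γ A} (t : Tm Γ A) {s} ρ → sizeEnv Γ ρ ≤ s → size A (⟦ t ⟧ ρ) ≤ sizeBound t s
  size≤ {Γ} {A} t ρ le = ≤maxOver (λ ρ → size A (⟦ t ⟧ ρ)) (∈-enumEnv Γ ρ le)

-- Bounds of the form f (pmax) · N ^ k

N : Instance → ℕ
N I = let open Instance I in 1 ⊔ (n + ⌊log₂ m ⌋)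

FPT : (Instance → ℕ) → Set
FPT g = Σ[ f ∈ (ℕ → ℕ) ] ∃[ k ] ∀ I → g I ≤ f (Instance.pmax I) * N I ^ k

module _ where
  open Instance

  -- The maximum with 1 in `N` serves the instance with no jobs and one machine. Thanks to it,
  -- bounds of different degree can be raised to a common degree before they are added.
  1≤N^ : ∀ I k → 1 ≤ N I ^ k
  1≤N^ I k = ≤-trans (≤-reflexive (sym (^-zeroˡ k))) (^-monoˡ-≤ k (m≤m⊔n 1 (n I + ⌊log₂ m I ⌋)))

  FPT-param : (h : ℕ → ℕ) → FPT (λ I → h (pmax I))
  FPT-param h = h , 0 , λ I → ≤-reflexive (sym (*-identityʳ _))

  FPT-≤ : ∀ {g g′} → (∀ I → g I ≤ g′ I) → FPT g′ → FPT g
  FPT-≤ le (f , k , b) = f , k , λ I → ≤-trans (le I) (b I)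

  FPT-N : FPT N
  FPT-N = (λ _ → 1) , 1 , λ I → ≤-reflexive (sym (trans (+-identityʳ _) (*-identityʳ _)))

  FPT-* : ∀ {g g′} → FPT g → FPT g′ → FPT (λ I → g I * g′ I)
  FPT-* (f , k , b) (f′ , k′ , b′) = (λ q → f q * f′ q) , k + k′ , λ I →
    ≤-trans (*-mono-≤ (b I) (b′ I))
      (≤-reflexive (trans (rearrange (f (pmax I)) (f′ (pmax I)) (N I ^ k) (N I ^ k′))
        (cong (f (pmax I) * f′ (pmax I) *_) (sym (^-distribˡ-+-* (N I) k k′)))))
    where
    rearrange : ∀ a b x y → a * x * (b * y) ≡ a * b * (x * y)
    rearrange = solve-∀

  FPT-+ : ∀ {g g′} → FPT g → FPT g′ → FPT (λ I → g I + g′ I)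
  FPT-+ (f , k , b) (f′ , k′ , b′) = (λ q → f q + f′ q) , k + k′ , λ I →
    ≤-trans (+-mono-≤ (≤-trans (b I) (*-monoʳ-≤ (f (pmax I)) (up I k k′)))
                      (≤-trans (b′ I) (*-monoʳ-≤ (f′ (pmax I))
                        (≤-trans (up I k′ k) (≤-reflexive (cong (N I ^_) (+-comm k′ k)))))))
      (≤-reflexive (sym (*-distribʳ-+ (N I ^ (k + k′)) (f (pmax I)) _)))
    where
    up : ∀ I k k′ → N I ^ k ≤ N I ^ (k + k′)
    up I k k′ = ≤-trans (≤-reflexive (sym (*-identityʳ _)))
      (≤-trans (*-monoʳ-≤ (N I ^ k) (1≤N^ I k′)) (≤-reflexive (sym (^-distribˡ-+-* (N I) k k′))))

FPT-const : ∀ c → FPT (λ _ → c)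
FPT-const c = FPT-param (λ _ → c)

module _ {g : Instance → ℕ} (G : FPT g) where

  -- For a fixed term, `time` is built from the iteration bound by sums and products, and `FPT` is
  -- closed under both. The degree depends on how the loops of the program are nested, never on the
  -- instance.
  time-FPT  : ∀ {Γ A} (t : Tm Γ A) → FPT (λ I → time t (g I))
  time*-FPT : ∀ {Γ Δ} (ts : Args Γ Δ) → FPT (λ I → time* ts (g I))

  time-FPT (var x)        = FPT-const _
  time-FPT `0             = FPT-const _
  time-FPT (`suc t)       = FPT-+ (time-FPT t) (FPT-const _)
  time-FPT (`case t u v)  = FPT-+ (time-FPT t) (FPT-+ (FPT-const 2) (FPT-+ (time-FPT u)
                              (FPT-+ (FPT-const 5) (FPT-+ (time-FPT v) (FPT-const 3)))))
  time-FPT (`loop b z t)  = FPT-+ (time-FPT t) (FPT-+ (FPT-const 4) (FPT-+ (time-FPT z)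
                              (FPT-+ (FPT-+ (FPT-const 3) (FPT-* G (FPT-+ (FPT-const 21) (time-FPT b))))
                                     (FPT-const 3))))
  time-FPT `t             = FPT-const _
  time-FPT `f             = FPT-const _
  time-FPT (`if t u v)    = FPT-+ (time-FPT t) (FPT-+ (FPT-const 2) (FPT-+ (time-FPT u) (time-FPT v)))
  time-FPT `[]            = FPT-const _
  time-FPT (t `∷ u)       = FPT-+ (time-FPT t) (FPT-+ (FPT-const 4) (FPT-+ (time-FPT u) (FPT-const 8)))
  time-FPT (`foldr b z t) = FPT-+ (time-FPT t) (FPT-+ (FPT-const 4) (FPT-+
                              (FPT-+ (FPT-const 2) (FPT-* G (FPT-const 14)))
                              (FPT-+ (time-FPT z) (FPT-+
                                (FPT-+ (FPT-* G (FPT-+ (FPT-const 22) (time-FPT b))) (FPT-const 3))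
                                (FPT-const 3)))))
  time-FPT (t `, u)       = FPT-+ (time-FPT t) (FPT-+ (FPT-const 4) (FPT-+ (time-FPT u) (FPT-const 8)))
  time-FPT (`fst t)       = FPT-+ (time-FPT t) (FPT-const 3)
  time-FPT (`snd t)       = FPT-+ (time-FPT t) (FPT-const 3)
  time-FPT (`let t u)     = FPT-+ (time-FPT t) (FPT-+ (FPT-const 4) (FPT-+ (time-FPT u) (FPT-const 3)))
  time-FPT (call t ts)    = FPT-+ (time*-FPT ts) (FPT-+ (FPT-const 10) (FPT-+ (time-FPT t) (FPT-const 6)))

  time*-FPT ∅        = FPT-const _
  time*-FPT (t ▸ ts) = FPT-+ (time*-FPT ts) (FPT-+ (time-FPT t) (FPT-const 8))

-- Invariants of loops and folds

module _ {X : Set} {f : ℕ → X → X} where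

  -- The invariant is indexed by the number of iterations still to come, so it can tie the
  -- accumulator to the counter.
  countdown-inv : (P : ℕ → X → Set) → (∀ {k a} → P (suc k) a → P k (f k a)) →
                  ∀ n {a} → P n a → P 0 (countdown f n a)
  countdown-inv P step zero    p = p
  countdown-inv P step (suc n) p = countdown-inv P step n (step p)

  loopPeak-inv : ∀ {c M} (P : ℕ → X → Set) → (∀ {k a} → P (suc k) a → P k (f k a)) →
                 (∀ {k a} → P (suc k) a → c k a ≤ M) →
                 ∀ n {a} → P n a → loopPeak f c n a ≤ M
  loopPeak-inv P step le zero    p = z≤n
  loopPeak-inv P step le (suc n) p = ⊔-lub (le p) (loopPeak-inv P step le n (step p))

  loopPeak≤ : ∀ {c M} → (∀ k a → c k a ≤ M) → ∀ n {a} → loopPeak f c n a ≤ M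
  loopPeak≤ le n = loopPeak-inv (λ _ _ → ⊤) _ (λ {k} {a} _ → le k a) n tt

module _ {A X : Set} {f : A → X → X} {z : X} where

  foldr-inv : (P : List A → X → Set) → P [] z → (∀ x {xs a} → P xs a → P (x ∷ xs) (f x a)) →
              ∀ xs → P xs (foldr f z xs)
  foldr-inv P p₀ step []       = p₀
  foldr-inv P p₀ step (x ∷ xs) = step x (foldr-inv P p₀ step xs)

  foldPeak-inv : ∀ {c M} (Q : A → Set) (P : X → Set) → P z →
                 (∀ {x a} → Q x → P a → P (f x a)) →
                 (∀ {x a} → Q x → P a → c x a ≤ M) →
                 ∀ {xs} → All Q xs → foldPeak f c z xs ≤ M × P (foldr f z xs)
  foldPeak-inv Q P p₀ step le []       = z≤n , p₀
  foldPeak-inv Q P p₀ step le (q ∷ qs) with foldPeak-inv Q P p₀ step le qs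
  ... | ih , p = ⊔-lub (le q p) ih , step q p

  foldPeak-All : ∀ {c M} (Q : A → Set) → (∀ {x} a → Q x → c x a ≤ M) →
                 ∀ {xs} → All Q xs → foldPeak f c z xs ≤ M
  foldPeak-All Q le qs = proj₁ (foldPeak-inv Q (λ _ → ⊤) tt _ (λ {_} {a} q _ → le a q) qs)

  foldPeak≤ : ∀ {c M} → (∀ x a → c x a ≤ M) → ∀ xs → foldPeak f c z xs ≤ M
  foldPeak≤ le []       = z≤n
  foldPeak≤ le (x ∷ xs) = ⊔-lub (le _ _) (foldPeak≤ le xs)

-- Basic programs

v0 : ∀ {A Γ} → Tm (A ∷ Γ) A
v0 = var first
v1 : ∀ {A B Γ} → Tm (B ∷ A ∷ Γ) A
v1 = var (later first)
v2 : ∀ {A B C Γ} → Tm (C ∷ B ∷ A ∷ Γ) A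
v2 = var (later (later first))
v3 : ∀ {A B C D Γ} → Tm (D ∷ C ∷ B ∷ A ∷ Γ) A
v3 = var (later (later (later first)))
v4 : ∀ {A B C D E Γ} → Tm (E ∷ D ∷ C ∷ B ∷ A ∷ Γ) A
v4 = var (later (later (later (later first))))
v5 : ∀ {A B C D E F Γ} → Tm (F ∷ E ∷ D ∷ C ∷ B ∷ A ∷ Γ) A
v5 = var (later (later (later (later (later first)))))
v6 : ∀ {A B C D E F G Γ} → Tm (G ∷ F ∷ E ∷ D ∷ C ∷ B ∷ A ∷ Γ) A
v6 = var (later (later (later (later (later (later first))))))
v7 : ∀ {A B C D E F G H Γ} → Tm (H ∷ G ∷ F ∷ E ∷ D ∷ C ∷ B ∷ A ∷ Γ) A
v7 = var (later (later (later (later (later (later (later first)))))))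
v8 : ∀ {A B C D E F G H I Γ} → Tm (I ∷ H ∷ G ∷ F ∷ E ∷ D ∷ C ∷ B ∷ A ∷ Γ) A
v8 = var (later (later (later (later (later (later (later (later first))))))))

-- Weighted sums take the place of multisets. Agreement for every weight amounts to equality of
-- multisets, and the weights `ind i`, constant 1 and identity extract multiplicities, length and
-- volume.
wt : {X : Set} → (X → ℕ) → List X → ℕ
wt g = foldr (λ x a → g x + a) 0

ind : ℕ → ℕ → ℕ
ind i x = if x ≡ᵇ i then 1 else 0

cnt : ℕ → List ℕ → ℕ
cnt i = wt (ind i)

false≢true : false ≢ true
false≢true ()

≡ᵇ-refl : ∀ n → (n ≡ᵇ n) ≡ true
≡ᵇ-refl zero    = refl
≡ᵇ-refl (suc n) = ≡ᵇ-refl n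

≡ᵇ-true : ∀ {m n} → (m ≡ᵇ n) ≡ true → m ≡ n
≡ᵇ-true {m} {n} e = ≡ᵇ⇒≡ m n (subst T (sym e) tt)

≡ᵇ-false : ∀ {m n} → m ≢ n → (m ≡ᵇ n) ≡ false
≡ᵇ-false {m} {n} ne with m ≡ᵇ n in e
... | true  = ⊥-elim (ne (≡ᵇ-true e))
... | false = refl

≤ᵇ-true : ∀ {m n} → (m ≤ᵇ n) ≡ true → m ≤ n
≤ᵇ-true {m} {n} e = ≤ᵇ⇒≤ m n (subst T (sym e) tt)

≤⇒≤ᵇ-true : ∀ {m n} → m ≤ n → (m ≤ᵇ n) ≡ true
≤⇒≤ᵇ-true {m} {n} le with m ≤ᵇ n | ≤⇒≤ᵇ le
... | true | _ = refl

ind-refl : ∀ i → ind i i ≡ 1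
ind-refl i rewrite ≡ᵇ-refl i = refl

ind-≢ : ∀ {i x} → x ≢ i → ind i x ≡ 0
ind-≢ ne rewrite ≡ᵇ-false ne = refl

wt-++ : {X : Set} (g : X → ℕ) (xs ys : List X) → wt g (xs ++ ys) ≡ wt g xs + wt g ys
wt-++ g []       ys = refl
wt-++ g (x ∷ xs) ys = trans (cong (g x +_) (wt-++ g xs ys)) (sym (+-assoc (g x) _ _))

wt-1 : {X : Set} (xs : List X) → wt (λ _ → 1) xs ≡ length xs
wt-1 []       = refl
wt-1 (x ∷ xs) = cong suc (wt-1 xs)

wt-cong : {X : Set} {g h : X → ℕ} → (∀ x → g x ≡ h x) → ∀ xs → wt g xs ≡ wt h xs
wt-cong e []       = refl
wt-cong e (x ∷ xs) = cong₂ _+_ (e x) (wt-cong e xs)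

∈⇒≤wt : {X : Set} (g : X → ℕ) {x : X} {xs : List X} → x ∈ xs → g x ≤ wt g xs
∈⇒≤wt g (here refl) = m≤m+n _ _
∈⇒≤wt g {xs = y ∷ _} (there p) = ≤-trans (∈⇒≤wt g p) (m≤n+m _ (g y))

foldr-cong′ : {A X : Set} {f g : A → X → X} → (∀ x a → f x a ≡ g x a) →
              ∀ z xs → foldr f z xs ≡ foldr g z xs
foldr-cong′ e z []       = refl
foldr-cong′ {g = g} e z (x ∷ xs) = trans (e x _) (cong (g x) (foldr-cong′ e z xs))

opaque

  -- From here on programs are opaque and known through lemmas on their values and peaks. Programs
  -- whose inputs are bounded in terms of q get no lemma on the peak, because `peakBound` covers
  -- them.
  append : ∀ {A} → Tm (list A ∷ list A ∷ []) (list A)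
  append = `foldr (v0 `∷ v1) v1 v0

  append-sem : ∀ {A} (xs ys : Val (list A)) → ⟦ append {A} ⟧ (xs , ys , tt) ≡ xs ++ ys
  append-sem []       ys = refl
  append-sem {A} (x ∷ xs) ys = cong (x ∷_) (append-sem {A} xs ys)

  append-peak : ∀ {A M} {xs ys : Val (list A)} → length xs ≤ M → peak (append {A}) (xs , ys , tt) ≤ M
  append-peak {xs = xs} le = ⊔-lub le (foldPeak≤ (λ _ _ → z≤n) xs)

opaque

  add : Tm (nat ∷ nat ∷ []) nat
  add = `loop (`suc v1) v1 v0

  add-sem : ∀ a b → ⟦ add ⟧ (a , b , tt) ≡ a + b
  add-sem zero    b = refl
  add-sem (suc a) b = trans (add-sem a (suc b)) (+-suc a b)

  add-peak : ∀ {M a} b → a ≤ M → peak add (a , b , tt) ≤ M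
  add-peak {a = a} b le = ⊔-lub le (loopPeak≤ (λ _ _ → z≤n) a)

opaque

  mul : Tm (nat ∷ nat ∷ []) nat
  mul = `loop (call add (v3 ▸ v1 ▸ ∅)) `0 v0

  mul-sem : ∀ a b → ⟦ mul ⟧ (a , b , tt) ≡ a * b
  mul-sem a b = trans (go a 0) (+-identityʳ _)
    where
    go : ∀ a c → countdown (λ _ acc → ⟦ add ⟧ (b , acc , tt)) a c ≡ a * b + c
    go zero    c = refl
    go (suc a) c = trans (go a _) (trans (cong (a * b +_) (add-sem b c)) (rearrange (a * b) b c))
      where
      rearrange : ∀ x b c → x + (b + c) ≡ b + x + c
      rearrange = solve-∀

  mul-peak : ∀ {M a b} → a ≤ M → b ≤ M → peak mul (a , b , tt) ≤ M
  mul-peak {M} {a} {b} la lb = ⊔-lub la (loopPeak≤ (λ _ acc → add-peak acc lb) a)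

opaque

  sub : Tm (nat ∷ nat ∷ []) nat
  sub = `loop (`case v1 `0 v0) v0 v1

  sub-sem : ∀ a b → ⟦ sub ⟧ (a , b , tt) ≡ a ∸ b
  sub-sem a       zero    = refl
  sub-sem zero    (suc b) = trans (sub-sem 0 b) (0∸n≡0 b)
  sub-sem (suc a) (suc b) = sub-sem a b

  sub-peak : ∀ {M a b} → b ≤ M → peak sub (a , b , tt) ≤ M
  sub-peak {b = b} le = ⊔-lub le (loopPeak≤ (λ { _ zero → z≤n ; _ (suc _) → z≤n }) b)

opaque

  leq : Tm (nat ∷ nat ∷ []) bool
  leq = `case (call sub (v0 ▸ v1 ▸ ∅)) `t `f

  leq-sem : ∀ a b → ⟦ leq ⟧ (a , b , tt) ≡ (a ≤ᵇ b)
  leq-sem a b rewrite sub-sem a b with a ∸ b in e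
  ... | zero  = sym (≤⇒≤ᵇ-true {a} {b} (m∸n≡0⇒m≤n e))
  ... | suc d with a ≤ᵇ b in e′
  ...   | false = refl
  ...   | true  with trans (sym e) (m≤n⇒m∸n≡0 (≤ᵇ-true {a} {b} e′))
  ...     | ()

  leq-peak : ∀ {M a b} → b ≤ M → peak leq (a , b , tt) ≤ M
  leq-peak {a = a} {b} le = ⊔-lub (sub-peak {a = a} le) (go (⟦ sub ⟧ (a , b , tt)))
    where
    go : ∀ {M} k → natCase 0 (λ _ → 0) k ≤ M
    go zero    = z≤n
    go (suc _) = z≤n

opaque

  eqN : Tm (nat ∷ nat ∷ []) bool
  eqN = `if (call leq (v0 ▸ v1 ▸ ∅)) (call leq (v1 ▸ v0 ▸ ∅)) `f

  eqN-sem : ∀ a b → ⟦ eqN ⟧ (a , b , tt) ≡ (a ≡ᵇ b)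
  eqN-sem a b rewrite leq-sem a b | leq-sem b a with a ≤ᵇ b in e | b ≤ᵇ a in e′
  ... | true | true  rewrite ≤-antisym (≤ᵇ-true {a} {b} e) (≤ᵇ-true {b} {a} e′) = sym (≡ᵇ-refl b)
  ... | false | _ = sym (≡ᵇ-false {a} {b} λ { refl → false≢true (trans (sym e) (≤⇒≤ᵇ-true (≤-refl {a}))) })
  ... | true | false = sym (≡ᵇ-false {a} {b} λ { refl → false≢true (trans (sym e′) (≤⇒≤ᵇ-true (≤-refl {a}))) })

  eqN-peak : ∀ {M a b} → a ≤ M → b ≤ M → peak eqN (a , b , tt) ≤ M
  eqN-peak {a = a} {b} la lb = ⊔-lub (leq-peak {a = a} lb) (⊔-lub (leq-peak {a = b} la) z≤n)

opaque

  sumL : Tm (list nat ∷ []) nat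
  sumL = `foldr (call add (v0 ▸ v1 ▸ ∅)) `0 v0

  sumL-sem : ∀ xs → ⟦ sumL ⟧ (xs , tt) ≡ sum xs
  sumL-sem xs = foldr-cong′ add-sem 0 xs

  sumL-peak : ∀ {M xs} → length xs ≤ M → All (_≤ M) xs → peak sumL (xs , tt) ≤ M
  sumL-peak le all = ⊔-lub le (foldPeak-All (_≤ _) (λ a q → add-peak a q) all)

opaque

  len : ∀ {A} → Tm (list A ∷ []) nat
  len = `foldr (`suc v1) `0 v0

  len-sem : ∀ {A} (xs : Val (list A)) → ⟦ len {A} ⟧ (xs , tt) ≡ length xs
  len-sem []       = refl
  len-sem {A} (x ∷ xs) = cong suc (len-sem {A} xs)

  len-peak : ∀ {A M} {xs : Val (list A)} → length xs ≤ M → peak (len {A}) (xs , tt) ≤ M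
  len-peak {xs = xs} le = ⊔-lub le (foldPeak≤ (λ _ _ → z≤n) xs)

opaque

  count : Tm (nat ∷ list nat ∷ []) nat
  count = `foldr (`if (call eqN (v0 ▸ v2 ▸ ∅)) (`suc v1) v1) `0 v1

  count-sem : ∀ i xs → ⟦ count ⟧ (i , xs , tt) ≡ cnt i xs
  count-sem i xs = foldr-cong′ go 0 xs
    where
    go : ∀ x a → (if ⟦ eqN ⟧ (x , i , tt) then suc a else a) ≡ ind i x + a
    go x a rewrite eqN-sem x i with x ≡ᵇ i
    ... | true  = refl
    ... | false = refl

  count-peak : ∀ {M i xs} → i ≤ M → length xs ≤ M → All (_≤ M) xs → peak count (i , xs , tt) ≤ M
  count-peak li le all = ⊔-lub le (foldPeak-All (_≤ _) (λ a q → ⊔-lub (eqN-peak q li) z≤n) all)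

opaque

  range : Tm (nat ∷ []) (list nat)
  range = `loop (v0 `∷ v1) `[] v0

  range-peak : ∀ {M n} → n ≤ M → peak range (n , tt) ≤ M
  range-peak {n = n} le = ⊔-lub le (loopPeak≤ (λ _ _ → z≤n) n)

rng : ℕ → List ℕ
rng n = countdown _∷_ n []

opaque
  unfolding range

  range-sem : ∀ n → ⟦ range ⟧ (n , tt) ≡ rng n
  range-sem n = refl

rng-bounded : ∀ n → All (_< n) (rng n)
rng-bounded n = proj₁ (countdown-inv (λ k xs → All (_< n) xs × k ≤ n) (λ { (a , le) → le ∷ a , <⇒≤ le }) n
  ([] , ≤-refl))

∈-rng : ∀ {i n} → i < n → i ∈ rng n
∈-rng {i} {n} i<n = countdown-inv (λ k xs → k ≤ i → i ∈ xs)
  (λ {k} p k≤i → go (m≤n⇒m<n∨m≡n k≤i) p) n (λ n≤i → ⊥-elim (<-irrefl refl (<-≤-trans i<n n≤i))) z≤n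
  where
  go : ∀ {k xs} → (k < i) ⊎ (k ≡ i) → (suc k ≤ i → i ∈ xs) → i ∈ k ∷ xs
  go (inj₁ lt)   p = there (p lt)
  go (inj₂ refl) p = here refl

length-rng : ∀ n → length (rng n) ≡ n
length-rng n = trans (sym (+-identityʳ _)) (countdown-inv (λ k xs → length xs + k ≡ n) (λ {k} {a} p →
  trans (sym (+-suc (length a) k)) p) n refl)

cnt-rng≤1 : ∀ i n → cnt i (rng n) ≤ 1
-- The second component records that indices below the counter have not been inserted yet; it is
-- what rules out a second copy.
cnt-rng≤1 i n = proj₁ (countdown-inv (λ k xs → cnt i xs ≤ 1 × (i < k → cnt i xs ≡ 0)) (λ {_} {xs} →
  step {xs = xs}) n (z≤n , λ _ → refl))
  where
  step : ∀ {k xs} → cnt i xs ≤ 1 × (i < suc k → cnt i xs ≡ 0) →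
         ind i k + cnt i xs ≤ 1 × (i < k → ind i k + cnt i xs ≡ 0)
  step {k} {xs} (le , z) with k ≡ᵇ i in e
  ... | true rewrite ≡ᵇ-true {k} {i} e = s≤s (≤-reflexive (z ≤-refl)) , λ lt → ⊥-elim (<-irrefl refl lt)
  ... | false = le , λ lt → z (m≤n⇒m≤1+n lt)

cnt-rng : ∀ {i n} → i < n → cnt i (rng n) ≡ 1
cnt-rng {i} {n} lt = ≤-antisym (cnt-rng≤1 i n) (≤-trans (≤-reflexive (sym (ind-refl i)))
  (∈⇒≤wt (ind i) (∈-rng lt)))

-- Binary digits of unary numbers

bit : Bool → ℕ
bit b = if b then 1 else 0

opaque

  -- The parity flag flips in every iteration, and the quotient grows when the flag falls back. With
  -- k iterations to go, flag + 2 · quotient + k is constant.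
  halve : Tm (nat ∷ []) (bool ⊗ nat)
  halve = `loop (`if (`fst v1) (`f `, `suc (`snd v1)) (`t `, `snd v1)) (`f `, `0) v0

  halve-peak : ∀ {M n} → n ≤ M → peak halve (n , tt) ≤ M
  halve-peak {n = n} le = ⊔-lub le (loopPeak≤ (λ _ _ → z≤n) n)

odd : ℕ → Bool
odd n = proj₁ (⟦ halve ⟧ (n , tt))

half : ℕ → ℕ
half n = proj₂ (⟦ halve ⟧ (n , tt))

opaque
  unfolding halve

  halve-spec : ∀ n → n ≡ bit (odd n) + 2 * half n
  halve-spec n = sym (trans (sym (+-identityʳ _)) (countdown-inv (λ k (b , h) → bit b + 2 * h + k ≡ n)
    (λ {k} {a} → step {k} (proj₁ a) (proj₂ a)) n {false , 0} refl))
    where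
    step : ∀ {k} b h → bit b + 2 * h + suc k ≡ n →
           let (b′ , h′) = if b then (false , suc h) else (true , h) in bit b′ + 2 * h′ + k ≡ n
    step {k} true  h refl = rearrange h k
      where
      rearrange : ∀ h k → 2 * suc h + k ≡ suc (2 * h + suc k)
      rearrange = solve-∀
    step {k} false h refl = sym (+-suc (2 * h) k)

opaque

  shift : Tm (nat ∷ nat ∷ []) nat
  shift = `loop (`snd (call halve (v1 ▸ ∅))) v1 v0

shiftBy : ℕ → ℕ → ℕ
shiftBy k v = countdown (λ _ → half) k v

bit≤1 : ∀ b → bit b ≤ 1
bit≤1 true  = ≤-refl
bit≤1 false = z≤n

half≤ : ∀ n → half n ≤ n
half≤ n = ≤-trans (m≤m+n (half n) (half n + 0)) (≤-trans (m≤n+m (2 * half n) (bit (odd n)))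
  (≤-reflexive (sym (halve-spec n))))

half-0 : half 0 ≡ 0
half-0 = n≤0⇒n≡0 (half≤ 0)

half-< : ∀ n → half (suc n) ≤ n
half-< n with half (suc n) | halve-spec (suc n)
... | zero  | e = z≤n
... | suc h | e = s≤s⁻¹ (≤-trans (s≤s (≤-trans (s≤s (m≤m+n h 0)) (m≤n+m (suc (h + 0)) h)))
  (≤-trans (m≤n+m (2 * suc h) (bit (odd (suc n)))) (≤-reflexive (sym e))))

shift-half : ∀ k v → shiftBy (suc k) v ≡ half (shiftBy k v)
shift-half zero    v = refl
shift-half (suc k) v = shift-half k (half v)

shift-≤ : ∀ k v → shiftBy k v ≤ v
shift-≤ zero    v = ≤-refl
shift-≤ (suc k) v = ≤-trans (shift-≤ k (half v)) (half≤ v)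

-- Logarithmically many halvings would do. The linear count is affordable because v is kept in
-- unary, and it follows at once from `half-<`.
shift-vanish : ∀ k v → v ≤ k → shiftBy k v ≡ 0
shift-vanish zero    .0 z≤n = refl
shift-vanish (suc k) zero    le = trans (cong (shiftBy k) half-0) (shift-vanish k 0 z≤n)
shift-vanish (suc k) (suc v) (s≤s le) = shift-vanish k _ (≤-trans (half-< v) le)

shift-spec : ∀ k v → shiftBy k v ≡ bit (odd (shiftBy k v)) + 2 * shiftBy (suc k) v
shift-spec k v = trans (halve-spec (shiftBy k v)) (cong (λ h → bit (odd (shiftBy k v)) + 2 * h)
  (sym (shift-half k v)))

opaque
  unfolding shift

  shift-sem : ∀ k v → ⟦ shift ⟧ (k , v , tt) ≡ shiftBy k v
  shift-sem k v = refl

  shift-peak : ∀ {M k v} → k ≤ M → v ≤ M → peak shift (k , v , tt) ≤ M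
  shift-peak {k = k} lk lv = ⊔-lub lk (loopPeak-inv (λ _ a → a ≤ _) (λ {_} {a} p → ≤-trans (half≤ a) p)
    (λ p → halve-peak p) k lv)

module _ {A X : Set} {f : A → X → X} {z : X} where

  foldr-∈-inv : (P : X → Set) → P z → ∀ xs → (∀ {x a} → x ∈ xs → P a → P (f x a)) → P (foldr f z xs)
  foldr-∈-inv P p₀ []       step = p₀
  foldr-∈-inv P p₀ (x ∷ xs) step = step (here refl) (foldr-∈-inv P p₀ xs (λ m → step (there m)))

  foldr-∈-hit : (P : X → Set) → (∀ x {a} → P a → P (f x a)) → ∀ {x xs} → x ∈ xs →
                (∀ a → P (f x a)) → P (foldr f z xs)
  foldr-∈-hit P keep (here refl)        hit = hit _
  foldr-∈-hit P keep {xs = y ∷ _} (there m) hit = keep y (foldr-∈-hit P keep m hit)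

-- Halving multisets

wt-replicate : {X : Set} (g : X → ℕ) → ∀ k a → wt g (replicate k a) ≡ k * g a
wt-replicate g zero    a = refl
wt-replicate g (suc k) a = cong (g a +_) (wt-replicate g k a)

module _ {X : Set} where

  -- Membership proofs decide which letter an element is booked under, so the argument works over
  -- any type, and repeated letters do no harm.
  partition-head : ∀ {a : X} {as} xs → All (_∈ a ∷ as) xs →
    Σ[ k ∈ ℕ ] Σ[ ys ∈ List X ] (∀ g → wt g xs ≡ k * g a + wt g ys) × All (_∈ as) ys
  partition-head [] [] = 0 , [] , (λ _ → refl) , []
  partition-head {a} (x ∷ xs) (m ∷ ms) with partition-head xs ms
  ... | k , ys , e , ms′ with m
  ...   | here refl = suc k , ys , (λ g → trans (cong (g a +_) (e g)) (sym (+-assoc (g a) _ _))) , ms′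
  ...   | there m′  = k , x ∷ ys , (λ g → trans (cong (g x +_) (e g))
    (rearrange (g x) (k * g a) (wt g ys))) , m′ ∷ ms′
    where
    rearrange : ∀ x y z → x + (y + z) ≡ y + (x + z)
    rearrange = solve-∀

  -- Halving all multiplicities leaves at most one copy of each letter over.
  split : ∀ as (xs : List X) → All (_∈ as) xs →
    Σ[ ys ∈ List X ] Σ[ r ∈ List X ] (∀ g → wt g xs ≡ 2 * wt g ys + wt g r) ×
      (∀ g → wt g r ≤ wt g as) × All (_∈ as) ys × All (_∈ as) r
  split []       [] [] = [] , [] , (λ _ → refl) , (λ _ → z≤n) , [] , []
  split (a ∷ as) xs ms with partition-head xs ms
  ... | k , zs , e , ms′ with split as zs ms′
  ...   | ys , r , e′ , le , m₁ , m₂ =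
    replicate (half k) a ++ ys , replicate (bit (odd k)) a ++ r , eq , le′ ,
    ++⁺ (replicate⁺ (half k) (here refl)) (All.map there m₁) ,
    ++⁺ (replicate⁺ (bit (odd k)) (here refl)) (All.map there m₂)
    where
    rearrange : ∀ b h x y r → (b + 2 * h) * x + (2 * y + r) ≡ 2 * (h * x + y) + (b * x + r)
    rearrange = solve-∀
    eq : ∀ g → wt g xs ≡ 2 * wt g (replicate (half k) a ++ ys) + wt g (replicate (bit (odd k)) a ++ r)
    eq g rewrite wt-++ g (replicate (half k) a) ys | wt-++ g (replicate (bit (odd k)) a) r
               | wt-replicate g (half k) a | wt-replicate g (bit (odd k)) a =
      trans (e g) (trans (cong₂ (λ u v → u * g a + v) (halve-spec k) (e′ g))
                         (rearrange (bit (odd k)) (half k) (g a) (wt g ys) (wt g r)))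
    le′ : ∀ g → wt g (replicate (bit (odd k)) a ++ r) ≤ g a + wt g as
    le′ g rewrite wt-++ g (replicate (bit (odd k)) a) r | wt-replicate g (bit (odd k)) a =
      +-mono-≤ (≤-trans (*-monoˡ-≤ (g a) (bit≤1 (odd k))) (≤-reflexive (*-identityˡ (g a)))) (le g)

digit-unique : ∀ {a b x y} → a ≤ 1 → b ≤ 1 → a + 2 * x ≡ b + 2 * y → a ≡ b × x ≡ y
digit-unique {x = x} {y} z≤n z≤n e             = refl , *-cancelˡ-≡ x y 2 e
digit-unique {x = x} {y} z≤n (s≤s z≤n) e       = ⊥-elim (even≢odd x y e)
digit-unique {x = x} {y} (s≤s z≤n) z≤n e       = ⊥-elim (even≢odd y x (sym e))
digit-unique {x = x} {y} (s≤s z≤n) (s≤s z≤n) e = refl , *-cancelˡ-≡ x y 2 (suc-injective e)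

-- Columns and moves

-- A column of the matrix as a list of row indices, with repetition: the row of the tag once, and
-- row i once for each letter i. Rows 1 to q belong to job sizes, rows 0 and q + 1 count
-- configurations and blocks.
Col : Set
Col = ℕ × List ℕ

col entry : Ty
col   = nat ⊗ list nat
entry = list nat ⊗ list col

colWt : (ℕ → ℕ) → Col → ℕ
colWt g (tag , w) = g tag + wt g w

flat : List Col → List ℕ
flat = foldr (λ (tag , w) a → tag ∷ w ++ a) []

wt-flat : ∀ g r → wt g (flat r) ≡ wt (colWt g) r
wt-flat g []             = refl
wt-flat g ((tag , w) ∷ r) = trans (cong (g tag +_)
  (trans (wt-++ g w (flat r)) (cong (wt g w +_) (wt-flat g r))))
                                  (sym (+-assoc (g tag) _ _))

All-flat : ∀ {P : ℕ → Set} {r} → All (λ (tag , w) → P tag × All P w) r → All P (flat r)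
All-flat []              = []
All-flat ((p , ps) ∷ qs) = p ∷ ++⁺ ps (All-flat qs)

extend : {X : Set} → List X → List (List X) → List (List X)
extend as ws = foldr (λ a out → foldr (λ w o → (a ∷ w) ∷ o) out ws) ([] ∷ []) as

module _ {X : Set} {as : List X} where

  []∈extend : ∀ ws → [] ∈ extend as ws
  []∈extend ws = foldr-∈-inv (λ o → [] ∈ o) (here refl) as
    (λ _ m → foldr-∈-inv (λ o → [] ∈ o) m ws (λ _ → there))

  ∷∈extend : ∀ {a w ws} → a ∈ as → w ∈ ws → a ∷ w ∈ extend as ws
  ∷∈extend {a} {w} {ws} a∈ w∈ = foldr-∈-hit (λ o → a ∷ w ∈ o)
    (λ _ m → foldr-∈-inv (λ o → a ∷ w ∈ o) m ws (λ _ → there)) a∈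
    (λ out → foldr-∈-hit (λ o → a ∷ w ∈ o) (λ _ → there) w∈ (λ _ → here refl))

  extend-sound : ∀ {ws} → All (All (_∈ as)) ws → All (All (_∈ as)) (extend as ws)
  extend-sound {ws} ps = foldr-∈-inv (All (All (_∈ as))) ([] ∷ []) as
    (λ a∈ qs → foldr-∈-inv (All (All (_∈ as))) qs ws (λ w∈ rs → (a∈ ∷ All.lookup ps w∈) ∷ rs))

opaque

  words : ∀ {A} → Tm (list A ∷ nat ∷ []) (list (list A))
  words = `loop (`foldr (`foldr ((v2 `∷ v0) `∷ v1) v1 v3) (`[] `∷ `[]) v2) (`[] `∷ `[]) v1

  words-complete : ∀ {A} (as : List (Val A)) n {w} → All (_∈ as) w → length w ≤ n →
    w ∈ ⟦ words {A} ⟧ (as , n , tt)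
  words-complete {A} as n ms le = countdown-inv
    (λ k ws → ∀ {w} → All (_∈ as) w → length w + k ≤ n → w ∈ ws)
    (λ {k} {ws} ih → λ { [] le → []∈extend {as = as} ws
                       ; {x ∷ w} (m ∷ ms) le →
                         ∷∈extend m (ih ms (≤-trans (≤-reflexive (+-suc (length w) k)) le)) })
    n (λ { [] _ → here refl ; {_ ∷ w} (_ ∷ _) le →
      ⊥-elim (<-irrefl refl (≤-trans (s≤s (m≤n+m n (length w))) le)) })
    ms (≤-trans (≤-reflexive (+-identityʳ _)) le)

  words-sound : ∀ {A} (as : List (Val A)) n {w} → w ∈ ⟦ words {A} ⟧ (as , n , tt) → All (_∈ as) w
  words-sound as n m = All.lookup (countdown-inv (λ _ → All (All (_∈ as))) extend-sound n ([] ∷ [])) m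

opaque

  flatten : Tm (list col ∷ []) (list nat)
  flatten = `foldr (call append ((`fst v0 `∷ `snd v0) ▸ v1 ▸ ∅)) `[] v0

  flatten-sem : ∀ r → ⟦ flatten ⟧ (r , tt) ≡ flat r
  flatten-sem r = foldr-cong′ (λ x a → append-sem (proj₁ x ∷ proj₂ x) a) [] r

opaque

  colsFor : Tm (nat ∷ nat ∷ list (list nat) ∷ []) (list col)
  colsFor = `foldr (`if (call leq (call sumL (v0 ▸ ∅) ▸ v3 ▸ ∅)) ((v2 `, v0) `∷ v1) v1) `[] v2

  colsFor-sound : ∀ tag cap ws {c} → c ∈ ⟦ colsFor ⟧ (tag , cap , ws , tt) →
                  proj₁ c ≡ tag × proj₂ c ∈ ws × sum (proj₂ c) ≤ cap
  colsFor-sound tag cap ws m = All.lookup (foldr-∈-inv (All (λ c → proj₁ c ≡ tag × proj₂ c ∈ ws ×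
    sum (proj₂ c) ≤ cap)) [] ws step) m
    where
    step : ∀ {w} {a : List Col} → w ∈ ws → All (λ c → proj₁ c ≡ tag × proj₂ c ∈ ws × sum (proj₂ c) ≤ cap) a →
           All (λ c → proj₁ c ≡ tag × proj₂ c ∈ ws × sum (proj₂ c) ≤ cap)
             (if ⟦ leq ⟧ (⟦ sumL ⟧ (w , tt) , cap , tt) then (tag , w) ∷ a else a)
    step {w} w∈ ps rewrite sumL-sem w | leq-sem (sum w) cap with sum w ≤ᵇ cap in e
    ... | true  = (refl , w∈ , ≤ᵇ-true {sum w} e) ∷ ps
    ... | false = ps

  colsFor-complete : ∀ tag cap ws {w} → w ∈ ws → sum w ≤ cap → (tag , w) ∈ ⟦ colsFor ⟧ (tag , cap , ws , tt)
  colsFor-complete tag cap ws {w} w∈ le = foldr-∈-hit ((tag , w) ∈_) keep w∈ hit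
    where
    keep : ∀ w′ {a : List Col} → (tag , w) ∈ a →
           (tag , w) ∈ (if ⟦ leq ⟧ (⟦ sumL ⟧ (w′ , tt) , cap , tt) then (tag , w′) ∷ a else a)
    keep w′ m with ⟦ leq ⟧ (⟦ sumL ⟧ (w′ , tt) , cap , tt)
    ... | true  = there m
    ... | false = m
    hit : ∀ (a : List Col) → (tag , w) ∈ (if ⟦ leq ⟧ (⟦ sumL ⟧ (w , tt) , cap , tt) then (tag , w) ∷ a else a)
    hit a rewrite sumL-sem w | leq-sem (sum w) cap | ≤⇒≤ᵇ-true le = here refl

opaque

  sizes : Tm (nat ∷ []) (list nat)
  sizes = `loop (`suc v0 `∷ v1) `[] v0

  sizes-sound : ∀ q {i} → i ∈ ⟦ sizes ⟧ (q , tt) → 0 < i × i ≤ q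
  sizes-sound q m = All.lookup (proj₁ (countdown-inv (λ k xs → All (λ i → 0 < i × i ≤ q) xs × k ≤ q)
    (λ { (a , le) → (z<s , le) ∷ a , <⇒≤ le }) q ([] , ≤-refl))) m

  sizes-complete : ∀ q {i} → 0 < i → i ≤ q → i ∈ ⟦ sizes ⟧ (q , tt)
  sizes-complete q {i} pos le = countdown-inv (λ k xs → k < i → i ∈ xs)
    (λ p k<i → go (m≤n⇒m<n∨m≡n k<i) p) q (λ q<i → ⊥-elim (<-irrefl refl (<-≤-trans q<i le))) pos
    where
    go : ∀ {k xs} → (suc k < i) ⊎ (suc k ≡ i) → (suc k < i → i ∈ xs) → i ∈ suc k ∷ xs
    go (inj₁ lt)   p = there (p lt)
    go (inj₂ refl) p = here refl

opaque

  -- Columns with tag 0 are contents of a machine, those with tag 1 + q are blocks.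
  columns : Tm (nat ∷ nat ∷ nat ∷ []) (list col)
  -- Letters are positive, so (q + 1) L bounds the number of letters in a word of volume at most L
  -- or T₀, given T₀ ≤ (q + 1) L.
  columns = `let (call words (call sizes (v0 ▸ ∅) ▸ call mul (`suc v0 ▸ v1 ▸ ∅) ▸ ∅))
              (call append (call colsFor (`0 ▸ v3 ▸ v0 ▸ ∅) ▸ call colsFor (`suc v1 ▸ v2 ▸ v0 ▸ ∅) ▸ ∅))

length≤sum : ∀ {w} → All (0 <_) w → length w ≤ sum w
length≤sum []       = z≤n
length≤sum (p ∷ ps) = +-mono-≤ p (length≤sum ps)

cols : ℕ → ℕ → ℕ → List Col
cols q L T₀ = ⟦ columns ⟧ (q , L , T₀ , tt)

record Column (q L T₀ : ℕ) (c : Col) : Set where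
  constructor column
  field
    shape   : (proj₁ c ≡ 0 × sum (proj₂ c) ≤ T₀) ⊎ (proj₁ c ≡ suc q × sum (proj₂ c) ≤ L)
    letters : All (λ i → 0 < i × i ≤ q) (proj₂ c)

smallWords : ℕ → ℕ → List (List ℕ)
smallWords q L = ⟦ words ⟧ (⟦ sizes ⟧ (q , tt) , ⟦ mul ⟧ (suc q , L , tt) , tt)

opaque
  unfolding columns

  cols-sem : ∀ q L T₀ → cols q L T₀ ≡ ⟦ colsFor ⟧ (0 , T₀ , smallWords q L , tt) ++
                                        ⟦ colsFor ⟧ (suc q , L , smallWords q L , tt)
  cols-sem q L T₀ = append-sem (⟦ colsFor ⟧ (0 , T₀ , smallWords q L , tt)) _

smallWords-letters : ∀ q L {w} → w ∈ smallWords q L → All (λ i → 0 < i × i ≤ q) w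
smallWords-letters q L w∈ = All.map (sizes-sound q) (words-sound (⟦ sizes ⟧ (q , tt)) _ w∈)

columns-sound : ∀ q L T₀ {c} → c ∈ cols q L T₀ → Column q L T₀ c
columns-sound q L T₀ m
  with ∈-++⁻ (⟦ colsFor ⟧ (0 , T₀ , smallWords q L , tt)) (subst (_ ∈_) (cols-sem q L T₀) m)
... | inj₁ m′ with colsFor-sound 0 T₀ (smallWords q L) m′
...   | refl , w∈ , le = column (inj₁ (refl , le)) (smallWords-letters q L w∈)
columns-sound q L T₀ m | inj₂ m′ with colsFor-sound (suc q) L (smallWords q L) m′
...   | refl , w∈ , le = column (inj₂ (refl , le)) (smallWords-letters q L w∈)

columns-complete : ∀ q L T₀ {c} → T₀ ≤ suc q * L → Column q L T₀ c → c ∈ cols q L T₀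
columns-complete q L T₀ {tag , w} T₀≤ (column s ps) = subst (_ ∈_) (sym (cols-sem q L T₀)) (go s)
  where
  w∈ : sum w ≤ suc q * L → w ∈ smallWords q L
  w∈ le = words-complete (⟦ sizes ⟧ (q , tt)) _ (All.map (λ (p , l) → sizes-complete q p l) ps)
    (≤-trans (length≤sum (All.map proj₁ ps)) (≤-trans le (≤-reflexive (sym (mul-sem (suc q) L)))))
  go : (tag ≡ 0 × sum w ≤ T₀) ⊎ (tag ≡ suc q × sum w ≤ L) →
       (tag , w) ∈ ⟦ colsFor ⟧ (0 , T₀ , smallWords q L , tt) ++ ⟦ colsFor ⟧ (suc q , L , smallWords q L , tt)
  go (inj₁ (refl , le)) = ∈-++⁺ˡ (colsFor-complete 0 T₀ _ (w∈ (≤-trans le T₀≤)) le)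
  go (inj₂ (refl , le)) = ∈-++⁺ʳ (⟦ colsFor ⟧ (0 , T₀ , smallWords q L , tt))
                                 (colsFor-complete (suc q) L _ (w∈ (≤-trans le (m≤m+n L _))) le)

opaque

  -- Carries are multisets of rows no longer than all columns laid end to end; moves are multisets
  -- of at most as many columns as there are. `solves-down` shows that these finite ranges suffice.
  -- Multisets are listed with all their orderings, which costs only a factor depending on q.
  tables : Tm (nat ∷ nat ∷ nat ∷ []) (list (list nat) ⊗ list (list col))
  tables = `let (call columns (v0 ▸ v1 ▸ v2 ▸ ∅))
             (call words (call range (`suc (`suc v1) ▸ ∅) ▸ call len (call flatten (v0 ▸ ∅) ▸ ∅) ▸ ∅) `,
              call words (v0 ▸ call len (v0 ▸ ∅) ▸ ∅))

opaque

  test : Tm (nat ∷ list nat ∷ list col ∷ list nat ∷ list nat ∷ []) bool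
  test = `foldr (`if (call eqN (call count (v0 ▸ call append (v3 ▸ call flatten (v4 ▸ ∅) ▸ ∅) ▸ ∅) ▸
                                call count (v0 ▸ call append (v5 ▸ call append (v6 ▸ v6 ▸ ∅) ▸ ∅) ▸ ∅) ▸ ∅))
                     v1 `f) `t (call range (v0 ▸ ∅))

box : ℕ → ℕ → ℕ → List (List ℕ)
box q L T₀ = proj₁ (⟦ tables ⟧ (q , L , T₀ , tt))

moves : ℕ → ℕ → ℕ → List (List Col)
moves q L T₀ = proj₂ (⟦ tables ⟧ (q , L , T₀ , tt))

opaque
  unfolding tables

  box-complete : ∀ q L T₀ {c} → All (_< 2 + q) c → length c ≤ length (flat (cols q L T₀)) → c ∈ box q L T₀
  box-complete q L T₀ ps le = words-complete {nat} (⟦ range ⟧ (2 + q , tt)) _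
    (All.map (λ {i} lt → subst (i ∈_) (sym (range-sem (2 + q))) (∈-rng lt)) ps)
    (≤-trans le (≤-reflexive (sym (trans (len-sem {nat} (⟦ flatten ⟧ (cols q L T₀ , tt)))
      (cong length (flatten-sem (cols q L T₀)))))))

  moves-complete : ∀ q L T₀ {r} → All (_∈ cols q L T₀) r → length r ≤ length (cols q L T₀) → r ∈ moves q L T₀
  moves-complete q L T₀ ps le = words-complete {col} (cols q L T₀) _ ps
    (≤-trans le (≤-reflexive (sym (len-sem {col} (cols q L T₀)))))

  moves-sound : ∀ q L T₀ {r} → r ∈ moves q L T₀ → All (_∈ cols q L T₀) r
  moves-sound q L T₀ m = words-sound {col} (cols q L T₀) _ m

-- One position of the addition. A solution X = r + 2 X′ of c + X = v, where v has last digit δ and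
-- half v′, amounts to c + r = δ + 2 c′ together with c′ + X′ = v′.
Match : ℕ → List ℕ → List Col → List ℕ → List ℕ → Set
Match Q c r δ c′ = ∀ {i} → i < Q → cnt i c + cnt i (flat r) ≡ cnt i δ + 2 * cnt i c′

agrees : List ℕ → List Col → List ℕ → List ℕ → ℕ → Bool
agrees c r δ c′ i = ⟦ eqN ⟧ (⟦ count ⟧ (i , ⟦ append ⟧ (c , ⟦ flatten ⟧ (r , tt) , tt) , tt) ,
                             ⟦ count ⟧ (i , ⟦ append ⟧ (δ , ⟦ append ⟧ (c′ , c′ , tt) , tt) , tt) , tt)

agrees-sem : ∀ c r δ c′ i → agrees c r δ c′ i ≡ (cnt i c + cnt i (flat r) ≡ᵇ cnt i δ + 2 * cnt i c′)
agrees-sem c r δ c′ i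
  rewrite flatten-sem r | append-sem c (flat r) | append-sem c′ c′ | append-sem δ (c′ ++ c′)
        | count-sem i (c ++ flat r) | count-sem i (δ ++ c′ ++ c′)
        | wt-++ (ind i) c (flat r) | wt-++ (ind i) δ (c′ ++ c′) | wt-++ (ind i) c′ c′
        | +-identityʳ (cnt i c′) =
  eqN-sem (cnt i c + cnt i (flat r)) (cnt i δ + (cnt i c′ + cnt i c′))

allᵇ : (ℕ → Bool) → List ℕ → Bool
allᵇ p = foldr (λ i a → if p i then a else false) true

allᵇ-sound : ∀ p xs → allᵇ p xs ≡ true → ∀ {i} → i ∈ xs → p i ≡ true
allᵇ-sound p (x ∷ xs) e m with p x in e′
allᵇ-sound p (x ∷ xs) e (here refl) | true = e′
allᵇ-sound p (x ∷ xs) e (there m)   | true = allᵇ-sound p xs e m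
allᵇ-sound p (x ∷ xs) () m          | false

allᵇ-complete : ∀ p {xs} → All (λ i → p i ≡ true) xs → allᵇ p xs ≡ true
allᵇ-complete p []       = refl
allᵇ-complete p (e ∷ es) rewrite e = allᵇ-complete p es

opaque
  unfolding test

  test-sound : ∀ Q c r δ c′ → ⟦ test ⟧ (Q , c , r , δ , c′ , tt) ≡ true → Match Q c r δ c′
  test-sound Q c r δ c′ e {i} i<Q =
    ≡ᵇ-true (trans (sym (agrees-sem c r δ c′ i))
      (allᵇ-sound (agrees c r δ c′) (rng Q)
        (subst (λ xs → allᵇ (agrees c r δ c′) xs ≡ true) (range-sem Q) e) (∈-rng i<Q)))

  test-complete : ∀ Q c r δ c′ → Match Q c r δ c′ → ⟦ test ⟧ (Q , c , r , δ , c′ , tt) ≡ true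
  test-complete Q c r δ c′ m =
    subst (λ xs → allᵇ (agrees c r δ c′) xs ≡ true) (sym (range-sem Q))
      (allᵇ-complete (agrees c r δ c′) (All.map go (rng-bounded Q)))
    where
    go : ∀ {i} → i < Q → agrees c r δ c′ i ≡ true
    go {i} lt = trans (agrees-sem c r δ c′ i) (trans (cong (cnt i c + cnt i (flat r) ≡ᵇ_) (sym (m lt)))
      (≡ᵇ-refl (cnt i c + cnt i (flat r))))

-- Solving the system of columns digit by digit

Entry : Set
Entry = List ℕ × List Col

opaque

  -- For every carry c, look for a move r and an entry (c′ , X) with c + r = δ + 2 c′.
  step : Tm (list nat ∷ list entry ∷ nat ∷ list (list nat) ∷ list (list col) ∷ []) (list entry)
  step = `foldr (`foldr (`foldr
           (`if (call test (v8 ▸ v4 ▸ v2 ▸ v6 ▸ `fst v0 ▸ ∅))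
                ((v4 `, call append (`snd v0 ▸ call append (`snd v0 ▸ v2 ▸ ∅) ▸ ∅)) `∷ v5)
                v1)
           v1 v5) v1 v6) `[] v3

module _ (δ : List ℕ) (es : List Entry) (Q : ℕ) (box : List (List ℕ)) (moves : List (List Col)) where

  Found : List ℕ → List Col → Set
  Found c X = Σ[ e ∈ Entry ] Σ[ r ∈ List Col ]
    e ∈ es × r ∈ moves × Match Q c r δ (proj₁ e) × X ≡ proj₂ e ++ proj₂ e ++ r

  private
    -- A hit is consed onto `out`, the table before carry `c` was considered, and thereby replaces
    -- earlier hits for `c`. Each carry of the box contributes at most one entry, so the table never
    -- outgrows the box.
    put : List ℕ → List Entry → List Col → Entry → List Entry → List Entry
    put c out r e o = if ⟦ test ⟧ (Q , c , r , δ , proj₁ e , tt)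
      then (c , ⟦ append ⟧ (proj₂ e , ⟦ append ⟧ (proj₂ e , r , tt) , tt)) ∷ out else o

    scan : List ℕ → List Entry → List Entry
    scan c out = foldr (λ r o → foldr (put c out r) o es) out moves

    Outcome : List ℕ → List Entry → List Entry → Set
    Outcome c out o = (o ≡ out) ⊎ (Σ[ X ∈ List Col ] o ≡ (c , X) ∷ out × Found c X)

    scan-sound : ∀ c out → Outcome c out (scan c out)
    scan-sound c out = foldr-∈-inv (Outcome c out) (inj₁ refl) moves λ {r} r∈ p →
      foldr-∈-inv (Outcome c out) p es λ {e} {o} e∈ p′ → go r∈ e∈ p′
      where
      go : ∀ {r e o} → r ∈ moves → e ∈ es → Outcome c out o → Outcome c out (put c out r e o)
      go {r} {e} r∈ e∈ p with ⟦ test ⟧ (Q , c , r , δ , proj₁ e , tt) in eq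
      ... | false = p
      ... | true  = inj₂ (_ , refl , e , r , e∈ , r∈ , test-sound Q c r δ (proj₁ e) eq ,
                          trans (append-sem {col} (proj₂ e) _)
                            (cong (proj₂ e ++_) (append-sem {col} (proj₂ e) r)))

    Hit : List ℕ → List Entry → List Entry → Set
    Hit c out o = Σ[ X ∈ List Col ] o ≡ (c , X) ∷ out

    scan-complete : ∀ c out {e r} → e ∈ es → r ∈ moves → Match Q c r δ (proj₁ e) → Hit c out (scan c out)
    scan-complete c out {e} {r} e∈ r∈ m =
      foldr-∈-hit (Hit c out) (λ r′ p → foldr-∈-inv (Hit c out) p es (λ {e′} _ p′ → keep r′ e′ p′)) r∈
        (λ o → foldr-∈-hit (Hit c out) (λ e′ p′ → keep r e′ p′) e∈ (λ o′ → hit o′))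
      where
      keep : ∀ r e {o} → Hit c out o → Hit c out (put c out r e o)
      keep r e p with ⟦ test ⟧ (Q , c , r , δ , proj₁ e , tt)
      ... | true  = _ , refl
      ... | false = p
      hit : ∀ o → Hit c out (put c out r e o)
      hit o rewrite test-complete Q c r δ (proj₁ e) m = _ , refl

  next : List Entry
  next = ⟦ step ⟧ (δ , es , Q , box , moves , tt)

  opaque
    unfolding step

    step-sound : All (λ (c , X) → c ∈ box × Found c X) next
    step-sound = foldr-∈-inv (All (λ (c , X) → c ∈ box × Found c X)) [] box λ {c} {out} c∈ ps →
      go c∈ ps (scan-sound c out)
      where
      go : ∀ {c out o} → c ∈ box → All (λ (c , X) → c ∈ box × Found c X) out → Outcome c out o →
           All (λ (c , X) → c ∈ box × Found c X) o
      go c∈ ps (inj₁ refl)           = ps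
      go c∈ ps (inj₂ (X , refl , f)) = (c∈ , f) ∷ ps

    step-complete : ∀ {c e r} → c ∈ box → e ∈ es → r ∈ moves → Match Q c r δ (proj₁ e) →
                    Σ[ X ∈ List Col ] (c , X) ∈ next
    step-complete {c} c∈ e∈ r∈ m = foldr-∈-hit P (λ c′ {out} p → keep p (scan-sound c′ out)) c∈ λ out →
      let X , eq = scan-complete c out e∈ r∈ m in X , subst ((c , X) ∈_) (sym eq) (here refl)
      where
      P : List Entry → Set
      P o = Σ[ X ∈ List Col ] (c , X) ∈ o
      keep : ∀ {c′ out o} → P out → Outcome c′ out o → P o
      keep p         (inj₁ refl)           = p
      keep (X , x∈)  (inj₂ (_ , refl , _)) = X , there x∈

    step-length : length next ≤ length box
    step-length = foldr-inv (λ cs o → length o ≤ length cs) z≤n (λ c {cs} {out} p →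
      go {cs} p (scan-sound c out)) box
      where
      go : ∀ {cs : List (List ℕ)} {c out o} → length out ≤ length cs → Outcome c out o →
        length o ≤ suc (length cs)
      go p (inj₁ refl)           = m≤n⇒m≤1+n p
      go p (inj₂ (_ , refl , _)) = s≤s p

    step-peak : ∀ {M} → length box ≤ M → length moves ≤ M → length es ≤ M →
      All (λ e → length (proj₂ e) ≤ M) es →
      (∀ {c r e} → c ∈ box → r ∈ moves → e ∈ es → peak test (Q , c , r , δ , proj₁ e , tt) ≤ M) →
      peak step (δ , es , Q , box , moves , tt) ≤ M
    step-peak lb lm le lX lt =
      ⊔-lub lb (foldPeak-All (_∈ box) (λ out c∈ →
        ⊔-lub lm (foldPeak-All (_∈ moves) (λ o r∈ →
          ⊔-lub le (foldPeak-All (_∈ es) (λ {e} o′ e∈ →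
            ⊔-lub (lt c∈ r∈ e∈) (⊔-lub (⊔-lub (⊔-lub (⊔-lub (append-peak {col} (All.lookup lX e∈)) z≤n)
              (append-peak {col} (All.lookup lX e∈))) z≤n) z≤n))
            (All.tabulate λ m → m))) (All.tabulate λ m → m))) (All.tabulate λ m → m))

filterᵇ-cnt : ∀ (p : ℕ → Bool) i xs → cnt i (foldr (λ x a → if p x then x ∷ a else a) [] xs) ≡ bit
  (p i) * cnt i xs
filterᵇ-cnt p i []       = sym (*-zeroʳ (bit (p i)))
filterᵇ-cnt p i (x ∷ xs) with p x in e
... | true  with x ≡ᵇ i in e′
...   | true  rewrite filterᵇ-cnt p i xs | sym (≡ᵇ-true {x} {i} e′) | e = refl
...   | false = filterᵇ-cnt p i xs
filterᵇ-cnt p i (x ∷ xs) | false with x ≡ᵇ i in e′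
...   | true  rewrite filterᵇ-cnt p i xs | sym (≡ᵇ-true {x} {i} e′) | e = refl
...   | false = filterᵇ-cnt p i xs

opaque

  -- Digit k of the right-hand side: the rows in which the multiplicity has its k-th bit set.
  bits : Tm (nat ∷ nat ∷ list nat ∷ []) (list nat)
  bits = `foldr (`if (`fst (call halve (call shift (v2 ▸ call count (v0 ▸ v4 ▸ ∅) ▸ ∅) ▸ ∅))) (v0 `∷ v1) v1)
                `[] (call range (v1 ▸ ∅))

  bits-sem : ∀ k Q items → ⟦ bits ⟧ (k , Q , items , tt) ≡
             foldr (λ i a → if odd (shiftBy k (cnt i items)) then i ∷ a else a) [] (rng Q)
  bits-sem k Q items rewrite range-sem Q = foldr-cong′ go [] (rng Q)
    where
    go : ∀ i (a : List ℕ) →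
      (if odd (⟦ shift ⟧ (k , ⟦ count ⟧ (i , items , tt) , tt)) then i ∷ a else a) ≡
      (if odd (shiftBy k (cnt i items)) then i ∷ a else a)
    go i a rewrite count-sem i items | shift-sem k (cnt i items) = refl

cnt≤length : ∀ i xs → cnt i xs ≤ length xs
cnt≤length i []       = z≤n
cnt≤length i (x ∷ xs) with x ≡ᵇ i
... | true  = s≤s (cnt≤length i xs)
... | false = m≤n⇒m≤1+n (cnt≤length i xs)

opaque
  unfolding bits

  bits-peak : ∀ {M k Q items} → k ≤ M → Q ≤ M → length items ≤ M → All (_≤ M) items →
              peak bits (k , Q , items , tt) ≤ M
  bits-peak {M} {k} {Q} {items} lk lQ ll la rewrite range-sem Q = ⊔-lub (range-peak lQ)
    (⊔-lub (≤-trans (≤-reflexive (length-rng Q)) lQ)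
      (foldPeak-All (_< Q) (λ {i} a lt → ⊔-lub (go i a (≤-trans (<⇒≤ lt) lQ)) z≤n) (rng-bounded Q)))
    where
    go : ∀ i (a : List ℕ) → i ≤ M → peak {nat ∷ list nat ∷ nat ∷ nat ∷ list nat ∷ []}
      (`fst (call halve (call shift (v2 ▸ call count (v0 ▸ v4 ▸ ∅) ▸ ∅) ▸ ∅))) (i , a , k , Q , items , tt) ≤ M
    go i a li with ⟦ count ⟧ (i , items , tt) | count-sem i items
    ... | v | refl = ⊔-lub (⊔-lub (⊔-lub (count-peak li ll la) z≤n) (shift-peak lk lv))
                           (halve-peak (≤-trans (≤-reflexive (shift-sem k _)) (≤-trans (shift-≤ k _) lv)))
      where
      lv : cnt i items ≤ M
      lv = ≤-trans (cnt≤length i items) ll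

cnt-bits : ∀ k Q items {i} → i < Q → cnt i (⟦ bits ⟧ (k , Q , items , tt)) ≡ bit (odd (shiftBy k (cnt i items)))
cnt-bits k Q items {i} lt rewrite bits-sem k Q items | filterᵇ-cnt (λ i → odd (shiftBy k (cnt i items))) i
  (rng Q) | cnt-rng lt =
  *-identityʳ _

-- The bound is free of the number of items; this keeps every input of `test` bounded in terms of q.
bits-size : ∀ k Q items → size (list nat) (⟦ bits ⟧ (k , Q , items , tt)) ≤ Q + Q
bits-size k Q items rewrite bits-sem k Q items = ≤-trans
  (go (rng-bounded Q)) (+-monoʳ-≤ Q (≤-reflexive (length-rng Q)))
  where
  go : ∀ {xs} → All (_< Q) xs →
    size (list nat) (foldr (λ i a → if odd (shiftBy k (cnt i items)) then i ∷ a else a) [] xs) ≤ Q + length xs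
  go [] = z≤n
  go {x ∷ xs} (lt ∷ lts) with odd (shiftBy k (cnt x items))
  ... | true  = ≤-trans (s≤s (⊔-lub (≤-trans (<⇒≤ lt) (m≤m+n Q (length xs))) (go lts)))
    (≤-reflexive (sym (+-suc Q (length xs))))
  ... | false = ≤-trans (go lts) (+-monoʳ-≤ Q (n≤1+n _))

opaque

  dp : Tm (nat ∷ list (list nat) ∷ list (list col) ∷ list nat ∷ []) (list entry)
  dp = `loop (call step (call bits (v0 ▸ v2 ▸ v5 ▸ ∅) ▸ v1 ▸ v2 ▸ v3 ▸ v4 ▸ ∅))
             -- A multiplicity is at most the number of items and has vanished after that many
             -- halvings. At this position only the empty carry can be completed, by the empty list
             -- of columns, and the loop descends from there to position 0.
             ((`[] `, `[]) `∷ `[]) (call len (v3 ▸ ∅))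

-- Correctness of the dynamic program

module _ (q L T₀ : ℕ) (items : List ℕ) where

  private
    C : List Col
    C = cols q L T₀

    W : ℕ
    W = length (flat C)

    δ : ℕ → List ℕ
    δ k = ⟦ bits ⟧ (k , 2 + q , items , tt)

  -- c and X together account for the items divided by 2 ^ k.
  Solves : ℕ → List ℕ → List Col → Set
  Solves k c X = ∀ {i} → i < 2 + q → cnt i c + cnt i (flat X) ≡ shiftBy k (cnt i items)

  -- Completeness promises some solution for the carry c, not the given X. Only solvability for c
  -- matters to the lower digits, which is why one entry per carry is enough.
  record Valid (k : ℕ) (es : List Entry) : Set where
    field
      sound    : ∀ {c X} → (c , X) ∈ es → c ∈ box q L T₀ × All (_∈ C) X × Solves k c X
      complete : ∀ {c X} → All (_< 2 + q) c → length c ≤ W → All (_∈ C) X → Solves k c X →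
                 Σ[ X′ ∈ List Col ] (c , X′) ∈ es
      short    : length es ≤ suc (length (box q L T₀))
  open Valid

  cols-letters : All (λ (tag , w) → tag < 2 + q × All (_< 2 + q) w) C
  cols-letters = All.tabulate λ m → go (columns-sound q L T₀ m)
    where
    go : ∀ {c} → Column q L T₀ c → proj₁ c < 2 + q × All (_< 2 + q) (proj₂ c)
    go (column (inj₁ (refl , _)) ls) = z<s , All.map (λ (_ , le) → m≤n⇒m≤1+n (s≤s le)) ls
    go (column (inj₂ (refl , _)) ls) = ≤-refl , All.map (λ (_ , le) → m≤n⇒m≤1+n (s≤s le)) ls

  empty-solves : ∀ {c X} → All (_< 2 + q) c → (∀ {i} → i < 2 + q → cnt i c + cnt i (flat X) ≡ 0) → c ≡ []
  empty-solves {[]} ps e = refl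
  empty-solves {x ∷ c} (p ∷ ps) e with e p
  ... | e′ rewrite ≡ᵇ-refl x with e′
  ...   | ()

  valid-start : Valid (length items) (([] , []) ∷ [])
  valid-start .sound (here refl) = box-complete q L T₀ [] z≤n , [] ,
    λ {i} _ → sym (shift-vanish (length items) _ (cnt≤length i items))
  valid-start .complete {c} {X} ps _ _ s
    rewrite empty-solves {c} {X} ps (λ {i} lt →
      trans (s lt) (shift-vanish (length items) _ (cnt≤length i items))) =
      [] , here refl
  valid-start .short = s≤s z≤n

  cnt-flat-++ : ∀ i X Y → cnt i (flat (X ++ Y)) ≡ cnt i (flat X) + cnt i (flat Y)
  cnt-flat-++ i X Y = trans (wt-flat (ind i) (X ++ Y)) (trans (wt-++ (colWt (ind i)) X Y)
    (sym (cong₂ _+_ (wt-flat (ind i) X) (wt-flat (ind i) Y))))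

  solves-up : ∀ {k c c′ X r} → Match (2 + q) c r (δ k) c′ → Solves (suc k) c′ X → Solves k c (X ++ X ++ r)
  solves-up {k} {c} {c′} {X} {r} m s {i} lt = begin
    cnt i c + cnt i (flat (X ++ X ++ r))
      ≡⟨ cong (cnt i c +_) (trans (cnt-flat-++ i X (X ++ r)) (cong (cnt i (flat X) +_) (cnt-flat-++ i X r))) ⟩
    cnt i c + (cnt i (flat X) + (cnt i (flat X) + cnt i (flat r)))
      ≡⟨ rearrange₁ (cnt i c) (cnt i (flat X)) (cnt i (flat r)) ⟩
    cnt i c + cnt i (flat r) + 2 * cnt i (flat X)
      ≡⟨ cong (_+ 2 * cnt i (flat X)) (m lt) ⟩
    cnt i (δ k) + 2 * cnt i c′ + 2 * cnt i (flat X)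
      ≡⟨ rearrange₂ (cnt i (δ k)) (cnt i c′) (cnt i (flat X)) ⟩
    cnt i (δ k) + 2 * (cnt i c′ + cnt i (flat X))
      ≡⟨ cong₂ (λ x y → x + 2 * y) (cnt-bits k (2 + q) items lt) (s lt) ⟩
    bit (odd (shiftBy k (cnt i items))) + 2 * shiftBy (suc k) (cnt i items)
      ≡⟨ shift-spec k (cnt i items) ⟨
    shiftBy k (cnt i items) ∎
    where
    open ≡-Reasoning
    rearrange₁ : ∀ c x r → c + (x + (x + r)) ≡ c + r + 2 * x
    rearrange₁ = solve-∀
    rearrange₂ : ∀ d c x → d + 2 * c + 2 * x ≡ d + 2 * (c + x)
    rearrange₂ = solve-∀

  -- The converse of `solves-up`. Halving the multiplicities in X gives X′ and a remainder r with at
  -- most one copy of each column; halving c + r gives c′ and a remainder ρ with at most one copy of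
  -- each row. Then ρ is the digit δ, because a number has only one last binary digit.
  solves-down : ∀ {k c X} → All (_< 2 + q) c → length c ≤ W → All (_∈ C) X → Solves k c X →
    Σ[ c′ ∈ List ℕ ] Σ[ X′ ∈ List Col ] Σ[ r ∈ List Col ]
      All (_< 2 + q) c′ × length c′ ≤ W × All (_∈ C) X′ × Solves (suc k) c′ X′ ×
      All (_∈ C) r × length r ≤ length C × Match (2 + q) c r (δ k) c′
  solves-down {k} {c} {X} ps le X⊆ s with split C X X⊆
  ... | X′ , r , eX , ler , X′⊆ , r⊆ with split (rng (2 + q)) (c ++ flat r) (All.map ∈-rng
                                            (++⁺ ps (All-flat (All.map (All.lookup cols-letters) r⊆))))
  ...   | c′ , ρ , eu , leρ , c′⊆ , _ =
    c′ , X′ , r , All.map (All.lookup (rng-bounded (2 + q))) c′⊆ , len≤ , X′⊆ ,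
    (λ lt → proj₂ (digits lt)) , r⊆ , subst₂ _≤_ (wt-1 r) (wt-1 C) (ler (λ _ → 1)) , match
    where
    open ≡-Reasoning
    rearrange : ∀ ρ c x → 2 * c + ρ + 2 * x ≡ ρ + 2 * (c + x)
    rearrange = solve-∀
    rearrange′ : ∀ c x r → c + (2 * x + r) ≡ c + r + 2 * x
    rearrange′ = solve-∀
    digits : ∀ {i} → i < 2 + q → cnt i ρ ≡ bit (odd (shiftBy k (cnt i items))) ×
                                  cnt i c′ + cnt i (flat X′) ≡ shiftBy (suc k) (cnt i items)
    digits {i} lt = digit-unique (≤-trans (leρ (ind i)) (cnt-rng≤1 i (2 + q))) (bit≤1 _) (begin
      cnt i ρ + 2 * (cnt i c′ + cnt i (flat X′))    ≡⟨ rearrange (cnt i ρ) (cnt i c′) (cnt i (flat X′)) ⟨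
      2 * cnt i c′ + cnt i ρ + 2 * cnt i (flat X′)  ≡⟨ cong (_+ 2 * cnt i (flat X′))
        (trans (sym (eu (ind i))) (wt-++ (ind i) c (flat r))) ⟩
      cnt i c + cnt i (flat r) + 2 * cnt i (flat X′) ≡⟨ rearrange′ (cnt i c) (cnt i (flat X′))
        (cnt i (flat r)) ⟨
      cnt i c + (2 * cnt i (flat X′) + cnt i (flat r))
        ≡⟨ cong (cnt i c +_) (trans (cong₂ (λ x y → 2 * x + y) (wt-flat (ind i) X′) (wt-flat (ind i) r))
          (sym (trans (wt-flat (ind i) X) (eX (colWt (ind i)))))) ⟩
      cnt i c + cnt i (flat X)                      ≡⟨ s lt ⟩
      shiftBy k (cnt i items)                       ≡⟨ shift-spec k (cnt i items) ⟩
      bit (odd (shiftBy k (cnt i items))) + 2 * shiftBy (suc k) (cnt i items) ∎)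
    match : Match (2 + q) c r (δ k) c′
    match {i} lt = begin
      cnt i c + cnt i (flat r)     ≡⟨ wt-++ (ind i) c (flat r) ⟨
      cnt i (c ++ flat r)          ≡⟨ eu (ind i) ⟩
      2 * cnt i c′ + cnt i ρ       ≡⟨ +-comm (2 * cnt i c′) _ ⟩
      cnt i ρ + 2 * cnt i c′       ≡⟨ cong (_+ 2 * cnt i c′)
        (trans (proj₁ (digits lt)) (sym (cnt-bits k (2 + q) items lt))) ⟩
      cnt i (δ k) + 2 * cnt i c′   ∎
    flat≤ : length (flat r) ≤ W
    flat≤ = subst₂ _≤_ (trans (sym (wt-flat (λ _ → 1) r)) (wt-1 (flat r)))
                       (trans (sym (wt-flat (λ _ → 1) C)) (wt-1 (flat C))) (ler (colWt (λ _ → 1)))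
    -- Why carries stay in the box: 2 |c′| + |ρ| = |c| + |r| ≤ W + W, where |r| counts tags and
    -- letters.
    len≤ : length c′ ≤ W
    len≤ = *-cancelˡ-≤ 2 (≤-trans (m≤m+n (2 * length c′) (length ρ)) (≤-trans (≤-reflexive (begin
        2 * length c′ + length ρ                     ≡⟨ cong₂ (λ x y → 2 * x + y) (wt-1 c′) (wt-1 ρ) ⟨
        2 * wt (λ _ → 1) c′ + wt (λ _ → 1) ρ         ≡⟨ eu (λ _ → 1) ⟨
        wt (λ _ → 1) (c ++ flat r)                   ≡⟨ wt-++ (λ _ → 1) c (flat r) ⟩
        wt (λ _ → 1) c + wt (λ _ → 1) (flat r)       ≡⟨ cong₂ _+_ (wt-1 c) (wt-1 (flat r)) ⟩
        length c + length (flat r)                   ∎))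
      (≤-trans (+-mono-≤ le flat≤) (≤-reflexive (cong (W +_) (sym (+-identityʳ W)))))))

  valid-step : ∀ {k es} → Valid (suc k) es → Valid k (next (δ k) es (2 + q) (box q L T₀) (moves q L T₀))
  valid-step {k} {es} v = record
    { sound    = λ m → up (All.lookup (step-sound (δ k) es (2 + q) (box q L T₀) (moves q L T₀)) m)
    ; complete = λ {c} {X} ps le X⊆ s → down ps le (solves-down {k} {c} {X} ps le X⊆ s)
    ; short    = m≤n⇒m≤1+n (step-length (δ k) es (2 + q) (box q L T₀) (moves q L T₀))
    }
    where
    up : ∀ {c X} → c ∈ box q L T₀ × Found (δ k) es (2 + q) (box q L T₀) (moves q L T₀) c X →
         c ∈ box q L T₀ × All (_∈ C) X × Solves k c X
    up {c} (c∈ , (c′ , X′) , r , e∈ , r∈ , mt , refl) = let _ , X′⊆ , s = v .sound e∈ in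
      c∈ , ++⁺ X′⊆ (++⁺ X′⊆ (moves-sound q L T₀ r∈)) , solves-up {k} {c} {c′} {X′} {r} mt s
    down : ∀ {c} → All (_< 2 + q) c → length c ≤ W →
      (Σ[ c′ ∈ List ℕ ] Σ[ X′ ∈ List Col ] Σ[ r ∈ List Col ]
        All (_< 2 + q) c′ × length c′ ≤ W × All (_∈ C) X′ × Solves (suc k) c′ X′ ×
        All (_∈ C) r × length r ≤ length C × Match (2 + q) c r (δ k) c′) →
      Σ[ X ∈ List Col ] (c , X) ∈ next (δ k) es (2 + q) (box q L T₀) (moves q L T₀)
    down ps le (c′ , X′ , r , ps′ , le′ , X′⊆ , s′ , r⊆ , ler , mt) =
      let X″ , e∈ = v .complete {c′} {X′} ps′ le′ X′⊆ s′ in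
      step-complete (δ k) es (2 + q) (box q L T₀) (moves q L T₀)
        (box-complete q L T₀ ps le) e∈ (moves-complete q L T₀ r⊆ ler) mt

  solutions : List Entry
  solutions = ⟦ dp ⟧ (2 + q , box q L T₀ , moves q L T₀ , items , tt)

  -- Every column carries exactly one of the two tags.
  columns≤tags : ∀ {X} → All (_∈ C) X → length X ≤ cnt 0 (flat X) + cnt (suc q) (flat X)
  columns≤tags [] = z≤n
  columns≤tags {(tag , w) ∷ X} (m ∷ ms) = ≤-trans (+-mono-≤ (one (Column.shape (columns-sound q L T₀ m)))
    (columns≤tags ms))
    (≤-trans (m≤m+n _ (cnt 0 w + cnt (suc q) w)) (≤-reflexive (trans
      (rearrange (ind 0 tag) (ind (suc q) tag) (cnt 0 w) (cnt (suc q) w) (cnt 0 (flat X))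
        (cnt (suc q) (flat X)))
      (cong₂ _+_ (cong (ind 0 tag +_) (sym (wt-++ (ind 0) w (flat X))))
                 (cong (ind (suc q) tag +_) (sym (wt-++ (ind (suc q)) w (flat X))))))))
    where
    rearrange : ∀ a b c d x y → a + b + (x + y) + (c + d) ≡ a + (c + x) + (b + (d + y))
    rearrange = solve-∀
    one : (tag ≡ 0 × sum w ≤ T₀) ⊎ (tag ≡ suc q × sum w ≤ L) → 1 ≤ ind 0 tag + ind (suc q) tag
    one (inj₁ (refl , _)) = s≤s z≤n
    one (inj₂ (refl , _)) rewrite ≡ᵇ-refl q = ≤-refl

  -- Each step doubles the lists of columns, yet they stay linear in the number of items: every
  -- column uses up an item in one of the two tag rows. The bound on the peak depends on this.
  valid-columns : ∀ {k es} → Valid k es → All (λ e → length (proj₂ e) ≤ length items + length items) es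
  valid-columns {k} v = All.tabulate λ {(c , X)} m → let _ , X⊆ , s = v .sound m in
    ≤-trans (columns≤tags X⊆) (+-mono-≤ (bound {c} {X} 0 z<s s) (bound {c} {X} (suc q) ≤-refl s))
    where
    bound : ∀ {c X} i → i < 2 + q → Solves k c X → cnt i (flat X) ≤ length items
    bound {c} {X} i lt s = ≤-trans (m≤n+m (cnt i (flat X)) (cnt i c))
      (≤-trans (≤-reflexive (s lt)) (≤-trans (shift-≤ k _) (cnt≤length i items)))

  opaque
    unfolding dp

    dp-valid : Valid 0 solutions
    dp-valid = countdown-inv Valid valid-step (⟦ len ⟧ (items , tt))
      (subst (λ k → Valid k _) (sym (len-sem {nat} items)) valid-start)

    dp-peak : ∀ {M} → 2 + q ≤ M → length items + length items ≤ M → All (_≤ M) items →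
      suc (length (box q L T₀)) ≤ M → length (moves q L T₀) ≤ M →
      (∀ {c r c′ k} → c ∈ box q L T₀ → r ∈ moves q L T₀ → c′ ∈ box q L T₀ →
        peak test (2 + q , c , r , δ k , c′ , tt) ≤ M) →
      peak dp (2 + q , box q L T₀ , moves q L T₀ , items , tt) ≤ M
    dp-peak {M} lQ li la lb lm lt rewrite len-sem {nat} items = ⊔-lub (len-peak {nat} li′)
      (⊔-lub li′ (loopPeak-inv (λ k es → k ≤ length items × Valid k es)
        (λ (le , v) → <⇒≤ le , valid-step v)
        (λ {k} {es} (le , v) → ⊔-lub (bits-peak (≤-trans (<⇒≤ le) li′) lQ li′ la)
          (step-peak _ es (2 + q) (box q L T₀) (moves q L T₀) (≤-trans (n≤1+n _) lb) lm (≤-trans (v .short) lb)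
            (All.map (λ p → ≤-trans p li) (valid-columns v))
            (λ {c} {r} {e} c∈ r∈ e∈ → lt c∈ r∈ (proj₁ (v .sound e∈)))))
        (length items) (≤-refl , valid-start)))
      where
      li′ : length items ≤ M
      li′ = ≤-trans (m≤m+n _ _) li

-- From columns to schedules

kv : Ty
kv = nat ⊗ nat

Table : Set
Table = List (ℕ × ℕ)

keyCnt : ℕ → Table → ℕ
keyCnt k = wt (ind k ∘ proj₁)

opaque

  -- The flag records whether the entry has been found further right, so at most one entry with the
  -- key is removed even if there are several.
  pop : Tm (nat ∷ list kv ∷ []) ((bool ⊗ nat) ⊗ list kv)
  pop = `foldr (`if (`fst (`fst v1))
                    (`fst v1 `, v0 `∷ `snd v1)
                    (`if (call eqN (`fst v0 ▸ v2 ▸ ∅))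
                         ((`t `, `snd v0) `, `snd v1)
                         (`fst v1 `, v0 `∷ `snd v1)))
               -- The value 0 is a default for an absent key, which the hypothesis of `pop-spec`
               -- excludes.
               ((`f `, `0) `, `[]) v1

popped : ℕ → Table → ℕ
popped k tbl = proj₂ (proj₁ (⟦ pop ⟧ (k , tbl , tt)))

rest : ℕ → Table → Table
rest k tbl = proj₂ (⟦ pop ⟧ (k , tbl , tt))

opaque
  unfolding pop

  private
    popStep : ℕ → ℕ × ℕ → (Bool × ℕ) × Table → (Bool × ℕ) × Table
    popStep k e a = if proj₁ (proj₁ a) then (proj₁ a , e ∷ proj₂ a)
      else (if ⟦ eqN ⟧ (proj₁ e , k , tt) then ((true , proj₂ e) , proj₂ a) else (proj₁ a , e ∷ proj₂ a))

    PopOutcome : ℕ → Table → (Bool × ℕ) × Table → Set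
    PopOutcome k tbl ((b , v) , r) = (b ≡ true × (∀ g → wt g tbl ≡ g (k , v) + wt g r)) ⊎
      (b ≡ false × keyCnt k tbl ≡ 0 × r ≡ tbl)

    pop-outcome : ∀ k tbl → PopOutcome k tbl (foldr (popStep k) ((false , 0) , []) tbl)
    pop-outcome k [] = inj₂ (refl , refl , refl)
    pop-outcome k (e ∷ tbl) with foldr (popStep k) ((false , 0) , []) tbl | pop-outcome k tbl
    ... | (true , v) , r | inj₁ (refl , eq) =
      inj₁ (refl , λ g → trans (cong (g e +_) (eq g)) (rearrange (g e) (g (k , v)) (wt g r)))
      where
      rearrange : ∀ x y z → x + (y + z) ≡ y + (x + z)
      rearrange = solve-∀
    ... | (false , v) , r | inj₂ (refl , eq , refl) rewrite eqN-sem (proj₁ e) k with proj₁ e ≡ᵇ k in e′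
    ...   | true rewrite sym (≡ᵇ-true {proj₁ e} {k} e′) = inj₁ (refl , λ g → refl)
    ...   | false = inj₂ (refl , eq , refl)

  pop-spec : ∀ k tbl → 0 < keyCnt k tbl → ∀ g → wt g tbl ≡ g (k , popped k tbl) + wt g (rest k tbl)
  pop-spec k tbl pos with foldr (popStep k) ((false , 0) , []) tbl | pop-outcome k tbl
  ... | _ | inj₁ (_ , eq)     = eq
  ... | _ | inj₂ (_ , eq , _) rewrite eq = ⊥-elim (n≮0 pos)

  rest-All : ∀ k {P : ℕ × ℕ → Set} tbl → All P tbl → All P (rest k tbl)
  rest-All k [] [] = []
  rest-All k (e ∷ tbl) (p ∷ ps) with foldr (popStep k) ((false , 0) , []) tbl | rest-All k tbl ps
  ... | (true  , v) , r | qs = p ∷ qs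
  ... | (false , v) , r | qs with ⟦ eqN ⟧ (proj₁ e , k , tt)
  ...   | true  = qs
  ...   | false = p ∷ qs

  rest-length : ∀ k tbl → length (rest k tbl) ≤ length tbl
  rest-length k [] = z≤n
  rest-length k (e ∷ tbl) with foldr (popStep k) ((false , 0) , []) tbl | rest-length k tbl
  ... | (true  , v) , r | le = s≤s le
  ... | (false , v) , r | le with ⟦ eqN ⟧ (proj₁ e , k , tt)
  ...   | true  = m≤n⇒m≤1+n le
  ...   | false = s≤s le

  pop-peak : ∀ {M k tbl} → k ≤ M → length tbl ≤ M → All (λ e → proj₁ e ≤ M) tbl → peak pop (k , tbl , tt) ≤ M
  pop-peak lk ll la = ⊔-lub ll (foldPeak-All (λ e → proj₁ e ≤ _) (λ a le → ⊔-lub (eqN-peak le lk) z≤n) la)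

Small-Table : ℕ → Table → Set
Small-Table M tbl = length tbl ≤ M × All (λ e → proj₁ e ≤ M) tbl

rest-small : ∀ {M} k {tbl} → Small-Table M tbl → Small-Table M (rest k tbl)
rest-small k {tbl} (ll , la) = ≤-trans (rest-length k tbl) ll , rest-All k tbl la

opaque

  assign : Tm (list nat ∷ list kv ∷ []) (list nat ⊗ list kv)
  assign = `foldr (`let (call pop (v0 ▸ `snd v1 ▸ ∅)) ((`snd (`fst v0) `∷ `fst v2) `, `snd v0)) (`[] `, v1) v0

  assign-∷ : ∀ k ks tbl → let (vs , r) = ⟦ assign ⟧ (ks , tbl , tt) in
             ⟦ assign ⟧ (k ∷ ks , tbl , tt) ≡ (popped k r ∷ vs , rest k r)
  assign-∷ k ks tbl = refl

  assign-[] : ∀ tbl → ⟦ assign ⟧ ([] , tbl , tt) ≡ ([] , tbl)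
  assign-[] tbl = refl

  assign-peak : ∀ {M ks tbl} → length ks ≤ M → All (_≤ M) ks → Small-Table M tbl →
    peak assign (ks , tbl , tt) ≤ M
  assign-peak {M} ll la st = ⊔-lub ll (proj₁ (foldPeak-inv (_≤ M) (λ a → Small-Table M (proj₂ a)) st
    (λ {k} _ → rest-small k) (λ lk st → ⊔-lub (pop-peak lk (proj₁ st) (proj₂ st)) z≤n) la))

-- The table always equals what has been handed out plus what is left. As k occurs once more in k ∷
-- ks than in ks, comparing multiplicities shows that an entry with key k is still there when it is
-- asked for.
assign-spec : ∀ ks tbl → (∀ k → cnt k ks ≤ keyCnt k tbl) →
  let (vs , r) = ⟦ assign ⟧ (ks , tbl , tt) in
  length vs ≡ length ks × (∀ g → wt g tbl ≡ wt g (zip ks vs) + wt g r)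
assign-spec [] tbl le rewrite assign-[] tbl = refl , λ g → refl
assign-spec (k ∷ ks) tbl le rewrite assign-∷ k ks tbl
  with ⟦ assign ⟧ (ks , tbl , tt) | assign-spec ks tbl (λ i → ≤-trans (m≤n+m (cnt i ks) (ind i k)) (le i))
... | vs , r | el , eg = cong suc el , λ g → trans (eg g)
      (trans (cong (wt g (zip ks vs) +_) (pop-spec k r pos g))
        (rearrange (wt g (zip ks vs)) (g (k , popped k r)) (wt g (rest k r))))
  where
  rearrange : ∀ x y z → x + (y + z) ≡ y + x + z
  rearrange = solve-∀
  zip-key : ∀ ks (vs : List ℕ) → length vs ≡ length ks → keyCnt k (zip ks vs) ≡ cnt k ks
  zip-key []       []       e = refl
  zip-key (x ∷ ks) (v ∷ vs) e = cong (ind k x +_) (zip-key ks vs (suc-injective e))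
  pos : 0 < keyCnt k r
  pos = +-cancelˡ-≤ (cnt k ks) 1 (keyCnt k r)
    (≤-trans (≤-reflexive (trans (+-comm (cnt k ks) 1) (cong (_+ cnt k ks) (sym (ind-refl k)))))
    (≤-trans (le k) (≤-reflexive (trans (eg (ind k ∘ proj₁)) (cong (_+ keyCnt k r) (zip-key ks vs el))))))

opaque

  -- A column takes a token (tag, μ) and thereby moves to machine μ; each of its letters s then
  -- becomes a slot (s, μ), open to any job of size s.
  slots : Tm (list col ∷ list kv ∷ []) (list kv ⊗ list kv)
  slots = `foldr (`let (call pop (`fst v0 ▸ `snd v1 ▸ ∅))
                       (`foldr ((v0 `, `snd (`fst v2)) `∷ v1) (`fst v2) (`snd v1) `, `snd v0))
                 (`[] `, v1) v0

label : ℕ → List ℕ → Table → Table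
label μ w sl = foldr (λ s o → (s , μ) ∷ o) sl w

wt-label : ∀ g μ w sl → wt g (label μ w sl) ≡ wt (λ s → g (s , μ)) w + wt g sl
wt-label g μ []      sl = refl
wt-label g μ (s ∷ w) sl = trans (cong (g (s , μ) +_) (wt-label g μ w sl)) (sym (+-assoc (g (s , μ)) _ _))

opaque
  unfolding slots

  slots-∷ : ∀ c X toks → let (sl , r) = ⟦ slots ⟧ (X , toks , tt) in
    ⟦ slots ⟧ (c ∷ X , toks , tt) ≡ (label (popped (proj₁ c) r) (proj₂ c) sl , rest (proj₁ c) r)
  slots-∷ c X toks = refl

  slots-[] : ∀ toks → ⟦ slots ⟧ ([] , toks , tt) ≡ ([] , toks)
  slots-[] toks = refl

  slots-peak : ∀ {M X toks} → length X ≤ M → All (λ c → proj₁ c ≤ M × length (proj₂ c) ≤ M) X →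
    Small-Table M toks →
               peak slots (X , toks , tt) ≤ M
  slots-peak {M} ll la st = ⊔-lub ll (proj₁ (foldPeak-inv (λ c → proj₁ c ≤ M × length (proj₂ c) ≤ M) (λ a →
    Small-Table M (proj₂ a)) st
    (λ {c} _ → rest-small (proj₁ c))
    (λ {c} (lk , lw) st → ⊔-lub (pop-peak lk (proj₁ st) (proj₂ st))
      (⊔-lub (⊔-lub lw (foldPeak≤ (λ _ _ → z≤n) (proj₂ c))) z≤n)) la))

-- The second claim feeds the induction, as in `assign-spec`. The third charges the load to tokens:
-- if each word fits into the capacity h of its token, the total over the slots fits into the total
-- over the tokens.
slots-spec : ∀ X toks → (∀ k → wt (ind k ∘ proj₁) X ≤ keyCnt k toks) →
  let (sl , r) = ⟦ slots ⟧ (X , toks , tt) in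
  (∀ g → wt (g ∘ proj₁) sl ≡ wt (wt g ∘ proj₂) X) ×
  (∀ f → wt (f ∘ proj₁) toks ≡ wt (f ∘ proj₁) X + wt (f ∘ proj₁) r) ×
  (∀ g h → All (λ (tag , w) → ∀ μ → wt (λ s → g (s , μ)) w ≤ h (tag , μ)) X → wt g sl + wt h r ≤ wt h toks)
slots-spec [] toks le rewrite slots-[] toks = (λ g → refl) , (λ f → refl) , λ g h _ → ≤-refl
slots-spec ((tag , w) ∷ X) toks le rewrite slots-∷ (tag , w) X toks
  with ⟦ slots ⟧ (X , toks , tt) | slots-spec X toks (λ i →
    ≤-trans (m≤n+m (wt (ind i ∘ proj₁) X) (ind i tag)) (le i))
... | sl , r | eg , ef , leh =
  (λ g → trans (wt-label (g ∘ proj₁) μ w sl) (cong (wt g w +_) (eg g))) ,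
  (λ f → trans (ef f) (trans (cong (wt (f ∘ proj₁) X +_) (pop-spec tag r pos (f ∘ proj₁)))
                             (rearrange (wt (f ∘ proj₁) X) (f tag) (wt (f ∘ proj₁) (rest tag r))))) ,
  λ { g h (p ∷ ps) → ≤-trans (≤-reflexive (trans (cong (_+ wt h (rest tag r)) (wt-label g μ w sl))
                                                 (+-assoc (wt (λ s → g (s , μ)) w) (wt g sl) _)))
      (≤-trans (+-monoˡ-≤ _ (p μ)) (≤-trans (≤-reflexive
        (rearrange′ (h (tag , μ)) (wt g sl) (wt h (rest tag r))))
      (≤-trans (+-monoʳ-≤ (wt g sl) (≤-reflexive (sym (pop-spec tag r pos h)))) (leh g h ps)))) }
  where
  μ : ℕ
  μ = popped tag r
  rearrange : ∀ x y z → x + (y + z) ≡ y + x + z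
  rearrange = solve-∀
  rearrange′ : ∀ x y z → x + (y + z) ≡ y + (x + z)
  rearrange′ = solve-∀
  pos : 0 < keyCnt tag r
  pos = +-cancelˡ-≤ (wt (ind tag ∘ proj₁) X) 1 (keyCnt tag r)
    (≤-trans (≤-reflexive (trans (+-comm (wt (ind tag ∘ proj₁) X) 1)
      (cong (_+ wt (ind tag ∘ proj₁) X) (sym (ind-refl tag)))))
    (≤-trans (le tag) (≤-reflexive (ef (ind tag)))))

opaque

  -- Machine μ owns one token (0, μ) for its configuration and t tokens (Q, μ) for blocks. Which
  -- block goes to which machine is settled only when tokens are handed out, since blocks are
  -- interchangeable.
  tokens : Tm (nat ∷ nat ∷ nat ∷ []) (list kv)
  tokens = `loop (`foldr ((v6 `, v0) `∷ v1) v1 (call range (v2 ▸ ∅)))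
                 (`foldr ((`0 `, v0) `∷ v1) `[] (call range (v0 ▸ ∅))) v1

toks : ℕ → ℕ → ℕ → Table
toks M t Q = ⟦ tokens ⟧ (M , t , Q , tt)

opaque
  unfolding tokens

  tokens-spec : ∀ M t Q g → wt g (toks M t Q) ≡ wt (λ μ → g (0 , μ)) (rng M) + t * wt (λ μ → g (Q , μ)) (rng M)
  tokens-spec M t Q g rewrite range-sem M = trans (sym (+-identityʳ _))
    (countdown-inv (λ k o → wt g o + k * wB ≡ w₀ + t * wB) (λ {k} {o} e →
      trans (cong (_+ k * wB) (tag-wt Q o (rng M))) (trans (rearrange wB (wt g o) (k * wB)) e)) t
      (cong (_+ t * wB) (trans (tag-wt 0 [] (rng M)) (+-identityʳ _))))
    where
    w₀ wB : ℕ
    w₀ = wt (λ μ → g (0 , μ)) (rng M)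
    wB = wt (λ μ → g (Q , μ)) (rng M)
    rearrange : ∀ b o k → b + o + k ≡ o + (b + k)
    rearrange = solve-∀
    tag-wt : ∀ tag o xs → wt g (foldr (λ μ o → (tag , μ) ∷ o) o xs) ≡ wt (λ μ → g (tag , μ)) xs + wt g o
    tag-wt tag o []       = refl
    tag-wt tag o (x ∷ xs) = trans (cong (g (tag , x) +_) (tag-wt tag o xs)) (sym (+-assoc (g (tag , x)) _ _))

  tokens-peak : ∀ {B M t Q} → M ≤ B → t ≤ B → peak tokens (M , t , Q , tt) ≤ B
  tokens-peak {B} {M} {t} lM lt rewrite range-sem M =
    ⊔-lub (⊔-lub (range-peak lM) inner) (⊔-lub lt (loopPeak≤ (λ _ _ → ⊔-lub (range-peak lM) inner) t))
    where
    inner : ∀ {f : ℕ → Table → Table} {z} → length (rng M) ⊔ foldPeak f (λ _ _ → 0) z (rng M) ≤ B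
    inner = ⊔-lub (≤-trans (≤-reflexive (length-rng M)) lM) (foldPeak≤ (λ _ _ → z≤n) (rng M))

opaque

  -- T is counted out in steps of one. When the residue reaches hi = lo + L it falls back to lo and
  -- t grows, so the residue is at least lo as soon as t is positive.
  splitT : Tm (nat ∷ nat ∷ nat ∷ []) (nat ⊗ nat)
  splitT = `loop (`if (call eqN (`suc (`fst v1) ▸ v4 ▸ ∅)) (v3 `, `suc (`snd v1))
    (`suc (`fst v1) `, `snd v1)) (`0 `, `0) v0

record Split (T lo L T₀ t : ℕ) : Set where
  constructor mkSplit
  field
    value : T ≡ T₀ + t * L
    below : T₀ < lo + L
    above : t ≡ 0 ⊎ lo ≤ T₀

opaque
  unfolding splitT

  splitT-spec : ∀ T lo L hi → hi ≡ lo + L → 0 < L → let (T₀ , t) = ⟦ splitT ⟧ (T , lo , hi , tt) in Split T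
    lo L T₀ t
  splitT-spec T lo L hi refl pos = mkSplit′ (countdown-inv P (λ {k} {a} → stepP k (proj₁ a) (proj₂ a)) T
    {0 , 0} start)
    where
    P : ℕ → ℕ × ℕ → Set
    P k (T₀ , t) = (T₀ + t * L + k ≡ T) × (T₀ < lo + L) × (t ≡ 0 ⊎ lo ≤ T₀)
    start : P T (0 , 0)
    start = refl , ≤-trans pos (m≤n+m L lo) , inj₁ refl
    stepP : ∀ k T₀ t → P (suc k) (T₀ , t) →
      P k (if ⟦ eqN ⟧ (suc T₀ , lo + L , tt) then (lo , suc t) else (suc T₀ , t))
    stepP k T₀ t (e , lt , or) rewrite eqN-sem (suc T₀) (lo + L) with suc T₀ ≡ᵇ lo + L in eq
    ... | true  = trans (cong (_+ k) (trans (sym (+-assoc lo L (t * L)))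
      (cong (_+ t * L) (sym (≡ᵇ-true {suc T₀} {lo + L} eq))))) (trans (sym (+-suc _ k)) e)
                , m<m+n lo pos , inj₂ ≤-refl
    ... | false = trans (sym (+-suc _ k)) e
                , ≤∧≢⇒< lt (λ e′ → false≢true
                  (trans (sym eq) (trans (cong (_≡ᵇ lo + L) e′) (≡ᵇ-refl (lo + L)))))
                , orr or
      where
      orr : t ≡ 0 ⊎ lo ≤ T₀ → t ≡ 0 ⊎ lo ≤ suc T₀
      orr (inj₁ z) = inj₁ z
      orr (inj₂ l) = inj₂ (m≤n⇒m≤1+n l)
    mkSplit′ : ∀ {a} → P 0 a → Split T lo L (proj₁ a) (proj₂ a)
    mkSplit′ (e , lt , or) = mkSplit (sym (trans (sym (+-identityʳ _)) e)) lt or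

  splitT-peak : ∀ {M T lo hi} → T ≤ M → hi ≤ M → lo < hi → peak splitT (T , lo , hi , tt) ≤ M
  splitT-peak {M} {T} {lo} {hi} lT lh ll = ⊔-lub lT (loopPeak-inv (λ _ a → proj₁ a < hi)
    (λ {k} {a} → stepP (proj₁ a) (proj₂ a)) (λ p → ⊔-lub (eqN-peak (≤-trans p lh) lh) z≤n) T
      (≤-trans (s≤s z≤n) ll))
    where
    stepP : ∀ T₀ (t : ℕ) → T₀ < hi → proj₁ (if ⟦ eqN ⟧ (suc T₀ , hi , tt) then (lo , suc t) else (suc T₀ ,
      t)) < hi
    stepP T₀ t lt rewrite eqN-sem (suc T₀) hi with suc T₀ ≡ᵇ hi in eq
    ... | true  = ll
    ... | false = ≤∧≢⇒< lt (λ e′ → false≢true (trans (sym eq) (trans (cong (_≡ᵇ hi) e′) (≡ᵇ-refl hi))))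

opaque

  fact : Tm (nat ∷ []) nat
  fact = `loop (call mul (v1 ▸ `suc v0 ▸ ∅)) (`suc `0) v0

factorial : ℕ → ℕ
factorial q = ⟦ fact ⟧ (q , tt)

opaque
  unfolding fact

  private
    factFrom : ℕ → ℕ → ℕ
    factFrom q a = countdown (λ k a → ⟦ mul ⟧ (a , suc k , tt)) q a

    factFrom-pos : ∀ q a → 0 < a → 0 < factFrom q a
    factFrom-pos zero    a p = p
    factFrom-pos (suc q) a p = factFrom-pos q _
      (≤-trans (*-mono-≤ p (s≤s (z≤n {q}))) (≤-reflexive (sym (mul-sem a (suc q)))))

    factFrom-keep : ∀ {d} q a → d ∣ a → d ∣ factFrom q a
    factFrom-keep zero    a p = p
    factFrom-keep {d} (suc q) a p = factFrom-keep q _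
      (subst (d ∣_) (sym (mul-sem a (suc q))) (∣m⇒∣m*n (suc q) p))

    factFrom-divides : ∀ {i} q a → 0 < i → i ≤ q → i ∣ factFrom q a
    factFrom-divides zero a p le = ⊥-elim (n≮0 (≤-trans p le))
    factFrom-divides {i} (suc q) a p le with m≤n⇒m<n∨m≡n le
    ... | inj₁ lt   = factFrom-divides q _ p (s≤s⁻¹ lt)
    ... | inj₂ refl = factFrom-keep q _ (subst (suc q ∣_) (sym (mul-sem a (suc q))) (∣n⇒∣m*n a ∣-refl))

  factorial-pos : ∀ q → 0 < factorial q
  factorial-pos q = factFrom-pos q 1 z<s

  factorial-divides : ∀ {i q} → 0 < i → i ≤ q → i ∣ factorial q
  factorial-divides {q = q} = factFrom-divides q 1

-- Feasible makespans

InRange : ℕ → ℕ → Set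
InRange q i = 0 < i × i ≤ q

separate : ∀ q w → All (InRange (suc q)) w →
  Σ[ k ∈ ℕ ] Σ[ v ∈ List ℕ ] (∀ g → wt g w ≡ k * g (suc q) + wt g v) × All (InRange q) v
separate q [] [] = 0 , [] , (λ _ → refl) , []
separate q (x ∷ w) ((pos , le) ∷ ps) with separate q w ps | m≤n⇒m<n∨m≡n le
... | k , v , e , ps′ | inj₂ refl = suc k , v ,
  (λ g → trans (cong (g x +_) (e g)) (sym (+-assoc (g x) _ _))) , ps′
... | k , v , e , ps′ | inj₁ lt   = k , x ∷ v ,
  (λ g → trans (cong (g x +_) (e g)) (rearrange (g x) (k * g (suc q)) (wt g v))) , (pos , s≤s⁻¹ lt) ∷ ps′
  where
  rearrange : ∀ x y z → x + (y + z) ≡ y + (x + z)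
  rearrange = solve-∀

-- By pigeonhole some size i has total volume at least L, and i divides L.
find-block : ∀ q L w → (∀ {i} → InRange q i → i ∣ L) → All (InRange q) w → q * L < sum w →
  Σ[ v ∈ List ℕ ] Σ[ r ∈ List ℕ ] (∀ g → wt g w ≡ wt g v + wt g r) × sum v ≡ L × All (InRange q) v ×
    All (InRange q) r
find-block zero L [] dv [] ()
find-block zero L (x ∷ w) dv ((pos , le) ∷ _) lt = ⊥-elim (n≮0 (≤-trans pos le))
find-block (suc q) L w dv ps lt with separate q w ps
... | k , w′ , e , ps′ with L ≤? k * suc q
... | yes le with dv {suc q} (z<s , ≤-refl)
-- L = d (q + 1), so d copies of the size q + 1 make up a block of volume exactly L.
...   | divides d refl = replicate d (suc q) , replicate (k ∸ d) (suc q) ++ w′ , eq ,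
        trans (wt-replicate id d (suc q)) refl , replicate⁺ d (z<s , ≤-refl) ,
        ++⁺ (replicate⁺ (k ∸ d) (z<s , ≤-refl)) (All.map (λ (p , l) → p , m≤n⇒m≤1+n l) ps′)
  where
  d≤k : d ≤ k
  d≤k = *-cancelʳ-≤ d k (suc q) le
  eq : ∀ g → wt g w ≡ wt g (replicate d (suc q)) + wt g (replicate (k ∸ d) (suc q) ++ w′)
  eq g rewrite wt-++ g (replicate (k ∸ d) (suc q)) w′ | wt-replicate g d (suc q) | wt-replicate g (k ∸ d)
    (suc q) =
    trans (e g) (trans (cong (λ z → z * g (suc q) + wt g w′) (sym (m+[n∸m]≡n d≤k)))
      (rearrange d (k ∸ d) (g (suc q)) (wt g w′)))
    where
    rearrange : ∀ d e x y → (d + e) * x + y ≡ d * x + (e * x + y)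
    rearrange = solve-∀
-- The copies of q + 1 have volume below L, so the smaller sizes keep more than q L and the
-- induction applies to them.
find-block (suc q) L w dv ps lt | k , w′ , e , ps′ | no nle
  with find-block q L w′ (λ (p , l) → dv (p , m≤n⇒m≤1+n l)) ps′ small
  where
  small : q * L < sum w′
  small = +-cancelˡ-< L (q * L) (sum w′) (≤-trans lt
    (≤-trans (≤-reflexive (e id)) (+-monoˡ-≤ (sum w′) (<⇒≤ (≰⇒> nle)))))
... | v , r , e′ , sv , pv , pr = v , replicate k (suc q) ++ r , eq , sv ,
      All.map (λ (p , l) → p , m≤n⇒m≤1+n l) pv ,
      ++⁺ (replicate⁺ k (z<s , ≤-refl)) (All.map (λ (p , l) → p , m≤n⇒m≤1+n l) pr)
  where
  eq : ∀ g → wt g w ≡ wt g v + wt g (replicate k (suc q) ++ r)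
  eq g rewrite wt-++ g (replicate k (suc q)) r | wt-replicate g k (suc q) =
    trans (e g) (trans (cong (k * g (suc q) +_) (e′ g)) (rearrange (k * g (suc q)) (wt g v) (wt g r)))
    where
    rearrange : ∀ x y z → x + (y + z) ≡ y + (x + z)
    rearrange = solve-∀

module _ (q L T₀ : ℕ) (dv : ∀ {i} → InRange q i → i ∣ L) where

  -- If w fits even without the last block, that block stays empty. Otherwise its volume exceeds T₀
  -- ≥ q L, and `find-block` splits off a block of volume L. Empty blocks make the number of blocks
  -- exactly t, as the system consists of equations.
  decompose : ∀ t w → All (InRange q) w → sum w ≤ T₀ + t * L → (t ≡ 0 ⊎ q * L ≤ T₀) →
    Σ[ X ∈ List Col ] All (Column q L T₀) X × (∀ g → wt (colWt g) X ≡ g 0 + t * g (suc q) + wt g w)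
  decompose zero w ps le _ = (0 , w) ∷ [] , column (inj₁ (refl , ≤-trans le (≤-reflexive (+-identityʳ T₀))))
    ps ∷ [] , λ g →
    trans (+-identityʳ _) (cong (_+ wt g w) (sym (+-identityʳ (g 0))))
  decompose (suc t) w ps le (inj₂ big) with sum w ≤? T₀ + t * L
  ... | yes le′ with decompose t w ps le′ (inj₂ big)
  ...   | X , cX , e = (suc q , []) ∷ X , column (inj₂ (refl , z≤n)) [] ∷ cX , λ g →
          trans (cong (g (suc q) + 0 +_) (e g)) (rearrange (g (suc q)) (g 0) (t * g (suc q)) (wt g w))
    where
    rearrange : ∀ b z y w → b + 0 + (z + y + w) ≡ z + (b + y) + w
    rearrange = solve-∀
  decompose (suc t) w ps le (inj₂ big) | no nle with find-block q L w dv ps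
    (≤-<-trans (≤-trans big (m≤m+n T₀ (t * L))) (≰⇒> nle))
  ... | v , r , e , sv , pv , pr with decompose t r pr sr (inj₂ big)
    where
    rearrange : ∀ x l y → x + (l + y) ≡ l + (x + y)
    rearrange = solve-∀
    sr : sum r ≤ T₀ + t * L
    sr = +-cancelˡ-≤ L (sum r) (T₀ + t * L) (≤-trans
      (≤-reflexive (trans (cong (_+ sum r) (sym sv)) (sym (e id))))
           (≤-trans le (≤-reflexive (rearrange T₀ L (t * L)))))
  ...   | X , cX , e′ = (suc q , v) ∷ X , column (inj₂ (refl , ≤-reflexive sv)) pv ∷ cX , λ g →
          trans (cong (g (suc q) + wt g v +_) (e′ g))
            (trans (rearrange (g (suc q)) (wt g v) (g 0) (t * g (suc q)) (wt g r))
              (cong (g 0 + (g (suc q) + t * g (suc q)) +_) (sym (e g))))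
    where
    rearrange : ∀ b v z y r → b + v + (z + y + r) ≡ z + (b + y) + (v + r)
    rearrange = solve-∀

  decomposeAll : ∀ t ws → (t ≡ 0 ⊎ q * L ≤ T₀) → All (λ w → All (InRange q) w × sum w ≤ T₀ + t * L) ws →
    Σ[ X ∈ List Col ] All (Column q L T₀) X ×
      (∀ g → wt (colWt g) X ≡ length ws * g 0 + t * (length ws * g (suc q)) + wt (wt g) ws)
  decomposeAll t [] or [] = [] , [] , λ g → sym (trans (+-identityʳ _) (*-zeroʳ t))
  decomposeAll t (w ∷ ws) or ((ps , le) ∷ qs) with decompose t w ps le or | decomposeAll t ws or qs
  ... | X , cX , e | Y , cY , e′ = X ++ Y , ++⁺ cX cY , λ g →
    trans (wt-++ (colWt g) X Y) (trans (cong₂ _+_ (e g) (e′ g))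
      (rearrange (g 0) t (g (suc q)) (wt g w) (length ws * g 0) (length ws * g (suc q)) (wt (wt g) ws)))
    where
    rearrange : ∀ z t b w n m ws → z + t * b + w + (n + t * m + ws) ≡ z + n + t * (b + m) + (w + ws)
    rearrange = solve-∀

-- Equality of all weighted sums says that the contents ws form the multiset ps.
Feasible : ℕ → List ℕ → ℕ → Set
Feasible M ps T = Σ[ ws ∈ List (List ℕ) ] length ws ≡ M × All (λ w → sum w ≤ T) ws ×
  (∀ g → wt (wt g) ws ≡ wt g ps)

-- vs lists the machines of the jobs ps; taking for φ the indicator of a
-- machine bounds its load, the indicator of ≥ M shows that all entries are < M.
Good : ℕ → List ℕ → ℕ → List ℕ → Set
Good M ps T vs = length vs ≡ length ps ×
  (∀ φ → wt (λ (s , μ) → φ μ * s) (zip ps vs) ≤ T * wt φ (rng M))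

Good-mono : ∀ {M ps T T′ vs} → T ≤ T′ → Good M ps T vs → Good M ps T′ vs
Good-mono {M} le (e , b) = e , λ φ → ≤-trans (b φ) (*-monoˡ-≤ (wt φ (rng M)) le)

wt-scale : {X : Set} (c : ℕ) (g : X → ℕ) (xs : List X) → wt (λ x → c * g x) xs ≡ c * wt g xs
wt-scale c g []       = sym (*-zeroʳ c)
wt-scale c g (x ∷ xs) = trans (cong (c * g x +_) (wt-scale c g xs)) (sym (*-distribˡ-+ c (g x) _))

wt-const : {X : Set} (c : ℕ) (xs : List X) → wt (λ _ → c) xs ≡ length xs * c
wt-const c []       = refl
wt-const c (x ∷ xs) = cong (c +_) (wt-const c xs)

wt-map : {X Y : Set} (g : Y → ℕ) (f : X → Y) (xs : List X) → wt g (map f xs) ≡ wt (g ∘ f) xs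
wt-map g f []       = refl
wt-map g f (x ∷ xs) = cong (g (f x) +_) (wt-map g f xs)

wt-zero : {X : Set} {g : X → ℕ} {xs : List X} → All (λ x → g x ≡ 0) xs → wt g xs ≡ 0
wt-zero []       = refl
wt-zero (e ∷ es) = cong₂ _+_ e (wt-zero es)

-- Multisets are compared by weighted sums only, so a property passes from `ps` to `ws` through a
-- weight that vanishes only where the property holds: a sum of naturals that is 0 has all its terms
-- 0.
All-contents : ∀ {P : ℕ → Set} (χ : ℕ → ℕ) → (∀ i → χ i ≡ 0 → P i) → ∀ ws → wt (wt χ) ws ≡ 0 → All (All P) ws
All-contents χ dec [] e = []
All-contents χ dec (w ∷ ws) e = inner w (m+n≡0⇒m≡0 _ e) ∷ All-contents χ dec ws (m+n≡0⇒n≡0 (wt χ w) e)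
  where
  inner : ∀ w → wt χ w ≡ 0 → All _ w
  inner []      e = []
  inner (x ∷ w) e = dec x (m+n≡0⇒m≡0 _ e) ∷ inner w (m+n≡0⇒n≡0 (χ x) e)

outOfRange : ℕ → ℕ → ℕ
outOfRange q zero    = 1
outOfRange q (suc i) = if suc i ≤ᵇ q then 0 else 1

outOfRange-zero : ∀ q i → outOfRange q i ≡ 0 → InRange q i
outOfRange-zero q (suc i) e with suc i ≤ᵇ q in eq
... | true = z<s , ≤ᵇ-true {suc i} eq

inRange-zero : ∀ {q i} → InRange q i → outOfRange q i ≡ 0
inRange-zero {q} {suc i} (_ , le) rewrite ≤⇒≤ᵇ-true le = refl

-- The right-hand side of the system as a multiset of rows: 0 for every machine, q + 1 for every
-- block, and each job under its size.
items : ℕ → ℕ → ℕ → List ℕ → List ℕ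
items M q t ps = map proj₁ (toks M t (suc q)) ++ ps

module _ (M q L T₀ t : ℕ) (ps : List ℕ) (psOK : All (InRange q) ps) where

  private
    its : List ℕ
    its = items M q t ps

  keyCnt-toks : ∀ i → keyCnt i (toks M t (suc q)) ≡ M * ind i 0 + t * (M * ind i (suc q))
  keyCnt-toks i = trans (tokens-spec M t (suc q) (ind i ∘ proj₁))
    (cong₂ (λ x y → x + t * y) (rep (ind i 0)) (rep (ind i (suc q))))
    where
    rep : ∀ c → wt (λ _ → c) (rng M) ≡ M * c
    rep c = trans (wt-const c (rng M)) (cong (_* c) (length-rng M))

  cnt-items : ∀ i → cnt i its ≡ keyCnt i (toks M t (suc q)) + cnt i ps
  cnt-items i = trans (wt-++ (ind i) (map proj₁ (toks M t (suc q))) ps)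
    (cong (_+ cnt i ps) (wt-map (ind i) proj₁ (toks M t (suc q))))

  -- `above` is what the peeling of blocks requires, `below` guarantees that all resulting columns
  -- are among the listed ones. The rest is completeness at position 0 with empty carry, where the
  -- quotient is the multiplicity itself.
  feasible⇒solvable : (∀ {i} → InRange q i → i ∣ L) → T₀ < q * L + L → (t ≡ 0 ⊎ q * L ≤ T₀) →
    Feasible M ps (T₀ + t * L) → Σ[ X ∈ List Col ] ([] , X) ∈ solutions q L T₀ its
  feasible⇒solvable dv below above (ws , refl , sums , e)
    with decomposeAll q L T₀ dv t ws above (All.zip (All-contents (outOfRange q) (outOfRange-zero q) ws
           (trans (e (outOfRange q)) (wt-zero (All.map inRange-zero psOK))) , sums))
  ... | X , cX , eX = Valid.complete (dp-valid q L T₀ its) {[]} {X} [] z≤n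
    (All.map (columns-complete q L T₀ (≤-trans (<⇒≤ below) (≤-reflexive (+-comm (q * L) L)))) cX)
    (λ {i} _ → trans (wt-flat (ind i) X) (trans (eX (ind i))
      (trans (cong₂ _+_ (sym (keyCnt-toks i)) (e (ind i))) (sym (cnt-items i)))))

  cap : ℕ → ℕ
  cap zero    = T₀
  cap (suc _) = L

  module _ {c : List ℕ} {X : List Col} (X⊆ : All (_∈ cols q L T₀) X) (s : Solves q L T₀ its 0 c X) where

    private
      tk : Table
      tk = toks M t (suc q)

    cnt-flat : ∀ k → cnt k (flat X) ≡ wt (ind k ∘ proj₁) X + wt (cnt k ∘ proj₂) X
    cnt-flat k = trans (wt-flat (ind k) X) (go X)
      where
      rearrange : ∀ a b c d → a + b + (c + d) ≡ a + c + (b + d)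
      rearrange = solve-∀
      go : ∀ X → wt (colWt (ind k)) X ≡ wt (ind k ∘ proj₁) X + wt (cnt k ∘ proj₂) X
      go []            = refl
      go ((g , w) ∷ X) = trans (cong (ind k g + cnt k w +_) (go X)) (rearrange (ind k g) (cnt k w) _ _)

    cnt-ps-outside : ∀ {k} → ¬ InRange q k → cnt k ps ≡ 0
    cnt-ps-outside {k} out = wt-zero (All.map (λ {i} r → ind-≢ {k} {i} λ { refl → out r }) psOK)

    tag-≤ : ∀ {k} → k < 2 + q → cnt k ps ≡ 0 → wt (ind k ∘ proj₁) X ≤ keyCnt k tk
    tag-≤ {k} lt z = ≤-trans (m≤m+n _ (wt (cnt k ∘ proj₂) X)) (≤-trans (≤-reflexive (sym (cnt-flat k)))
      (≤-trans (m≤n+m (cnt k (flat X)) (cnt k c)) (≤-reflexive (trans (s lt) (trans (cnt-items k)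
        (trans (cong (keyCnt k tk +_) z) (+-identityʳ _)))))))

    tag-zero : ∀ {k} → k ≢ 0 → k ≢ suc q → wt (ind k ∘ proj₁) X ≡ 0
    tag-zero {k} n₀ n₁ = wt-zero (All.map (λ {c} m → go {c} (Column.shape (columns-sound q L T₀ m))) X⊆)
      where
      go : ∀ {c : Col} → (proj₁ c ≡ 0 × sum (proj₂ c) ≤ T₀) ⊎ (proj₁ c ≡ suc q × sum (proj₂ c) ≤ L) →
        ind k (proj₁ c) ≡ 0
      go (inj₁ (refl , _)) = ind-≢ (n₀ ∘ sym)
      go (inj₂ (refl , _)) = ind-≢ (n₁ ∘ sym)

    -- Rows 0 and q + 1 contain no jobs, so their equations bound the columns of either kind by the
    -- tokens. No column carries any other tag.
    tags-available : ∀ k → wt (ind k ∘ proj₁) X ≤ keyCnt k tk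
    tags-available k with k ≟ 0 | k ≟ suc q
    ... | yes refl | _        = tag-≤ z<s (cnt-ps-outside λ ())
    ... | no _     | yes refl = tag-≤ ≤-refl (cnt-ps-outside λ (_ , le) → <-irrefl refl le)
    ... | no n₀    | no n₁    = ≤-trans (≤-reflexive (tag-zero n₀ n₁)) z≤n

    slotTable : Table
    slotTable = proj₁ (⟦ slots ⟧ (X , tk , tt))

    slots-key : ∀ g → wt (g ∘ proj₁) slotTable ≡ wt (wt g ∘ proj₂) X
    slots-key = proj₁ (slots-spec X tk tags-available)

    -- A configuration is charged T₀ and a block L. Each machine below M owns one token of the first
    -- kind and t of the second, which adds up to T₀ + t L.
    slots-load : ∀ φ → wt (λ (s , μ) → φ μ * s) slotTable ≤ (T₀ + t * L) * wt φ (rng M)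
    slots-load φ = ≤-trans (m≤m+n _ _) (≤-trans
      (proj₂ (proj₂ (slots-spec X tk tags-available)) (λ (s , μ) → φ μ * s) (λ (tag , μ) → φ μ * cap tag)
        (All.map (λ {c} m μ → fits {c} (Column.shape (columns-sound q L T₀ m)) μ) X⊆))
      (≤-reflexive (trans (tokens-spec M t (suc q) (λ (tag , μ) → φ μ * cap tag))
        (trans (cong₂ (λ x y → x + t * y) (scale T₀) (scale L)) (rearrange T₀ t L (wt φ (rng M)))))))
      where
      rearrange : ∀ a t l w → a * w + t * (l * w) ≡ (a + t * l) * w
      rearrange = solve-∀
      scale : ∀ c → wt (λ μ → φ μ * c) (rng M) ≡ c * wt φ (rng M)
      scale c = trans (wt-cong (λ μ → *-comm (φ μ) c) (rng M)) (wt-scale c φ (rng M))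
      fits : ∀ {c : Col} → (proj₁ c ≡ 0 × sum (proj₂ c) ≤ T₀) ⊎ (proj₁ c ≡ suc q × sum (proj₂ c) ≤ L) →
             ∀ μ → wt (λ s → φ μ * s) (proj₂ c) ≤ φ μ * cap (proj₁ c)
      fits {_ , w} (inj₁ (refl , le)) μ = ≤-trans (≤-reflexive (wt-scale (φ μ) id w)) (*-monoʳ-≤ (φ μ) le)
      fits {_ , w} (inj₂ (refl , le)) μ = ≤-trans (≤-reflexive (wt-scale (φ μ) id w)) (*-monoʳ-≤ (φ μ) le)

    module _ (c≡[] : c ≡ []) where

      -- Column tags do not occur in rows 1 to q, so with the empty carry the equation of the row
      -- provides at least one slot for each job of that size.
      jobs-fit : ∀ k → cnt k ps ≤ keyCnt k slotTable
      jobs-fit k with 1 ≤? k | k ≤? q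
      ... | no out | _      = ≤-trans (≤-reflexive (cnt-ps-outside λ (p , _) → out p)) z≤n
      ... | yes _  | no out = ≤-trans (≤-reflexive (cnt-ps-outside λ (_ , l) → out l)) z≤n
      ... | yes pos | yes le = ≤-trans (m≤n+m (cnt k ps) (keyCnt k tk)) (≤-reflexive (begin
        keyCnt k tk + cnt k ps                          ≡⟨ cnt-items k ⟨
        cnt k its                                     ≡⟨ s (m≤n⇒m≤1+n (s≤s le)) ⟨
        cnt k c + cnt k (flat X)                        ≡⟨ cong (λ c → cnt k c + cnt k (flat X)) c≡[] ⟩
        cnt k (flat X)                                  ≡⟨ cnt-flat k ⟩
        wt (ind k ∘ proj₁) X + wt (cnt k ∘ proj₂) X     ≡⟨ cong (_+ wt (cnt k ∘ proj₂) X)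
                                                             (tag-zero (λ { refl → n≮0 pos })
                                                               (λ { refl → <-irrefl refl le })) ⟩
        wt (cnt k ∘ proj₂) X                            ≡⟨ slots-key (ind k) ⟨
        keyCnt k slotTable                              ∎))
        where open ≡-Reasoning

      solution-good : Good M ps (T₀ + t * L) (proj₁ (⟦ assign ⟧ (ps , slotTable , tt)))
      solution-good = let el , eg = assign-spec ps slotTable jobs-fit in
        el , λ φ → ≤-trans (m≤m+n _ _) (≤-trans (≤-reflexive (sym (eg (λ (s , μ) → φ μ * s)))) (slots-load φ))

-- Searching for the optimal makespan

opaque

  keys : Tm (list kv ∷ []) (list nat)
  keys = `foldr (`fst v0 `∷ v1) `[] v0

  keys-sem : ∀ tbl → ⟦ keys ⟧ (tbl , tt) ≡ map proj₁ tbl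
  keys-sem []        = refl
  keys-sem (e ∷ tbl) = cong (proj₁ e ∷_) (keys-sem tbl)

  keys-peak : ∀ {B tbl} → length tbl ≤ B → peak keys (tbl , tt) ≤ B
  keys-peak {tbl = tbl} le = ⊔-lub le (foldPeak≤ (λ _ _ → z≤n) tbl)

opaque

  null : Tm (list nat ∷ []) bool
  null = `foldr `f `t v0

  null-[] : ⟦ null ⟧ ([] , tt) ≡ true
  null-[] = refl

  null-true : ∀ xs → ⟦ null ⟧ (xs , tt) ≡ true → xs ≡ []
  null-true [] e = refl

  null-peak : ∀ {B xs} → length xs ≤ B → peak null (xs , tt) ≤ B
  null-peak {xs = xs} le = ⊔-lub le (foldPeak≤ (λ _ _ → z≤n) xs)

build : List Col → Table → List ℕ → List ℕ
build X tk ps = proj₁ (⟦ assign ⟧ (ps , proj₁ (⟦ slots ⟧ (X , tk , tt)) , tt))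

opaque

  -- An entry with the empty carry at position 0 solves the system itself; any other carry is a set
  -- of items left uncovered. Without such an entry the previous answer survives.
  pick : Tm (list entry ∷ list kv ∷ list nat ∷ list nat ∷ []) (list nat)
  pick = `foldr (`if (call null (`fst v0 ▸ ∅))
                     (`fst (call assign (v4 ▸ `fst (call slots (`snd v0 ▸ v3 ▸ ∅)) ▸ ∅)))
                     v1) v3 v0

  pick-spec : ∀ es tk ps ans → let r = ⟦ pick ⟧ (es , tk , ps , ans , tt) in
    (Σ[ X ∈ List Col ] ([] , X) ∈ es × r ≡ build X tk ps) ⊎ (r ≡ ans × (∀ {X} → ¬ ([] , X) ∈ es))
  pick-spec []             tk ps ans = inj₂ (refl , λ ())
  pick-spec ((c , X) ∷ es) tk ps ans with ⟦ null ⟧ (c , tt) in e | pick-spec es tk ps ans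
  ... | true  | _ rewrite null-true c e = inj₁ (X , here refl , refl)
  ... | false | inj₁ (Y , m , eq) = inj₁ (Y , there m , eq)
  ... | false | inj₂ (eq , none)    = inj₂ (eq ,
    λ { (here refl) → false≢true (trans (sym e) null-[]) ; (there m) → none m })

  pick-peak : ∀ {B es tk ps} ans → length es ≤ B →
    (∀ {c X} → (c , X) ∈ es → length c ≤ B × peak slots (X , tk , tt) ≤ B ×
      peak assign (ps , proj₁ (⟦ slots ⟧ (X , tk , tt)) , tt) ≤ B) →
    peak pick (es , tk , ps , ans , tt) ≤ B
  pick-peak {es = es} ans le ok = ⊔-lub le (foldPeak-All (_∈ es)
    (λ _ m → let a , b , c = ok m in ⊔-lub (null-peak a) (⊔-lub (⊔-lub (⊔-lub b z≤n) c) z≤n)) (All.tabulate id))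

opaque

  -- Arguments: T₀, t, M, q, L, ps and the answer to be kept on failure.
  attempt : Tm (nat ∷ nat ∷ nat ∷ nat ∷ nat ∷ list nat ∷ list nat ∷ []) (list nat)
  attempt = `let (call tokens (v2 ▸ v1 ▸ `suc v3 ▸ ∅))
            (`let (call tables (v4 ▸ v5 ▸ v1 ▸ ∅))
            (call pick (call dp (`suc (`suc v5) ▸ `fst v0 ▸ `snd v0 ▸
                                 call append (call keys (v1 ▸ ∅) ▸ v7 ▸ ∅) ▸ ∅) ▸
                        v1 ▸ v7 ▸ v8 ▸ ∅)))

module _ (M q L T₀ t : ℕ) (ps : List ℕ) (psOK : All (InRange q) ps) (ans : List ℕ) where

  private
    its : List ℕ
    its = items M q t ps

    tk : Table
    tk = toks M t (suc q)

    its-eq : ⟦ append ⟧ (⟦ keys ⟧ (tk , tt) , ps , tt) ≡ its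
    its-eq = trans (append-sem {nat} (⟦ keys ⟧ (tk , tt)) ps) (cong (_++ ps) (keys-sem tk))

  opaque
    unfolding attempt

    attempt-sem : ⟦ attempt ⟧ (T₀ , t , M , q , L , ps , ans , tt) ≡
                  ⟦ pick ⟧ (solutions q L T₀ its , tk , ps , ans , tt)
    attempt-sem rewrite its-eq = refl

  attempt-spec : (∀ {i} → InRange q i → i ∣ L) → T₀ < q * L + L → (t ≡ 0 ⊎ q * L ≤ T₀) →
    let r = ⟦ attempt ⟧ (T₀ , t , M , q , L , ps , ans , tt) in
    Good M ps (T₀ + t * L) r ⊎ (r ≡ ans × ¬ Feasible M ps (T₀ + t * L))
  attempt-spec dv below above rewrite attempt-sem with pick-spec (solutions q L T₀ its) tk ps ans
  ... | inj₂ (eq , none) = inj₂ (eq , λ f → none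
    (proj₂ (feasible⇒solvable M q L T₀ t ps psOK dv below above f)))
  ... | inj₁ (X , m , eq) rewrite eq = inj₁ (let _ , X⊆ , s = Valid.sound (dp-valid q L T₀ its) m in
          solution-good M q L T₀ t ps psOK {[]} {X} X⊆ s refl)

  length-its : length its ≡ M + t * M + length ps
  length-its = trans (length-++ (map proj₁ tk)) (cong (_+ length ps) (trans (length-map proj₁ tk) length-tk))
    where
    length-tk : length tk ≡ M + t * M
    length-tk = trans (sym (wt-1 tk)) (trans (tokens-spec M t (suc q) (λ _ → 1))
      (cong₂ (λ x y → x + t * y) (trans (wt-1 (rng M)) (length-rng M)) (trans (wt-1 (rng M)) (length-rng M))))

  length-tk≤ : length tk ≤ length its
  length-tk≤ = ≤-trans (≤-reflexive (sym (length-map proj₁ tk)))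
    (≤-trans (m≤m+n _ _) (≤-reflexive (sym (length-++ (map proj₁ tk)))))

  tk-keys : All (λ e → proj₁ e ≤ suc q) tk
  tk-keys = go tk (trans (tokens-spec M t (suc q) (χ ∘ proj₁))
    (trans (cong₂ (λ x y → x + t * y) (wt-zero {xs = rng M} (All.tabulate λ _ → refl))
                                      (wt-zero {xs = rng M} (All.tabulate λ _ → χ-last)))
           (*-zeroʳ t)))
    where
    χ : ℕ → ℕ
    χ i = if i ≤ᵇ suc q then 0 else 1
    χ-last : χ (suc q) ≡ 0
    χ-last rewrite ≤⇒≤ᵇ-true (≤-refl {suc q}) = refl
    go : ∀ tbl → wt (χ ∘ proj₁) tbl ≡ 0 → All (λ e → proj₁ e ≤ suc q) tbl
    go [] e = []
    go ((k , v) ∷ tbl) e with k ≤ᵇ suc q in eq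
    ... | true = ≤ᵇ-true {k} eq ∷ go tbl e

  slots-keys : ∀ {c X} (X⊆ : All (_∈ cols q L T₀) X) (s : Solves q L T₀ its 0 c X) →
               All (λ e → proj₁ e ≤ q) (proj₁ (⟦ slots ⟧ (X , tk , tt)))
  slots-keys {c} {X} X⊆ s = go _ (trans (slots-key M q L T₀ t ps psOK {c} {X} X⊆ s (outOfRange q))
    (wt-zero (All.map (λ m → wt-zero (All.map inRange-zero (Column.letters (columns-sound q L T₀ m)))) X⊆)))
    where
    go : ∀ tbl → wt (outOfRange q ∘ proj₁) tbl ≡ 0 → All (λ e → proj₁ e ≤ q) tbl
    go [] e = []
    go ((k , v) ∷ tbl) e = proj₂ (outOfRange-zero q k (m+n≡0⇒m≡0 _ e)) ∷ go tbl (m+n≡0⇒n≡0 (outOfRange q k) e)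

  slots-length : ∀ {c X K} (X⊆ : All (_∈ cols q L T₀) X) (s : Solves q L T₀ its 0 c X) →
    All (λ col → length (proj₂ col) ≤ K) (cols q L T₀) →
    length (proj₁ (⟦ slots ⟧ (X , tk , tt))) ≤ length X * K
  slots-length {c} {X} {K} X⊆ s wK = ≤-trans (≤-reflexive
    (trans (sym (wt-1 (proj₁ (⟦ slots ⟧ (X , tk , tt)))))
           (slots-key M q L T₀ t ps psOK {c} {X} X⊆ s (λ _ → 1))))
    (go X⊆)
    where
    go : ∀ {X} → All (_∈ cols q L T₀) X → wt (wt (λ _ → 1) ∘ proj₂) X ≤ length X * K
    go [] = z≤n
    go {(_ , w) ∷ X} (m ∷ ms) = +-mono-≤ (≤-trans (≤-reflexive (wt-1 w)) (All.lookup wK m)) (go ms)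

  opaque
    unfolding attempt

    attempt-peak : ∀ {B K} → M ≤ B → t ≤ B → 2 + q ≤ B →
      (length its + length its) * suc K ≤ B →
      K ≤ B → size (list (list nat)) (box q L T₀) ≤ K → length (moves q L T₀) ≤ B →
      All (λ col → length (proj₂ col) ≤ K) (cols q L T₀) →
      suc K ≤ B →
      peak tables (q , L , T₀ , tt) ≤ B →
      (∀ {c r c′ k} → c ∈ box q L T₀ → r ∈ moves q L T₀ → c′ ∈ box q L T₀ →
        peak test (2 + q , c , r , ⟦ bits ⟧ (k , 2 + q , its , tt) , c′ , tt) ≤ B) →
      peak attempt (T₀ , t , M , q , L , ps , ans , tt) ≤ B
    attempt-peak {B} {K} lM lt lq lI lK lbox lmoves wK lsK ltab ltest rewrite its-eq =
      ⊔-lub (tokens-peak {Q = suc q} lM lt) (⊔-lub ltab (⊔-lub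
        (⊔-lub (⊔-lub (⊔-lub (⊔-lub (⊔-lub (keys-peak (≤-trans length-tk≤ l1))
                       (append-peak {nat} (≤-trans
                         (≤-reflexive (trans (cong length (keys-sem tk)) (length-map proj₁ tk)))
                         (≤-trans length-tk≤ l1)))) z≤n) z≤n) z≤n)
               (dp-peak q L T₀ its lq l2 itemsB
                 (≤-trans (s≤s (≤-trans (length≤size {list nat} (box q L T₀)) lbox)) lsK) lmoves
                   (λ {c} {r} {c′} {k} → ltest {c} {r} {c′} {k})))
        (pick-peak ans (≤-trans (Valid.short (dp-valid q L T₀ its))
                         (≤-trans (s≤s (≤-trans (length≤size {list nat} (box q L T₀)) lbox)) lsK)) entryB)))
      where
      -- The slots number at most 2 |its| · K; the factor `suc K` in the hypothesis covers 2 |its|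
      -- as well when K is 0.
      l2 : length its + length its ≤ B
      l2 = ≤-trans (m≤m*n (length its + length its) (suc K)) lI
      l1 : length its ≤ B
      l1 = ≤-trans (m≤m+n _ _) l2
      psB : All (_≤ B) ps
      psB = All.map (λ (_ , le) → ≤-trans (m≤n⇒m≤1+n (m≤n⇒m≤1+n le)) lq) psOK
      itemsB : All (_≤ B) its
      itemsB = ++⁺ (map⁺ (All.map (λ le → ≤-trans (m≤n⇒m≤1+n le) lq) tk-keys)) psB
      psL : length ps ≤ B
      psL = ≤-trans (m≤n+m (length ps) (M + t * M)) (≤-trans (≤-reflexive (sym length-its)) l1)
      entryB : ∀ {c X} → (c , X) ∈ solutions q L T₀ its → length c ≤ B × peak slots (X , tk , tt) ≤ B ×
               peak assign (ps , proj₁ (⟦ slots ⟧ (X , tk , tt)) , tt) ≤ B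
      entryB {c} {X} m =
        let c∈ , X⊆ , s = Valid.sound (dp-valid q L T₀ its) m
            lX = All.lookup (valid-columns q L T₀ its (dp-valid q L T₀ its)) m
        in ≤-trans (length≤size {nat} c) (≤-trans (∈⇒size≤ {list nat} c∈) (≤-trans lbox lK))
         , slots-peak (≤-trans lX l2) (All.map colB X⊆) (≤-trans length-tk≤ l1 ,
           All.map (λ le → ≤-trans (m≤n⇒m≤1+n le) lq) tk-keys)
         , assign-peak psL psB (≤-trans (slots-length {c} {X} X⊆ s wK) (≤-trans (*-mono-≤ lX (n≤1+n K)) lI)
                               , All.map (λ le → ≤-trans (m≤n⇒m≤1+n (m≤n⇒m≤1+n le)) lq)
                                 (slots-keys {c} {X} X⊆ s))
        where
        tagB : ∀ {c : Col} → (proj₁ c ≡ 0 × sum (proj₂ c) ≤ T₀) ⊎ (proj₁ c ≡ suc q × sum (proj₂ c) ≤ L) →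
          proj₁ c ≤ suc q
        tagB (inj₁ (refl , _)) = z≤n
        tagB (inj₂ (refl , _)) = ≤-refl
        colB : ∀ {col : Col} → col ∈ cols q L T₀ → proj₁ col ≤ B × length (proj₂ col) ≤ B
        colB {col} m = ≤-trans (m≤n⇒m≤1+n (tagB {col} (Column.shape (columns-sound q L T₀ m)))) lq ,
          ≤-trans (All.lookup wK m) lK

opaque

  tryT : Tm (nat ∷ list nat ∷ nat ∷ nat ∷ nat ∷ list nat ∷ []) (list nat)
  tryT = `let (call splitT (v0 ▸ call mul (v3 ▸ v4 ▸ ∅) ▸ call mul (`suc v3 ▸ v4 ▸ ∅) ▸ ∅))
              (call attempt (`fst v0 ▸ `snd v0 ▸ v3 ▸ v4 ▸ v5 ▸ v6 ▸ v2 ▸ ∅))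

opaque

  -- T descends from the total volume to 0 and a failed attempt keeps the answer so far, so the
  -- final answer comes from the smallest T that succeeds. Trying every value is affordable, there
  -- being at most n q + 1 of them.
  search : Tm (nat ∷ nat ∷ list nat ∷ []) (list nat)
  search = `let (call fact (v1 ▸ ∅))
           (`loop (call tryT (v0 ▸ v1 ▸ v3 ▸ v4 ▸ v2 ▸ v5 ▸ ∅)) `[] (`suc (call sumL (v3 ▸ ∅))))

-- `paramSize` bounds the arguments q, L and T₀ < (q + 1) L of `tables` and `columns`. `testSize`
-- bounds the arguments of `test`; its summand 2 (q + 2) is for the digits from `bits-size`.
paramSize tableSize testSize : ℕ → ℕ
paramSize q = q + suc q * factorial q
tableSize q = sizeBound tables (paramSize q) + sizeBound columns (paramSize q)
testSize q  = tableSize q + ((2 + q) + (2 + q))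

-- M + t M + n with M ≤ n and t ≤ T ≤ n q.
itemBound : ℕ → ℕ → ℕ
itemBound n q = n + n * q * n + n

record Budget (n q B : ℕ) : Set where
  field
    fact≤    : peakBound fact q ≤ B
    param≤   : paramSize q ≤ B
    tables≤  : peakBound tables (paramSize q) ≤ B
    test≤    : peakBound test (testSize q) ≤ B
    table≤   : suc (tableSize q) ≤ B
    letters≤ : 2 + q ≤ B
    volume≤  : suc (n * q) ≤ B
    items≤   : (itemBound n q + itemBound n q) * suc (tableSize q) ≤ B

sum≤ : ∀ {q ps} → All (InRange q) ps → sum ps ≤ length ps * q
sum≤ []             = z≤n
sum≤ ((_ , le) ∷ r) = +-mono-≤ le (sum≤ r)

module _ (M q : ℕ) (ps : List ℕ) (psOK : All (InRange q) ps) where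

  private
    L : ℕ
    L = factorial q

  split-of : ∀ T → let (T₀ , t) = ⟦ splitT ⟧ (T , q * L , suc q * L , tt) in Split T (q * L) L T₀ t
  split-of T = splitT-spec T (q * L) L (suc q * L) (+-comm L (q * L)) (factorial-pos q)

  opaque
    unfolding tryT

    tryT-spec : ∀ T ans → let r = ⟦ tryT ⟧ (T , ans , M , q , L , ps , tt) in
      Good M ps T r ⊎ (r ≡ ans × ¬ Feasible M ps T)
    tryT-spec T ans rewrite mul-sem q L | mul-sem (suc q) L
      with ⟦ splitT ⟧ (T , q * L , suc q * L , tt) | split-of T
    ... | T₀ , t | mkSplit refl below above =
      attempt-spec M q L T₀ t ps psOK ans (λ (p , l) → factorial-divides p l) below above

    tryT-peak : ∀ {B T} ans → M ≤ length ps → T ≤ sum ps → Budget (length ps) q B →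
                peak tryT (T , ans , M , q , L , ps , tt) ≤ B
    tryT-peak {B} {T} ans lM lT bud rewrite mul-sem q L | mul-sem (suc q) L =
      ⊔-lub (⊔-lub (⊔-lub (⊔-lub (mul-peak {b = L} sq≤ L≤) (mul-peak q≤ L≤)) z≤n)
               (splitT-peak T≤ (≤-trans (m≤n+m _ q) param≤) (m<n+m (q * L) (factorial-pos q))))
            (inner _ (split-of T))
      where
      open Budget bud
      q≤ : q ≤ B
      q≤ = ≤-trans (m≤m+n q _) param≤
      sq≤ : suc q ≤ B
      sq≤ = ≤-trans (n≤1+n _) letters≤
      L≤ : L ≤ B
      L≤ = ≤-trans (≤-trans (m≤m+n L (q * L)) (m≤n+m _ q)) param≤
      Tnq : T ≤ length ps * q
      Tnq = ≤-trans lT (sum≤ psOK)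
      T≤ : T ≤ B
      T≤ = ≤-trans Tnq (≤-trans (n≤1+n _) volume≤)
      inner : ∀ (a : ℕ × ℕ) → Split T (q * L) L (proj₁ a) (proj₂ a) →
              peak attempt (proj₁ a , proj₂ a , M , q , L , ps , ans , tt) ≤ B
      inner (T₀ , t) (mkSplit value below _) = attempt-peak M q L T₀ t ps psOK ans {B} {tableSize q}
        (≤-trans lM (≤-trans (≤-trans (≤-trans (m≤n+m _ (length ps + length ps * q * length ps))
          (m≤m+n _ (itemBound (length ps) q))) (m≤m*n _ (suc (tableSize q)))) items≤))
        (≤-trans t≤ (≤-trans (n≤1+n _) volume≤)) letters≤
        (≤-trans (*-monoˡ-≤ (suc (tableSize q)) (+-mono-≤ its≤ its≤)) items≤)
        (≤-trans (n≤1+n _) table≤)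
        (≤-trans (≤-trans (m≤m⊔n _ _) tables-size) (m≤m+n _ _))
        (≤-trans (length≤size {list col} (moves q L T₀))
          (≤-trans (m≤n⊔m (size (list (list nat)) (box q L T₀)) _)
          (≤-trans tables-size (≤-trans (m≤m+n _ _) (≤-trans (n≤1+n _) table≤)))))
        (All.tabulate λ {c} m → ≤-trans (length≤size {nat} (proj₂ c))
          (≤-trans (m≤n⊔m (proj₁ c) _) (≤-trans (∈⇒size≤ {col} m)
          (≤-trans columns-size (m≤n+m _ (sizeBound tables (paramSize q)))))))
        table≤
        (≤-trans (peak≤ tables (q , L , T₀ , tt) env≤) tables≤)
        (λ {c} {r} {c′} {k} c∈ r∈ c′∈ → ≤-trans
          (peak≤ test (2 + q , c , r , ⟦ bits ⟧ (k , 2 + q , items M q t ps , tt) , c′ , tt)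
          (⊔-lub (≤-trans (m≤m+n (2 + q) (2 + q)) (m≤n+m _ (tableSize q)))
          (⊔-lub (≤-trans (∈⇒size≤ {list nat} c∈) box≤)
          (⊔-lub (≤-trans (∈⇒size≤ {list col} r∈) moves≤)
          (⊔-lub (≤-trans (bits-size k (2 + q) (items M q t ps)) (m≤n+m _ (tableSize q)))
          (⊔-lub (≤-trans (∈⇒size≤ {list nat} c′∈) box≤) z≤n)))))) test≤)
        where
        T₀≤ : T₀ ≤ paramSize q
        T₀≤ = ≤-trans (<⇒≤ below) (≤-trans (≤-reflexive (+-comm (q * L) L)) (m≤n+m (suc q * L) q))
        env≤ : q ⊔ (L ⊔ (T₀ ⊔ 0)) ≤ paramSize q
        env≤ = ⊔-lub (m≤m+n q _) (⊔-lub (≤-trans (m≤m+n L (q * L)) (m≤n+m _ q)) (⊔-lub T₀≤ z≤n))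
        tables-size : size (list (list nat)) (box q L T₀) ⊔ size (list (list col))
          (moves q L T₀) ≤ sizeBound tables (paramSize q)
        tables-size = size≤ tables (q , L , T₀ , tt) env≤
        columns-size : size (list col) (cols q L T₀) ≤ sizeBound columns (paramSize q)
        columns-size = size≤ columns (q , L , T₀ , tt) env≤
        box≤ : size (list (list nat)) (box q L T₀) ≤ testSize q
        box≤ = ≤-trans (≤-trans (m≤m⊔n _ _) tables-size) (≤-trans (m≤m+n _ _) (m≤m+n (tableSize q) _))
        moves≤ : size (list (list col)) (moves q L T₀) ≤ testSize q
        moves≤ = ≤-trans (≤-trans (m≤n⊔m (size (list (list nat)) (box q L T₀)) _) tables-size)
          (≤-trans (m≤m+n _ _) (m≤m+n (tableSize q) _))
        t≤ : t ≤ length ps * q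
        t≤ = ≤-trans (≤-trans (≤-reflexive (sym (*-identityʳ t))) (*-monoʳ-≤ t (factorial-pos q)))
               (≤-trans (m≤n+m (t * L) T₀) (≤-trans (≤-reflexive (sym value)) Tnq))
        its≤ : length (items M q t ps) ≤ itemBound (length ps) q
        its≤ = ≤-trans (≤-reflexive (length-its M q L T₀ t ps psOK ans))
          (+-monoˡ-≤ (length ps) (+-mono-≤ lM (*-mono-≤ t≤ lM)))

  opaque
    unfolding search

    -- The invariant says that the answer is good for every feasible T from the counter up to the
    -- total volume. A success at k serves all larger T by `Good-mono`; a failure keeps the answer
    -- for larger T and shows that k itself is infeasible.
    search-spec : ∀ T → T ≤ sum ps → Feasible M ps T → Good M ps T (⟦ search ⟧ (M , q , ps , tt))
    search-spec T le f rewrite sumL-sem ps = countdown-inv P down (suc (sum ps)) start T z≤n le f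
      where
      P : ℕ → List ℕ → Set
      P k a = ∀ T → k ≤ T → T ≤ sum ps → Feasible M ps T → Good M ps T a
      start : P (suc (sum ps)) []
      start T l₁ l₂ = ⊥-elim (<-irrefl refl (≤-trans l₁ l₂))
      down : ∀ {k a} → P (suc k) a → P k (⟦ tryT ⟧ (k , a , M , q , L , ps , tt))
      down {k} {a} p T l₁ l₂ f with tryT-spec k a | m≤n⇒m<n∨m≡n l₁
      ... | inj₁ g            | _         = Good-mono {M} {ps} l₁ g
      ... | inj₂ (e , _)      | inj₁ k<T  = subst (Good M ps T) (sym e) (p T k<T l₂ f)
      ... | inj₂ (_ , none)   | inj₂ refl = ⊥-elim (none f)

    search-peak : ∀ {B} → M ≤ length ps → Budget (length ps) q B → peak search (M , q , ps , tt) ≤ B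
    search-peak {B} lM bud rewrite sumL-sem ps =
      ⊔-lub (≤-trans (peak≤ fact (q , tt) (⊔-lub ≤-refl z≤n)) fact≤)
        (⊔-lub (sumL-peak {xs = ps} ps≤ (All.map (λ (_ , le) → ≤-trans le (≤-trans (m≤m+n q _) param≤)) psOK))
          (⊔-lub (≤-trans (s≤s (sum≤ psOK)) volume≤)
            (loopPeak-inv (λ k _ → k ≤ suc (sum ps)) (λ le → <⇒≤ le) (λ {k} {a} le →
              tryT-peak a lM (s≤s⁻¹ le) bud) (suc (sum ps)) ≤-refl)))
      where
      open Budget bud
      ps≤ : length ps ≤ B
      ps≤ = ≤-trans (≤-trans (≤-trans (m≤n+m _ (length ps + length ps * q * length ps))
        (m≤m+n _ (itemBound (length ps) q))) (m≤m*n _ (suc (tableSize q)))) items≤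

-- Binary input and output

digits : ℕᵇ → List Bool
digits ℕᵇ.zero  = []
digits 2[1+ b ] = true ∷ digits b
digits 1+[2 b ] = false ∷ digits b

enc-digits : ∀ b → enc (list bool) (digits b) ≡ encodeℕᵇ b
enc-digits ℕᵇ.zero  = refl
enc-digits 2[1+ b ] = cong (cons (cons nil nil)) (enc-digits b)
enc-digits 1+[2 b ] = cong (cons nil) (enc-digits b)

digitStep : Bool → ℕ → ℕ
digitStep d v = if d then suc (suc (v + v)) else suc (v + v)

value : List Bool → ℕ
value = foldr digitStep 0

value-digits : ∀ b → value (digits b) ≡ ℕᵇ.toℕ b
value-digits ℕᵇ.zero  = refl
value-digits 2[1+ b ] rewrite value-digits b | +-identityʳ (ℕᵇ.toℕ b) = cong suc (sym (+-suc (ℕᵇ.toℕ b) _))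
value-digits 1+[2 b ] rewrite value-digits b | +-identityʳ (ℕᵇ.toℕ b) = refl

value-fromℕ : ∀ k → value (digits (fromℕ k)) ≡ k
value-fromℕ k = trans (value-digits (fromℕ k)) (toℕ-fromℕ k)

size≤value : ∀ ds → size (list bool) ds ≤ value ds
size≤value []           = z≤n
size≤value (true  ∷ ds) = s≤s (m≤n⇒m≤1+n (≤-trans (size≤value ds) (m≤m+n _ _)))
size≤value (false ∷ ds) = s≤s (≤-trans (size≤value ds) (m≤m+n _ _))

-- Digits in bijective base 2 are 1 or 2, so k digits have value at least 1 + 2 + ... + 2 ^ (k - 1)
-- = 2 ^ k - 1.
2^length≤ : ∀ ds → 2 ^ length ds ≤ suc (value ds)
2^length≤ []       = ≤-refl
2^length≤ (d ∷ ds) = ≤-trans (*-monoʳ-≤ 2 (2^length≤ ds)) (≤-trans (≤-reflexive (rearrange (value ds))) (go d))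
  where
  rearrange : ∀ v → 2 * suc v ≡ suc (suc (v + v))
  rearrange = solve-∀
  go : ∀ d → suc (suc (value ds + value ds)) ≤ suc (digitStep d (value ds))
  go true  = n≤1+n _
  go false = ≤-refl

length-digits : ∀ m → length (digits (fromℕ m)) ≤ suc ⌊log₂ m ⌋
length-digits m with digits (fromℕ m) | 2^length≤ (digits (fromℕ m)) | value-fromℕ m
... | []     | _  | _ = z≤n
... | d ∷ ds | le | e = s≤s (≤-trans (≤-reflexive (sym (⌊log₂[2^n]⌋≡n (length ds))))
  (⌊log₂⌋-mono-≤ {2 ^ length ds} {m} (≮⇒≥ λ lt →
    <-irrefl refl (≤-trans (≤-trans (s≤s (s≤s (m≤m+n m (m + 0))) )
      (≤-trans (≤-reflexive (rearrange m)) (*-monoʳ-≤ 2 lt)))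
      (≤-trans le (≤-reflexive (cong suc e)))))))
  where
  rearrange : ∀ m → suc (suc (m + (m + 0))) ≡ 2 * suc m
  rearrange = solve-∀

opaque

  grow : Tm (bool ∷ nat ∷ []) nat
  grow = `if v0 (`suc (`suc (call add (v1 ▸ v1 ▸ ∅)))) (`suc (call add (v1 ▸ v1 ▸ ∅)))

  grow-sem : ∀ d v → ⟦ grow ⟧ (d , v , tt) ≡ digitStep d v
  grow-sem true  v = cong (2 +_) (add-sem v v)
  grow-sem false v = cong suc (add-sem v v)

  grow-peak : ∀ {B} d {v} → v ≤ B → peak grow (d , v , tt) ≤ B
  grow-peak d le = ⊔-lub (add-peak _ le) (add-peak _ le)

opaque

  toNat : Tm (list bool ∷ []) nat
  toNat = `foldr (call grow (v0 ▸ v1 ▸ ∅)) `0 v0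

  toNat-sem : ∀ ds → ⟦ toNat ⟧ (ds , tt) ≡ value ds
  toNat-sem ds = foldr-cong′ grow-sem 0 ds

opaque

  -- The number of machines may be exponential in the input length, so it is
  -- cut off at the number of jobs after every digit.
  machines : Tm (nat ∷ list bool ∷ []) nat
  machines = `foldr (`let (call grow (v0 ▸ v1 ▸ ∅)) (`if (call leq (v0 ▸ v3 ▸ ∅)) v0 v3)) `0 v1

-- A digit step never lowers its argument. A value cut off at n would thus have stayed at n or
-- above, and the final cut hides the difference.
digitStep-cut : ∀ n d v → digitStep d (v ⊓ n) ⊓ n ≡ digitStep d v ⊓ n
digitStep-cut n d v with ≤-total v n
... | inj₁ le = cong (λ x → digitStep d x ⊓ n) (m≤n⇒m⊓n≡m le)
... | inj₂ ge = trans (cong (λ x → digitStep d x ⊓ n) (m≥n⇒m⊓n≡n ge))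
                      (trans (m≥n⇒m⊓n≡n (below d n)) (sym (m≥n⇒m⊓n≡n (≤-trans ge (below d v)))))
  where
  below : ∀ d v → v ≤ digitStep d v
  below true  v = m≤n⇒m≤1+n (m≤n⇒m≤1+n (m≤m+n v v))
  below false v = m≤n⇒m≤1+n (m≤m+n v v)

min-sem : ∀ x n → (if x ≤ᵇ n then x else n) ≡ x ⊓ n
min-sem x n with x ≤ᵇ n in e
... | true  = sym (m≤n⇒m⊓n≡m (≤ᵇ-true {x} e))
... | false = sym (m≥n⇒m⊓n≡n (<⇒≤ (≰⇒> λ le → false≢true (trans (sym e) (≤⇒≤ᵇ-true le)))))

opaque
  unfolding machines

  private
    machineStep : ∀ n d v → (if ⟦ leq ⟧ (⟦ grow ⟧ (d , v , tt) , n , tt) then ⟦ grow ⟧ (d , v ,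
      tt) else n) ≡ digitStep d v ⊓ n
    machineStep n d v rewrite grow-sem d v | leq-sem (digitStep d v) n = min-sem (digitStep d v) n

  machines-sem : ∀ n ds → ⟦ machines ⟧ (n , ds , tt) ≡ value ds ⊓ n
  machines-sem n []       = refl
  machines-sem n (d ∷ ds) = trans (machineStep n d _)
    (trans (cong (λ v → digitStep d v ⊓ n) (machines-sem n ds)) (digitStep-cut n d (value ds)))

  machines-peak : ∀ {B n ds} → n ≤ B → length ds ≤ B → peak machines (n , ds , tt) ≤ B
  machines-peak {B} {n} {ds} ln ll = ⊔-lub ll (proj₁ (foldPeak-inv (λ _ → ⊤) (_≤ n) z≤n
    (λ {d} {v} _ _ → ≤-trans (≤-reflexive (machineStep n d v)) (m⊓n≤n _ n))
    (λ {d} {v} _ le → ⊔-lub (grow-peak d (≤-trans le ln)) (⊔-lub (leq-peak {a = ⟦ grow ⟧ (d , v , tt)} ln) z≤n))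
    (All.tabulate {xs = ds} λ _ → tt)))

opaque

  maxL : Tm (list nat ∷ []) nat
  maxL = `foldr (`if (call leq (v1 ▸ v0 ▸ ∅)) v0 v1) `0 v0

  private
    maxStep : ∀ x a → (if ⟦ leq ⟧ (a , x , tt) then x else a) ≡ x ⊔ a
    maxStep x a rewrite leq-sem a x with a ≤ᵇ x in e
    ... | true  = sym (m≥n⇒m⊔n≡m (≤ᵇ-true {a} e))
    ... | false = sym (m≤n⇒m⊔n≡n (<⇒≤ (≰⇒> λ le → false≢true (trans (sym e) (≤⇒≤ᵇ-true le)))))

  maxL-upper : ∀ xs → All (_≤ ⟦ maxL ⟧ (xs , tt)) xs
  maxL-upper [] = []
  maxL-upper (x ∷ xs) rewrite maxStep x (⟦ maxL ⟧ (xs , tt)) =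
    m≤m⊔n x _ ∷ All.map (λ le → ≤-trans le (m≤n⊔m x _)) (maxL-upper xs)

  maxL-least : ∀ {v xs} → All (_≤ v) xs → ⟦ maxL ⟧ (xs , tt) ≤ v
  maxL-least [] = z≤n
  maxL-least {xs = x ∷ xs} (le ∷ les) rewrite maxStep x (⟦ maxL ⟧ (xs , tt)) = ⊔-lub le (maxL-least les)

  maxL-peak : ∀ {B xs} → length xs ≤ B → All (_≤ B) xs → peak maxL (xs , tt) ≤ B
  maxL-peak ll la = ⊔-lub ll (foldPeak-All (_≤ _) (λ a le → ⊔-lub (leq-peak {a = a} le) z≤n) la)

opaque

  -- The fold carries the unchanged tail beside its increment: digit 1 becomes 2 over the unchanged
  -- tail, while digit 2 becomes 1 and hands the carry to the incremented tail.
  incr : Tm (list bool ∷ []) (list bool)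
  incr = `snd (`foldr ((v0 `∷ `fst v1) `, `if v0 (`f `∷ `snd v1) (`t `∷ `fst v1)) (`[] `, (`f `∷ `[])) v0)

  private
    incr-pair : List Bool → List Bool × List Bool
    incr-pair = foldr (λ d a → (d ∷ proj₁ a) , (if d then false ∷ proj₂ a else true ∷ proj₁ a)) ([] ,
      false ∷ [])

    incr-digits : ∀ b → incr-pair (digits b) ≡ (digits b , digits (ℕᵇ.suc b))
    incr-digits ℕᵇ.zero  = refl
    incr-digits 2[1+ b ] rewrite incr-digits b = refl
    incr-digits 1+[2 b ] rewrite incr-digits b = refl

    incr-pair-length : ∀ ds → length (proj₁ (incr-pair ds)) ≤ length ds ×
      length (proj₂ (incr-pair ds)) ≤ suc (length ds)
    incr-pair-length []           = z≤n , s≤s z≤n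
    incr-pair-length (true  ∷ ds) = let a , b = incr-pair-length ds in s≤s a , s≤s b
    incr-pair-length (false ∷ ds) = let a , b = incr-pair-length ds in s≤s a , s≤s (m≤n⇒m≤1+n a)

  incr-sem : ∀ b → ⟦ incr ⟧ (digits b , tt) ≡ digits (ℕᵇ.suc b)
  incr-sem b = cong proj₂ (incr-digits b)

  incr-length : ∀ ds → length (⟦ incr ⟧ (ds , tt)) ≤ suc (length ds)
  incr-length ds = proj₂ (incr-pair-length ds)

  incr-peak : ∀ {B ds} → length ds ≤ B → peak incr (ds , tt) ≤ B
  incr-peak {ds = ds} le = ⊔-lub le (foldPeak≤ (λ _ _ → z≤n) ds)

opaque

  toBin : Tm (nat ∷ []) (list bool)
  toBin = `loop (call incr (v1 ▸ ∅)) `[] v0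

  toBin-sem : ∀ k → ⟦ toBin ⟧ (k , tt) ≡ digits (fromℕ k)
  toBin-sem k = trans (go k) (cong digits (sym (fromℕ≡fromℕ' k)))
    where
    step-out : ∀ k ds → countdown (λ _ a → ⟦ incr ⟧ (a , tt)) k (⟦ incr ⟧ (ds , tt)) ≡ ⟦ incr ⟧
      (countdown (λ _ a → ⟦ incr ⟧ (a , tt)) k ds , tt)
    step-out zero    ds = refl
    step-out (suc k) ds = step-out k (⟦ incr ⟧ (ds , tt))
    go : ∀ k → countdown (λ _ a → ⟦ incr ⟧ (a , tt)) k [] ≡ digits (fromℕ' k)
    go zero    = refl
    go (suc k) = trans (step-out k []) (trans (cong (λ ds → ⟦ incr ⟧ (ds , tt)) (go k)) (incr-sem (fromℕ' k)))

  toBin-peak : ∀ {B k} → k ≤ B → peak toBin (k , tt) ≤ B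
  toBin-peak {B} {k} le = ⊔-lub le (loopPeak-inv (λ j ds → length ds + j ≤ k)
    (λ {j} {ds} l → ≤-trans (+-monoˡ-≤ j (incr-length ds))
      (≤-trans (≤-reflexive (sym (+-suc (length ds) j))) l))
    (λ {j} {ds} l → incr-peak (≤-trans (≤-trans (m≤m+n (length ds) (suc j)) l) le)) k ≤-refl)

opaque

  -- Processing times are at most q, so turning each into unary costs a function of q. The output
  -- indices are below n, which makes counting up to them in binary affordable.
  solve : Tm ((list bool ⊗ list (list bool)) ∷ []) (list (list bool))
  solve = `let (`foldr (call toNat (v0 ▸ ∅) `∷ v1) `[] (`snd v0))
          (`let (call maxL (v0 ▸ ∅))
          (`foldr (call toBin (v0 ▸ ∅) `∷ v1) `[]
            (call search (call machines (call len (v1 ▸ ∅) ▸ `fst v2 ▸ ∅) ▸ v0 ▸ v1 ▸ ∅))))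

foldr-map : {A B : Set} {f g : A → B} → (∀ x → f x ≡ g x) → ∀ xs → foldr (λ x a → f x ∷ a) [] xs ≡ map g xs
foldr-map e []       = refl
foldr-map e (x ∷ xs) = cong₂ _∷_ (e x) (foldr-map e xs)

module _ (ds : List Bool) (pds : List (List Bool)) where

  private
    ps : List ℕ
    ps = map value pds

    q n : ℕ
    q = ⟦ maxL ⟧ (ps , tt)
    n = length ps

  opaque
    unfolding solve

    solve-sem : ⟦ solve ⟧ ((ds , pds) , tt) ≡ map (digits ∘ fromℕ) (⟦ search ⟧ (value ds ⊓ n , q , ps , tt))
    solve-sem rewrite foldr-map toNat-sem pds | len-sem {nat} ps | machines-sem n ds = foldr-map toBin-sem _

    solve-peak : ∀ {B} → n ≤ B → length ds ≤ B → q ≤ B → peakBound toNat q ≤ B →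
      peak search (value ds ⊓ n , q , ps , tt) ≤ B →
      length (⟦ search ⟧ (value ds ⊓ n , q , ps , tt)) ≤ B →
        All (_≤ B) (⟦ search ⟧ (value ds ⊓ n , q , ps , tt)) →
      peak solve ((ds , pds) , tt) ≤ B
    solve-peak {B} ln ll lq lN lS lO aO rewrite foldr-map toNat-sem pds | len-sem {nat} ps | machines-sem n ds =
      ⊔-lub (⊔-lub (≤-trans (≤-reflexive (sym (length-map value pds))) ln)
              (foldPeak-All (λ ds → value ds ≤ q) (λ {ds} a le →
                ⊔-lub (≤-trans (peak≤ toNat (ds , tt) (⊔-lub (≤-trans (size≤value ds) le) z≤n)) lN) z≤n)
                (map⁻ (maxL-upper ps))))
        (⊔-lub (maxL-peak ln (All.map (λ le → ≤-trans le lq) (maxL-upper ps)))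
          (⊔-lub (⊔-lub (⊔-lub (len-peak {nat} ln) (machines-peak ln ll)) lS)
            (⊔-lub lO (foldPeak-All (_≤ B) (λ a le → ⊔-lub (toBin-peak le) z≤n) aO))))

-- Schedules

ΣF : ∀ {k} → (Fin k → ℕ) → ℕ
ΣF {zero}  f = 0
ΣF {suc k} f = f Fin.zero + ΣF (f ∘ Fin.suc)

wt-tabulate : {X : Set} (g : X → ℕ) → ∀ {k} (f : Fin k → X) → wt g (tabulate f) ≡ ΣF (g ∘ f)
wt-tabulate g {zero}  f = refl
wt-tabulate g {suc k} f = cong (g (f Fin.zero) +_) (wt-tabulate g (f ∘ Fin.suc))

contents : ∀ {n k} → (Fin n → ℕ) → (Fin n → Fin k) → Fin k → List ℕ
contents {zero}  p s i = []
contents {suc n} p s i = if does (s Fin.zero Finₚ.≟ i) then p Fin.zero ∷ contents (p ∘ Fin.suc) (s ∘ Fin.suc) i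
                                                  else contents (p ∘ Fin.suc) (s ∘ Fin.suc) i

sum-contents : ∀ {n k} (p : Fin n → ℕ) (s : Fin n → Fin k) i →
               sum (contents p s i) ≡ sum (tabulate λ j → if does (s j Finₚ.≟ i) then p j else 0)
sum-contents {zero}  p s i = refl
sum-contents {suc n} p s i with does (s Fin.zero Finₚ.≟ i)
... | true  = cong (p Fin.zero +_) (sum-contents (p ∘ Fin.suc) (s ∘ Fin.suc) i)
... | false = sum-contents (p ∘ Fin.suc) (s ∘ Fin.suc) i

ΣF-add : ∀ {k} (i₀ : Fin k) x (y : Fin k → ℕ) →
         ΣF (λ i → if does (i₀ Finₚ.≟ i) then x + y i else y i) ≡ x + ΣF y
ΣF-add {suc k} Fin.zero    x y = +-assoc x (y Fin.zero) (ΣF (y ∘ Fin.suc))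
ΣF-add {suc k} (Fin.suc i) x y = trans (cong (y Fin.zero +_) (ΣF-add i x (y ∘ Fin.suc)))
  (rearrange (y Fin.zero) x (ΣF (y ∘ Fin.suc)))
  where
  rearrange : ∀ a b c → a + (b + c) ≡ b + (a + c)
  rearrange = solve-∀

ΣF-zero : ∀ k → ΣF {k} (λ _ → 0) ≡ 0
ΣF-zero zero    = refl
ΣF-zero (suc k) = ΣF-zero k

ΣF-cong : ∀ {k} {f g : Fin k → ℕ} → (∀ i → f i ≡ g i) → ΣF f ≡ ΣF g
ΣF-cong {zero}  e = refl
ΣF-cong {suc k} e = cong₂ _+_ (e Fin.zero) (ΣF-cong (e ∘ Fin.suc))

-- Every job lies on exactly one machine, where `ΣF-add` adds its weight.
wt-contents : ∀ {n k} (p : Fin n → ℕ) (s : Fin n → Fin k) g →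
              ΣF (λ i → wt g (contents p s i)) ≡ wt g (tabulate p)
wt-contents {zero}  {k} p s g = ΣF-zero k
wt-contents {suc n} p s g = trans (ΣF-cong λ i → push-in (does (s Fin.zero Finₚ.≟ i)))
  (trans (ΣF-add (s Fin.zero) (g (p Fin.zero)) (λ i → wt g (contents (p ∘ Fin.suc) (s ∘ Fin.suc) i)))
         (cong (g (p Fin.zero) +_) (wt-contents (p ∘ Fin.suc) (s ∘ Fin.suc) g)))
  where
  push-in : ∀ (b : Bool) {xs} → wt g (if b then p Fin.zero ∷ xs else xs) ≡ (if b then g (p Fin.zero) + wt g
    xs else wt g xs)
  push-in true  = refl
  push-in false = refl

feasible : ∀ {n k} (p : Fin n → ℕ) (s : Fin n → Fin k) T →
  (∀ i → sum (tabulate λ j → if does (s j Finₚ.≟ i) then p j else 0) ≤ T) → Feasible k (tabulate p) T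
feasible p s T le = tabulate (contents p s) , length-tabulate _ ,
  tabulate⁺ (λ i → ≤-trans (≤-reflexive (sum-contents p s i)) (le i)) ,
  λ g → trans (wt-tabulate (wt g) (contents p s)) (wt-contents p s g)

-- No machine holds more than the total volume. This brings every T into the range of the search.
feasible-cut : ∀ {k ps T} → Feasible k ps T → Feasible k ps (T ⊓ sum ps)
feasible-cut {ps = ps} (ws , e , les , eg) = ws , e ,
  All.tabulate (λ {w} m → ⊓-glb (All.lookup les m) (≤-trans (∈⇒≤wt sum m) (≤-reflexive (eg id)))) , eg

identity-load : ∀ {n} (p : Fin n → ℕ) i → sum (tabulate λ j → if does (j Finₚ.≟ i) then p j else 0) ≡ p i
identity-load p i = trans (wt-tabulate id (λ j → if does (j Finₚ.≟ i) then p j else 0)) (go p i)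
  where
  go : ∀ {n} (p : Fin n → ℕ) i → ΣF (λ j → if does (j Finₚ.≟ i) then p j else 0) ≡ p i
  go {suc n} p Fin.zero    = trans (cong (p Fin.zero +_) (ΣF-zero n)) (+-identityʳ _)
  go {suc n} p (Fin.suc i) = go (p ∘ Fin.suc) i

does-≟ : ∀ {k} (x i : Fin k) → does (x Finₚ.≟ i) ≡ (toℕ x ≡ᵇ toℕ i)
does-≟ x i with x Finₚ.≟ i
... | yes refl = sym (≡ᵇ-refl (toℕ x))
... | no ne    = sym (≡ᵇ-false (ne ∘ Finₚ.toℕ-injective))

fromList : ∀ {n m} vs → length vs ≡ n → All (_< m) vs → Σ[ s ∈ (Fin n → Fin m) ] tabulate (toℕ ∘ s) ≡ vs
fromList []       refl []       = (λ ()) , refl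
fromList (v ∷ vs) refl (lt ∷ ps) with fromList vs refl ps
... | s , e = (λ { Fin.zero → fromℕ< lt ; (Fin.suc j) → s j }) , cong₂ _∷_ (Finₚ.toℕ-fromℕ< lt) e

load-zip : ∀ {n k} (p : Fin n → ℕ) (s : Fin n → Fin k) i →
  sum (tabulate λ j → if does (s j Finₚ.≟ i) then p j else 0) ≡
  wt (λ (x , μ) → ind (toℕ i) μ * x) (zip (tabulate p) (tabulate (toℕ ∘ s)))
load-zip {zero}  p s i = refl
load-zip {suc n} p s i = cong₂ _+_ head (load-zip (p ∘ Fin.suc) (s ∘ Fin.suc) i)
  where
  head : (if does (s Fin.zero Finₚ.≟ i) then p Fin.zero else 0) ≡ ind (toℕ i) (toℕ (s Fin.zero)) * p Fin.zero
  head rewrite does-≟ (s Fin.zero) i with toℕ (s Fin.zero) ≡ᵇ toℕ i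
  ... | true  = sym (+-identityʳ _)
  ... | false = refl

-- A job with an index of at least M would contribute its positive processing time under the weight
-- χ, yet χ vanishes on all machines below M and hence the bound is 0.
good-bounded : ∀ {M ps T vs} → All (0 <_) ps → Good M ps T vs → All (_< M) vs
good-bounded {M} {ps} {T} {vs} pos (el , b) =
  go ps vs el pos (n≤0⇒n≡0 (≤-trans (b χ) (≤-reflexive (trans (cong (T *_) χ-rng) (*-zeroʳ T)))))
  where
  χ : ℕ → ℕ
  χ μ = if suc μ ≤ᵇ M then 0 else 1
  χ-rng : wt χ (rng M) ≡ 0
  χ-rng = wt-zero (All.map (λ {i} lt → cong (λ b → if b then 0 else 1) (≤⇒≤ᵇ-true lt)) (rng-bounded M))
  go : ∀ ps vs → length vs ≡ length ps → All (0 <_) ps → wt (λ (s , μ) → χ μ * s) (zip ps vs) ≡ 0 →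
    All (_< M) vs
  go []       []       e [] z = []
  go (p ∷ ps) (v ∷ vs) e (q ∷ qs) z with suc v ≤ᵇ M in eq
  ... | true  = ≤ᵇ-true {suc v} eq ∷ go ps vs (suc-injective e) qs z
  ... | false = ⊥-elim (n≮0 (≤-trans q (≤-reflexive (m+n≡0⇒m≡0 p (m+n≡0⇒m≡0 (p + 0) z)))))

-- Solving a given instance

module _ (I : Instance) where
  open Instance I

  private
    ps : List ℕ
    ps = tabulate p

    M : ℕ
    M = m ⊓ n

    q : ℕ
    q = ⟦ maxL ⟧ (ps , tt)

    input : Val (list bool ⊗ list (list bool))
    input = digits (fromℕ m) , tabulate (digits ∘ fromℕ ∘ p)

    vs : List ℕ
    vs = ⟦ search ⟧ (M , q , ps , tt)

  param≡ : q ≡ pmax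
  param≡ = ≤-antisym (maxL-least (xs≤max 0 ps)) (max≤v⁺ z≤n (maxL-upper ps))

  jobs-inRange : All (InRange q) ps
  jobs-inRange = All.zip (tabulate⁺ 0<p , maxL-upper ps)

  decode-jobs : map value (tabulate (digits ∘ fromℕ ∘ p)) ≡ ps
  decode-jobs = trans (map-tabulate (digits ∘ fromℕ ∘ p) value) (tabulate-cong (λ j → value-fromℕ (p j)))

  best : ∀ {T} → Feasible M ps T → Good M ps T vs
  best {T} f = Good-mono {M} {ps} (m⊓n≤m T (sum ps))
    (search-spec M q ps jobs-inRange (T ⊓ sum ps) (m⊓n≤n T (sum ps)) (feasible-cut {ps = ps} f))

  -- With at least as many machines as jobs, one job per machine is optimal.
  feasible-makespan : ∀ s → Feasible M ps (makespan s)
  feasible-makespan s with ≤-total m n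
  ... | inj₁ m≤n = subst (λ k → Feasible k ps (makespan s)) (sym (m≤n⇒m⊓n≡m m≤n))
                     (feasible p s (makespan s) (tabulate⁻ (xs≤max 0 (tabulate (load s)))))
  ... | inj₂ n≤m = subst (λ k → Feasible k ps (makespan s)) (sym (m≥n⇒m⊓n≡n n≤m))
                     (feasible p id (makespan s) λ j → ≤-trans (≤-reflexive (identity-load p j)) (job≤ j))
    where
    job≤ : ∀ j → p j ≤ makespan s
    job≤ j = ≤-trans (≤-trans (≤-reflexive (sym own)) (∈⇒≤wt-tabulate j))
      (tabulate⁻ (xs≤max 0 (tabulate (load s))) (s j))
      where
      own : (if does (s j Finₚ.≟ s j) then p j else 0) ≡ p j
      own rewrite does-≟ (s j) (s j) | ≡ᵇ-refl (toℕ (s j)) = refl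
      ∈⇒≤wt-tabulate : ∀ j → (if does (s j Finₚ.≟ s j) then p j else 0) ≤ load s (s j)
      ∈⇒≤wt-tabulate j = ∈⇒≤wt id (∈-tabulate⁺ j)

  -- Some feasible makespan has to be exhibited before `vs` is known to have the right length and
  -- range. All jobs on one machine provide it, as m is positive.
  vs-good : Good M ps (makespan (λ _ → fromℕ< 0<m)) vs
  vs-good = best (feasible-makespan (λ _ → fromℕ< 0<m))

  vs-length : length vs ≡ n
  vs-length = trans (proj₁ vs-good) (length-tabulate p)

  vs-bounded : All (_< M) vs
  vs-bounded = good-bounded {M} {ps} {makespan (λ _ → fromℕ< 0<m)} (tabulate⁺ 0<p) vs-good

  opaque

    schedule : Σ[ s ∈ Schedule ] tabulate (toℕ ∘ s) ≡ vs
    schedule = fromList vs vs-length (All.map (λ lt → ≤-trans lt (m⊓n≤m m n)) vs-bounded)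

  schedule-optimal : Optimal (proj₁ schedule)
  schedule-optimal s′ = max≤v⁺ z≤n (tabulate⁺ λ i → begin
    load (proj₁ schedule) i
      ≡⟨ load-zip p (proj₁ schedule) i ⟩
    wt (λ (x , μ) → ind (toℕ i) μ * x) (zip ps (tabulate (toℕ ∘ proj₁ schedule)))
      ≡⟨ cong (λ vs → wt (λ (x , μ) → ind (toℕ i) μ * x) (zip ps vs)) (proj₂ schedule) ⟩
    wt (λ (x , μ) → ind (toℕ i) μ * x) (zip ps vs)
      ≤⟨ proj₂ (best (feasible-makespan s′)) (ind (toℕ i)) ⟩
    -- For machines from M on the count is 0: they stay empty.
    makespan s′ * cnt (toℕ i) (rng M)
      ≤⟨ *-monoʳ-≤ (makespan s′) (cnt-rng≤1 (toℕ i) M) ⟩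
    makespan s′ * 1
      ≡⟨ *-identityʳ _ ⟩
    makespan s′ ∎)
    where open ≤-Reasoning

  solve-output : ⟦ solve ⟧ (input , tt) ≡ map (digits ∘ fromℕ) vs
  solve-output = trans (solve-sem (digits (fromℕ m)) (tabulate (digits ∘ fromℕ ∘ p)))
    (trans (cong₂ (λ k xs → map (digits ∘ fromℕ) (⟦ search ⟧ (k ⊓ length xs , ⟦ maxL ⟧ (xs , tt) , xs , tt)))
                  (value-fromℕ m) decode-jobs)
           (cong (λ k → map (digits ∘ fromℕ) (⟦ search ⟧ (m ⊓ k , q , ps , tt))) (length-tabulate p)))

  enc-numbers : ∀ {k} (f : Fin k → ℕ) → enc (list (list bool)) (tabulate (digits ∘ fromℕ ∘ f)) ≡ encodeList
    (tabulate (encodeℕ ∘ f))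
  enc-numbers {zero}  f = refl
  enc-numbers {suc k} f = cong₂ cons (enc-digits (fromℕ (f Fin.zero))) (enc-numbers (f ∘ Fin.suc))

  enc-input : enc (list bool ⊗ list (list bool)) input ≡ encodeInstance I
  enc-input = cong₂ cons (enc-digits (fromℕ m)) (enc-numbers p)

  enc-output : enc (list (list bool)) (⟦ solve ⟧ (input , tt)) ≡ encodeSchedule I (proj₁ schedule)
  enc-output = trans (cong (enc (list (list bool))) (trans solve-output
      (trans (cong (map (digits ∘ fromℕ)) (sym (proj₂ schedule)))
        (map-tabulate (toℕ ∘ proj₁ schedule) (digits ∘ fromℕ)))))
    (enc-numbers (toℕ ∘ proj₁ schedule))

  -- The demands are added rather than maximised because `FPT` is closed under sums; each of them is
  -- at most the sum.
  bounds : List ℕ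
  bounds = peakBound fact pmax ∷ paramSize pmax ∷ peakBound tables (paramSize pmax) ∷ peakBound test
    (testSize pmax) ∷
           suc (tableSize pmax) ∷ 2 + pmax ∷ suc (n * pmax) ∷
           (itemBound n pmax + itemBound n pmax) * suc (tableSize pmax) ∷
           n ∷ length (digits (fromℕ m)) ∷ peakBound toNat pmax ∷ []

  bound : ℕ
  bound = sum bounds

  budget : Budget n pmax bound
  budget = record
    { fact≤    = ∈⇒≤wt id {xs = bounds} (here refl)
    ; param≤   = ∈⇒≤wt id {xs = bounds} (there (here refl))
    ; tables≤  = ∈⇒≤wt id {xs = bounds} (there (there (here refl)))
    ; test≤    = ∈⇒≤wt id {xs = bounds} (there (there (there (here refl))))
    ; table≤   = ∈⇒≤wt id {xs = bounds} (there (there (there (there (here refl)))))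
    ; letters≤ = letters≤
    ; volume≤  = ∈⇒≤wt id {xs = bounds} (there (there (there (there (there (there (here refl)))))))
    ; items≤   = ∈⇒≤wt id {xs = bounds} (there (there (there (there (there (there (there (here refl))))))))
    }
    where
    letters≤ : 2 + pmax ≤ bound
    letters≤ = ∈⇒≤wt id {xs = bounds} (there (there (there (there (there (here refl))))))

  n≤bound : n ≤ bound
  n≤bound = ∈⇒≤wt id {xs = bounds} (there (there (there (there (there (there (there (there (here refl)))))))))

  digits≤bound : length (digits (fromℕ m)) ≤ bound
  digits≤bound = ∈⇒≤wt id {xs = bounds} (there
    (there (there (there (there (there (there (there (there (here refl))))))))))

  toNat≤bound : peakBound toNat pmax ≤ bound
  toNat≤bound = ∈⇒≤wt id {xs = bounds} (there
    (there (there (there (there (there (there (there (there (there (here refl)))))))))))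

  search≤bound : peak search (M , q , ps , tt) ≤ bound
  search≤bound = search-peak M q ps jobs-inRange (≤-trans (m⊓n≤n m n) (≤-reflexive (sym (length-tabulate p))))
    (subst₂ (λ k q → Budget k q bound) (sym (length-tabulate p)) (sym param≡) budget)

  solve≤bound : peak solve (input , tt) ≤ bound
  solve≤bound = solve-peak (digits (fromℕ m)) (tabulate (digits ∘ fromℕ ∘ p))
    (subst (λ xs → length xs ≤ bound) (sym decode-jobs) (≤-trans (≤-reflexive (length-tabulate p)) n≤bound))
    digits≤bound
    (subst (λ xs → ⟦ maxL ⟧ (xs , tt) ≤ bound) (sym decode-jobs)
      (≤-trans (≤-reflexive param≡) (≤-trans (m≤n+m pmax 2) (Budget.letters≤ budget))))
    (subst (λ xs → peakBound toNat (⟦ maxL ⟧ (xs , tt)) ≤ bound) (sym decode-jobs)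
      (≤-trans (≤-reflexive (cong (peakBound toNat) param≡)) toNat≤bound))
    (convert (λ k q xs → peak search (k , q , xs , tt) ≤ bound) search≤bound)
    (convert (λ k q xs → length (⟦ search ⟧ (k , q , xs , tt)) ≤ bound)
      (≤-trans (≤-reflexive vs-length) n≤bound))
    (convert (λ k q xs → All (_≤ bound) (⟦ search ⟧ (k , q , xs , tt)))
             (All.map (λ lt → ≤-trans (<⇒≤ lt) (≤-trans (m⊓n≤n m n) n≤bound)) vs-bounded))
    where
    convert : (P : ℕ → ℕ → List ℕ → Set) → P M q ps →
      let xs = map value (tabulate (digits ∘ fromℕ ∘ p)) in P (value (digits (fromℕ m)) ⊓ length xs)
        (⟦ maxL ⟧ (xs , tt)) xs
    convert P x = subst (λ xs → P (value (digits (fromℕ m)) ⊓ length xs) (⟦ maxL ⟧ (xs , tt)) xs)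
      (sym decode-jobs)
      (subst₂ (λ a b → P (a ⊓ b) q ps) (sym (value-fromℕ m)) (sym (length-tabulate p)) x)

-- Growth of the running time

FPT-n : FPT Instance.n
FPT-n = FPT-≤ (λ I → let open Instance I in ≤-trans (m≤m+n n ⌊log₂ m ⌋) (m≤n⊔m 1 _)) FPT-N

FPT-digits : FPT (λ I → length (digits (fromℕ (Instance.m I))))
FPT-digits = FPT-≤ (λ I → let open Instance I in
  ≤-trans (length-digits m) (s≤s (≤-trans (m≤n+m ⌊log₂ m ⌋ n) (m≤n⊔m 1 _)))) (FPT-+ (FPT-const 1) FPT-N)

FPT-bound : FPT bound
FPT-bound =
  FPT-+ (FPT-param (peakBound fact)) (FPT-+ (FPT-param paramSize)
  (FPT-+ (FPT-param (λ q → peakBound tables (paramSize q)))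
    (FPT-+ (FPT-param (λ q → peakBound test (testSize q)))
  (FPT-+ (FPT-param (λ q → suc (tableSize q))) (FPT-+ (FPT-param (2 +_))
  (FPT-+ (FPT-+ (FPT-const 1) (FPT-* FPT-n FPT-pmax))
  (FPT-+ (FPT-* (FPT-+ FPT-items FPT-items) (FPT-param (λ q → suc (tableSize q))))
  (FPT-+ FPT-n (FPT-+ FPT-digits (FPT-+ (FPT-param (peakBound toNat)) (FPT-const 0)))))))))))
  where
  FPT-pmax : FPT Instance.pmax
  FPT-pmax = FPT-param id
  FPT-items : FPT (λ I → itemBound (Instance.n I) (Instance.pmax I))
  FPT-items = FPT-+ (FPT-+ FPT-n (FPT-* (FPT-* FPT-n FPT-pmax) FPT-n)) FPT-n

program : Cmd
program = standalone solve

program-correct : ∀ I → ∃[ t ] t ≤ 4 + time solve (bound I) ×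
                  program on encodeInstance I outputs encodeSchedule I (proj₁ (schedule I)) inTime t
program-correct I = subst₂ (λ i o → ∃[ t ] t ≤ 4 + time solve (bound I) × program on i outputs o inTime t)
  (enc-input I) (enc-output I) (standalone-correct solve _ (bound I) (solve≤bound I))

opaque

  FPT-time : FPT (λ I → 4 + time solve (bound I))
  FPT-time = FPT-+ (FPT-const 4) (time-FPT FPT-bound solve)

mainTheorem2 : Σ[ f ∈ (ℕ → ℕ) ] ∃[ c ] ∃[ k ] c solvesOptimallyWithin λ I → let open Instance I in f pmax * (1 ⊔ (n + ⌊log₂ m ⌋)) ^ k
mainTheorem2 = proj₁ FPT-time , program , proj₁ (proj₂ FPT-time) , λ I →
  let t , t≤ , run = program-correct I in
  proj₁ (schedule I) , schedule-optimal I , t , ≤-trans t≤ (proj₂ (proj₂ FPT-time) I) , run
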